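{- For a positive proportion of primes $p$, there exist nonnegative integers $\alpha$ and $\beta$ (depending on $p$) such that $$\sum_{n=0}^{\infty} b_{25}(2pn+\alpha)\,q^n\equiv q^{\beta}\sum_{n=0}^{\infty} b_{25}(2n+1)\,q^{pn}\pmod 2.$$
   Context: For a positive integer $t$, $b_t(n)$ denotes the number of $t$-regular partitions of $n$, i.e. partitions of $n$ none of whose parts is divisible by $t$ (with $b_t(0)=1$); equivalently $\sum_{n\ge0}b_t(n)q^n=\prod_{j\ge1}\frac{1-q^{tj}}{1-q^j}$. A congruence between formal power series modulo $2$ means coefficientwise congruence. "A positive proportion of primes" means a set of primes having positive (lower) density within the set of all primes. -}

module Defs where

open import Data.Nat using (ℕ; zero; suc; _+_; _*_; _∸_; _≤_; _≤?_; _≟_)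
open import Data.Nat.Divisibility using (_∣?_)
open import Data.Nat.Primality using (prime?)
open import Data.List using (List; map; upTo)
open import Data.Nat.ListAction using (sum)
open import Data.Bool using (Bool; true; false; if_then_else_; _∧_)
open import Relation.Nullary.Decidable using (⌊_⌋)

-- pc t n k = number of partitions of n into parts from {1,…,k},
-- none of which is divisible by t.  Defined by recursion on k, summing
-- over the multiplicity j of the part (k+1).
pc : ℕ → ℕ → ℕ → ℕ
pc t zero    zero    = 1
pc t (suc n) zero    = 0
pc t n       (suc k) =
  if ⌊ t ∣? suc k ⌋
  then pc t n k
  else sum (map (λ j → if ⌊ j * suc k ≤? n ⌋ then pc t (n ∸ j * suc k) k else 0)
                (upTo (suc n)))

-- b t n = number of t-regular partitions of n (parts ≤ n suffice).
b : ℕ → ℕ → ℕ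
b t n = pc t n n

-- Coefficient of q^n in  q^β · Σ_{m≥0} a(m) q^{p m}   (for p ≥ 1 any m with
-- β + p m = n satisfies m ≤ n, so the finite range suffices).
shiftDilateCoeff : ℕ → ℕ → (ℕ → ℕ) → ℕ → ℕ
shiftDilateCoeff p β a n =
  sum (map (λ m → if ⌊ n ≟ β + p * m ⌋ then a m else 0) (upTo (suc n)))

primeCount : ℕ → ℕ
primeCount x = sum (map (λ p → if ⌊ prime? p ⌋ then 1 else 0) (upTo (suc x)))

primeCountIn : (ℕ → Bool) → ℕ → ℕ
primeCountIn S x =
  sum (map (λ p → if ⌊ prime? p ⌋ ∧ S p then 1 else 0) (upTo (suc x)))

module Submission where

-- Write C(q) = Σ c(n) q^n with c(n) = b₂₅(2 n − 1).  For α = 2 p − 1 and β = p − 1 the congruence says that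
-- c(p j) ≡ c(j / p), where c(j / p) = 0 if p ∤ j, and this is shown for all primes p ≡ ±1 (mod 5).
--
-- The reason is that, modulo 2, C = Σ q^(k²) + Σ q^(d e), over k > 0 prime to 5 and over d ≡ ±1, e ≡ ±2 (mod 5).
-- To prove this formula put A = Σ q^(5 n (5 n + 1) / 2) and w = q Σ q^(5 n (5 n + 3) / 2) / A, with n ∈ ℤ.
-- Kronecker's identity for Lambert series and a transformation of binary theta series express the four parts
-- S (k ≡ ±1), T (k ≡ ±2), L₁ (e ≡ 2 d), L₂ (e ≡ −2 d) of C as L₁ = w S, L₂ = w² S, T = w³ S.  Comparing odd and
-- even squares gives S + T⁴ = q A⁸ and T + S⁴ = q w⁸ A⁸, hence S (1 + w⁵) = w.  By Jacobi's identity the cube of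
-- G = q Π (1 − q^(25 n)) / (1 − q^n) is a quotient of theta series, which gives G (1 + w + w²) = w; now C is the
-- even part of G.
--
-- The primes ≡ ±1 (mod 5) are counted by Chebyshev's method.  With x = 10 n, the number
--   (x! n!⁶ / ((x / 2)!² (2 n)!³)) · Π_{k ≤ x} k^χ(k) · Π_{k ≤ x / 2} k^(2 χ(k)),    χ the quadratic character modulo 5,
-- is at least 4^(2 n) up to a power of x, and the prime powers ≡ ±2 (mod 5) enter it with exponents ≤ 0.

-- `w` is the Rogers-Ramanujan continued fraction r at q^5, reduced modulo 2, where the signs of its
-- theta quotient disappear. Accordingly G (1 + w + w²) = w is the reduction of Ramanujan's 1 /
-- r(q^5) - 1 - r(q^5) = Π (1 - q^n) / (q Π (1 - q^(25 n))). No modular forms occur: each series is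
-- a parity count of lattice points, so theta identities become bijections or involutions without
-- fixed points. Two relations come out only for cubes; they descend because cubing is injective on
-- series over 𝔽₂ that begin with q. Expressing everything in `w` pays off since f(q)² = f(q²) over
-- 𝔽₂, so that squares pass through the extraction of even coefficients. For p ≡ ±1 (mod 5)
-- multiplication by p preserves the classes of both d and e. The pairs with p | d and those with p
-- | e each contribute c(j), these two contributions cancel modulo 2, and c(j / p) remains.
-- Factorials alone cannot separate residue classes of primes. The products of k^χ(k) can, because
-- summing χ over multiples of a prime power multiplies the sum by its character value, and they
-- cost only a power of x in size.

module ResidueClasses where

  open import Data.Nat
  open import Data.Nat.DivMod using (_%_; %-distribˡ-*; m%n<n)
  open import Data.Bool using (Bool; true; false)
  open import Data.Sum using (_⊎_; inj₁; inj₂)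
  open import Relation.Binary.PropositionalEquality using (_≡_; refl; trans; cong)

  is-±1 is-±2 is-unit : ℕ → Bool
  is-±1 1 = true
  is-±1 4 = true
  is-±1 _ = false
  is-±2 2 = true
  is-±2 3 = true
  is-±2 _ = false
  is-unit 1 = true
  is-unit 2 = true
  is-unit 3 = true
  is-unit 4 = true
  is-unit _ = false

  class : (ℕ → Bool) → ℕ → Bool
  class f n = f (n % 5)

  ±1-residue : ∀ r → is-±1 r ≡ true → r ≡ 1 ⊎ r ≡ 4
  ±1-residue 1 _ = inj₁ refl
  ±1-residue 4 _ = inj₂ refl

  ±2-residue : ∀ r → is-±2 r ≡ true → r ≡ 2 ⊎ r ≡ 3
  ±2-residue 2 _ = inj₁ refl
  ±2-residue 3 _ = inj₂ refl

  -- Class membership depends on the residue alone, so five evaluations suffice, each closed by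
  -- `refl` for a concrete residue `i`. This moves a class predicate across multiplication by a
  -- prime or a prime power.
  class-* : ∀ (f g : ℕ → Bool) q {i} → q % 5 ≡ i → f ((i * 0) % 5) ≡ g 0 → f ((i * 1) % 5) ≡ g 1 →
            f ((i * 2) % 5) ≡ g 2 → f ((i * 3) % 5) ≡ g 3 → f ((i * 4) % 5) ≡ g 4 → ∀ k → class f (q * k) ≡ class g k
  class-* f g q refl e₀ e₁ e₂ e₃ e₄ k = trans (cong f (%-distribˡ-* q k 5)) (go (k % 5) (m%n<n k 5))
    where
    go : ∀ r → r < 5 → f ((q % 5 * r) % 5) ≡ g r
    go 0 _ = e₀
    go 1 _ = e₁
    go 2 _ = e₂
    go 3 _ = e₃
    go 4 _ = e₄
    go (suc (suc (suc (suc (suc _))))) (s≤s (s≤s (s≤s (s≤s (s≤s ())))))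

-- Formal power series over the field with two elements.

module PowerSeries where

  open import Data.Nat as ℕ using (ℕ; zero; suc; z≤n; s≤s)
  import Data.Nat.Properties as ℕ
  open import Data.Bool using (Bool; true; false; _∧_; _xor_)
  open import Data.Bool.Properties
    using (xor-assoc; xor-comm; xor-same; xor-identityʳ; ∧-comm; ∧-assoc; ∧-zeroʳ; ∧-identityʳ; ∧-distribˡ-xor;
           ∧-distribʳ-xor; xor-∧-commutativeRing)
  open import Data.Product using (_,_)
  open import Data.Maybe using (Maybe; just; nothing)
  open import Relation.Nullary using (yes; no)
  open import Relation.Binary.PropositionalEquality using (_≡_; refl; sym; trans; cong; cong₂; module ≡-Reasoning)
  open import Algebra.Bundles using (CommutativeRing)
  open import Algebra.Solver.Ring.AlmostCommutativeRing using (fromCommutativeRing; _-Raw-AlmostCommutative⟶_)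
  import Algebra.Solver.Ring
  import Relation.Binary.Reasoning.Setoid

  Series : Set
  Series = ℕ → Bool

  infix  4 _≈_
  infixl 6 _+_
  infixl 7 _*_

  record _≈_ (f g : Series) : Set where
    constructor ext
    field at : ∀ n → f n ≡ g n
  open _≈_ public

  tail : Series → Series
  tail f n = f (suc n)

  _+_ : Series → Series → Series
  (f + g) n = f n xor g n

  _*_ : Series → Series → Series
  (f * g) zero    = f 0 ∧ g 0
  (f * g) (suc n) = (f 0 ∧ g (suc n)) xor (tail f * g) n

  0ˢ 1ˢ q : Series
  0ˢ _ = false
  1ˢ zero    = true
  1ˢ (suc _) = false
  q zero    = false
  q (suc n) = 1ˢ n

  infixr 8 _·_
  _·_ : Bool → Series → Series
  (c · f) n = c ∧ f n

  ≈-refl : ∀ {f} → f ≈ f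
  ≈-refl = ext λ _ → refl

  ≈-sym : ∀ {f g} → f ≈ g → g ≈ f
  ≈-sym e = ext λ n → sym (at e n)

  ≈-trans : ∀ {f g h} → f ≈ g → g ≈ h → f ≈ h
  ≈-trans e e′ = ext λ n → trans (at e n) (at e′ n)

  xor-interchange : ∀ a b c d → (a xor b) xor (c xor d) ≡ (a xor c) xor (b xor d)
  xor-interchange a b c d = begin
    (a xor b) xor (c xor d) ≡⟨ xor-assoc a b _ ⟩
    a xor (b xor (c xor d)) ≡⟨ cong (a xor_) (sym (xor-assoc b c d)) ⟩
    a xor ((b xor c) xor d) ≡⟨ cong (λ t → a xor (t xor d)) (xor-comm b c) ⟩
    a xor ((c xor b) xor d) ≡⟨ cong (a xor_) (xor-assoc c b d) ⟩
    a xor (c xor (b xor d)) ≡⟨ sym (xor-assoc a c _) ⟩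
    (a xor c) xor (b xor d) ∎
    where open ≡-Reasoning

  +-cong : ∀ {f f′ g g′} → f ≈ f′ → g ≈ g′ → f + g ≈ f′ + g′
  +-cong e e′ = ext λ n → cong₂ _xor_ (at e n) (at e′ n)

  *-cong-≡ : ∀ {f f′ g g′} → (∀ n → f n ≡ f′ n) → (∀ n → g n ≡ g′ n) → ∀ n → (f * g) n ≡ (f′ * g′) n
  *-cong-≡ e e′ zero    = cong₂ _∧_ (e 0) (e′ 0)
  *-cong-≡ e e′ (suc n) =
    cong₂ _xor_ (cong₂ _∧_ (e 0) (e′ (suc n))) (*-cong-≡ (λ k → e (suc k)) e′ n)

  *-cong : ∀ {f f′ g g′} → f ≈ f′ → g ≈ g′ → f * g ≈ f′ * g′
  *-cong e e′ = ext (*-cong-≡ (at e) (at e′))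

  *-congˡ : ∀ f {g g′} → g ≈ g′ → f * g ≈ f * g′
  *-congˡ f = *-cong {f} ≈-refl

  +-congˡ : ∀ f {g g′} → g ≈ g′ → f + g ≈ f + g′
  +-congˡ f = +-cong {f} ≈-refl

  *-distribʳ-at : ∀ h f g n → ((f + g) * h) n ≡ (f * h) n xor (g * h) n
  *-distribʳ-at h f g zero    = ∧-distribʳ-xor (h 0) (f 0) (g 0)
  *-distribʳ-at h f g (suc n) = trans
    (cong₂ _xor_ (∧-distribʳ-xor (h (suc n)) (f 0) (g 0)) (*-distribʳ-at h (tail f) (tail g) n))
    (xor-interchange (f 0 ∧ h (suc n)) _ _ _)

  ·-*-at : ∀ c f g n → ((c · f) * g) n ≡ c ∧ (f * g) n
  ·-*-at c f g zero    = ∧-assoc c (f 0) (g 0)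
  ·-*-at c f g (suc n) = trans
    (cong₂ _xor_ (∧-assoc c (f 0) (g (suc n))) (·-*-at c (tail f) g n))
    (sym (∧-distribˡ-xor c _ _))

  *-suc : ∀ f g n → (f * g) (suc n) ≡ (f * tail g) n xor (f (suc n) ∧ g 0)
  *-suc f g zero    = refl
  *-suc f g (suc n) = trans (cong ((f 0 ∧ g (suc (suc n))) xor_) (*-suc (tail f) g n))
                            (sym (xor-assoc (f 0 ∧ g (suc (suc n))) _ _))

  *-comm-at : ∀ n f g → (f * g) n ≡ (g * f) n
  *-comm-at zero    f g = ∧-comm (f 0) (g 0)
  *-comm-at (suc n) f g = begin
    (f 0 ∧ g (suc n)) xor (tail f * g) n ≡⟨ cong₂ _xor_ (∧-comm (f 0) _) (*-comm-at n (tail f) g) ⟩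
    (g (suc n) ∧ f 0) xor (g * tail f) n ≡⟨ xor-comm _ ((g * tail f) n) ⟩
    (g * tail f) n xor (g (suc n) ∧ f 0) ≡⟨ sym (*-suc g f n) ⟩
    (g * f) (suc n)                      ∎
    where open ≡-Reasoning

  *-assoc-at : ∀ n f g h → ((f * g) * h) n ≡ (f * (g * h)) n
  *-assoc-at zero    f g h = ∧-assoc (f 0) (g 0) (h 0)
  *-assoc-at (suc n) f g h = begin
    ((f 0 ∧ g 0) ∧ h (suc n)) xor (tail (f * g) * h) n
      ≡⟨ cong₂ _xor_ (∧-assoc (f 0) (g 0) (h (suc n))) (*-distribʳ-at h (f 0 · tail g) (tail f * g) n) ⟩
    (f 0 ∧ (g 0 ∧ h (suc n))) xor (((f 0 · tail g) * h) n xor ((tail f * g) * h) n)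
      ≡⟨ cong ((f 0 ∧ (g 0 ∧ h (suc n))) xor_)
           (cong₂ _xor_ (·-*-at (f 0) (tail g) h n) (*-assoc-at n (tail f) g h)) ⟩
    (f 0 ∧ (g 0 ∧ h (suc n))) xor ((f 0 ∧ (tail g * h) n) xor (tail f * (g * h)) n)
      ≡⟨ sym (xor-assoc (f 0 ∧ (g 0 ∧ h (suc n))) _ _) ⟩
    ((f 0 ∧ (g 0 ∧ h (suc n))) xor (f 0 ∧ (tail g * h) n)) xor (tail f * (g * h)) n
      ≡⟨ cong (_xor (tail f * (g * h)) n) (sym (∧-distribˡ-xor (f 0) _ _)) ⟩
    (f 0 ∧ (g * h) (suc n)) xor (tail f * (g * h)) n ∎
    where open ≡-Reasoning

  0*-at : ∀ g n → (0ˢ * g) n ≡ false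
  0*-at g zero    = refl
  0*-at g (suc n) = 0*-at g n

  1*-at : ∀ g n → (1ˢ * g) n ≡ g n
  1*-at g zero    = refl
  1*-at g (suc n) = trans (cong (g (suc n) xor_) (0*-at g n)) (xor-identityʳ _)

  q*-suc : ∀ g n → (q * g) (suc n) ≡ g n
  q*-suc g n = 1*-at g n

  seriesRing : CommutativeRing _ _
  seriesRing = record
    { Carrier = Series ; _≈_ = _≈_ ; _+_ = _+_ ; _*_ = _*_ ; -_ = λ f → f ; 0# = 0ˢ ; 1# = 1ˢ
    ; isCommutativeRing = record
      { isRing = record
        { +-isAbelianGroup = record
          { isGroup = record
            { isMonoid = record
              { isSemigroup = record
                { isMagma = record
                  { isEquivalence = record { refl = ≈-refl ; sym = ≈-sym ; trans = ≈-trans }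
                  ; ∙-cong = +-cong }
                ; assoc = λ f g h → ext λ n → xor-assoc (f n) (g n) (h n) }
              ; identity = (λ f → ext λ n → refl) , (λ f → ext λ n → xor-identityʳ (f n)) }
            ; inverse = (λ f → ext λ n → xor-same (f n)) , (λ f → ext λ n → xor-same (f n))
            ; ⁻¹-cong = λ e → e }
          ; comm = λ f g → ext λ n → xor-comm (f n) (g n) }
        ; *-cong = *-cong
        ; *-assoc = λ f g h → ext λ n → *-assoc-at n f g h
        ; *-identity = (λ f → ext (1*-at f)) ,
                       (λ f → ext λ n → trans (*-comm-at n f 1ˢ) (1*-at f n))
        ; distrib = (λ h f g → ext λ n → trans (*-comm-at n h (f + g)) (trans (*-distribʳ-at h f g n)
                                    (cong₂ _xor_ (*-comm-at n f h) (*-comm-at n g h)))) ,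
                    (λ h f g → ext (*-distribʳ-at h f g)) }
      ; *-comm = λ f g → ext λ n → *-comm-at n f g } }

  open CommutativeRing seriesRing public using (setoid; semiring)
    renaming (+-comm to +ˢ-comm; *-comm to *ˢ-comm; *-assoc to *ˢ-assoc; +-assoc to +ˢ-assoc;
              *-identityˡ to *ˢ-identityˡ)
  open import Algebra.Properties.Semiring.Exp semiring public using (_^_; ^-congˡ)

  const : Bool → Series
  const true  = 1ˢ
  const false = 0ˢ

  const-homomorphism : CommutativeRing.rawRing xor-∧-commutativeRing
                         -Raw-AlmostCommutative⟶ fromCommutativeRing seriesRing
  const-homomorphism = record
    { ⟦_⟧ = const
    ; +-homo = λ { true true → ext λ { zero → refl ; (suc n) → refl }
                 ; true false → ext λ { zero → refl ; (suc n) → refl }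
                 ; false y → ≈-refl }
    ; *-homo = λ { true y → ≈-sym (ext (1*-at (const y))) ; false y → ≈-sym (ext (0*-at (const y))) }
    ; -‿homo = λ _ → ≈-refl
    ; 0-homo = ≈-refl
    ; 1-homo = ≈-refl }

  const-≟ : ∀ b c → Maybe (const b ≈ const c)
  const-≟ true  true  = just ≈-refl
  const-≟ false false = just ≈-refl
  const-≟ _     _     = nothing

  -- With the two-element field as coefficient ring the solver cancels `f + f`, so identities
  -- special to characteristic 2 are settled by normalisation.
  module SeriesSolver = Algebra.Solver.Ring
    (CommutativeRing.rawRing xor-∧-commutativeRing) (fromCommutativeRing seriesRing) const-homomorphism
    const-≟

  module ≈-Reasoning = Relation.Binary.Reasoning.Setoid setoid

  shift : ℕ → Series → Series
  shift zero    f = f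
  shift (suc k) f zero    = false
  shift (suc k) f (suc n) = shift k f n

  q^-shift : ∀ k f → q ^ k * f ≈ shift k f
  q^-shift zero    f = ext (1*-at f)
  q^-shift (suc k) f = ≈-trans (*ˢ-assoc q (q ^ k) f) (ext go)
    where
    go : ∀ n → (q * (q ^ k * f)) n ≡ shift (suc k) f n
    go zero    = refl
    go (suc n) = trans (q*-suc (q ^ k * f) n) (at (q^-shift k f) n)

  -- The lowest coefficient of `g` that could be nonzero appears unchanged in the product, because
  -- `f` has constant term 1.
  unit-cancel-at : ∀ f g → f 0 ≡ true → f * g ≈ 0ˢ → ∀ n → (∀ k → k ℕ.< n → g k ≡ false) → g n ≡ false
  unit-cancel-at f g f₀ e n below = trans (sym (last g n below)) (trans (*-comm-at n g f) (at e n))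
    where
    last : ∀ g n → (∀ k → k ℕ.< n → g k ≡ false) → (g * f) n ≡ g n
    last g zero below = trans (cong (g 0 ∧_) f₀) (∧-identityʳ (g 0))
    last g (suc n) below =
      trans (cong (λ t → (t ∧ f (suc n)) xor (tail g * f) n) (below 0 (s≤s z≤n)))
            (last (tail g) n (λ k k<n → below (suc k) (s≤s k<n)))

  unit-cancel₀ : ∀ {f g} → f 0 ≡ true → f * g ≈ 0ˢ → g ≈ 0ˢ
  unit-cancel₀ {f} {g} f₀ e = ext λ n → all n n ℕ.≤-refl
    where
    all : ∀ n k → k ℕ.≤ n → g k ≡ false
    all n zero k≤n = unit-cancel-at f g f₀ e 0 (λ _ ())
    all (suc n) (suc k) (s≤s k≤n) =
      unit-cancel-at f g f₀ e (suc k) (λ j j<k → all n j (ℕ.≤-trans (ℕ.≤-pred j<k) k≤n))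

  +≈0⇒≈ : ∀ {f g} → f + g ≈ 0ˢ → f ≈ g
  +≈0⇒≈ {f} {g} e = begin
    f             ≈⟨ solve 2 (λ f g → f := (f :+ g) :+ g) ≈-refl f g ⟩
    (f + g) + g   ≈⟨ +-cong e ≈-refl ⟩
    g             ∎
    where open ≈-Reasoning
          open SeriesSolver

  ≈⇒+≈0 : ∀ {f g} → f ≈ g → f + g ≈ 0ˢ
  ≈⇒+≈0 {f} {g} e = ≈-trans (+-cong e ≈-refl) (ext λ n → xor-same (g n))

  unit-cancel : ∀ {f g h} → f 0 ≡ true → f * g ≈ f * h → g ≈ h
  unit-cancel {f} {g} {h} f₀ e = +≈0⇒≈ (unit-cancel₀ f₀ (≈-trans
    (solve 3 (λ f g h → f :* (g :+ h) := f :* g :+ f :* h) ≈-refl f g h) (≈⇒+≈0 e)))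
    where open SeriesSolver

  q-cancel : ∀ {f g} → q * f ≈ q * g → f ≈ g
  q-cancel {f} {g} e = ext λ n → trans (sym (q*-suc f n)) (trans (at e (suc n)) (q*-suc g n))

  q*tail : ∀ f → f 0 ≡ false → f ≈ q * tail f
  q*tail f f₀ = ext λ { zero → f₀ ; (suc n) → sym (q*-suc (tail f) n) }

  -- Over 𝔽₂ the sum a² + ab + b² has constant term 1 when a and b have.
  unit-cube-injective : ∀ {a b} → a 0 ≡ true → b 0 ≡ true → a * (a * a) ≈ b * (b * b) → a ≈ b
  unit-cube-injective {a} {b} a₀ b₀ e = +≈0⇒≈ (unit-cancel₀ {f = a * a + a * b + b * b} const-1 (begin
    (a * a + a * b + b * b) * (a + b)
      ≈⟨ solve 2 (λ a b → (a :* a :+ a :* b :+ b :* b) :* (a :+ b)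
                          := a :* (a :* a) :+ b :* (b :* b)) ≈-refl a b ⟩
    a * (a * a) + b * (b * b) ≈⟨ ≈⇒+≈0 e ⟩
    0ˢ ∎))
    where
    open ≈-Reasoning
    open SeriesSolver
    const-1 : (a * a + a * b + b * b) 0 ≡ true
    const-1 rewrite a₀ | b₀ = refl

  -- Both series are q times a series with constant term 1, so q³ can be cancelled. This is how
  -- relations obtained only between cubes are turned into relations between the series themselves.
  cube-injective : ∀ {a b} → a 0 ≡ false → b 0 ≡ false → a 1 ≡ true → b 1 ≡ true →
                   a * (a * a) ≈ b * (b * b) → a ≈ b
  cube-injective {a} {b} a₀ b₀ a₁ b₁ e = begin
    a           ≈⟨ q*tail a a₀ ⟩
    q * tail a  ≈⟨ *-cong ≈-refl (unit-cube-injective a₁ b₁ (q-cancel (q-cancel (q-cancel (begin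
        q * (q * (q * (tail a * (tail a * tail a)))) ≈⟨ pull (tail a) ⟩
        (q * tail a) * ((q * tail a) * (q * tail a)) ≈⟨ cube a a₀ ⟨
        a * (a * a)                                  ≈⟨ e ⟩
        b * (b * b)                                  ≈⟨ cube b b₀ ⟩
        (q * tail b) * ((q * tail b) * (q * tail b)) ≈⟨ pull (tail b) ⟨
        q * (q * (q * (tail b * (tail b * tail b)))) ∎))))) ⟩
    q * tail b  ≈⟨ q*tail b b₀ ⟨
    b           ∎
    where
    open ≈-Reasoning
    open SeriesSolver
    pull : ∀ t → q * (q * (q * (t * (t * t)))) ≈ (q * t) * ((q * t) * (q * t))
    pull = solve 2 (λ q t → q :* (q :* (q :* (t :* (t :* t)))) := (q :* t) :* ((q :* t) :* (q :* t))) ≈-refl q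
    cube : ∀ f → f 0 ≡ false → f * (f * f) ≈ (q * tail f) * ((q * tail f) * (q * tail f))
    cube f f₀ = *-cong (q*tail f f₀) (*-cong (q*tail f f₀) (q*tail f f₀))

  -- meaningful only for series with constant term 1
  inverse-prefix : Series → ℕ → Series
  inverse-prefix f zero    = 1ˢ
  inverse-prefix f (suc n) = inverse-prefix f n + shift (suc n) (const ((f * inverse-prefix f n) (suc n)))

  inverse : Series → Series
  inverse f n = inverse-prefix f n n

  *-local : ∀ f {g h} n → (∀ k → k ℕ.≤ n → g k ≡ h k) → (f * g) n ≡ (f * h) n
  *-local f zero    e = cong (f 0 ∧_) (e 0 z≤n)
  *-local f (suc n) e = cong₂ _xor_ (cong (f 0 ∧_) (e (suc n) ℕ.≤-refl))
                                    (*-local (tail f) n (λ k k≤n → e k (ℕ.m≤n⇒m≤1+n k≤n)))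

  shift-< : ∀ k f n → n ℕ.< k → shift k f n ≡ false
  shift-< (suc k) f zero    _ = refl
  shift-< (suc k) f (suc n) (s≤s n<k) = shift-< k f n n<k

  *-shift : ∀ f k g n → (f * shift k g) n ≡ shift k (f * g) n
  *-shift f zero    g n = refl
  *-shift f (suc k) g zero = ∧-zeroʳ (f 0)
  *-shift f (suc k) g (suc n) = begin
    (f * shift (suc k) g) (suc n)          ≡⟨ *-suc f (shift (suc k) g) n ⟩
    (f * shift k g) n xor (f (suc n) ∧ false) ≡⟨ cong ((f * shift k g) n xor_) (∧-zeroʳ (f (suc n))) ⟩
    (f * shift k g) n xor false            ≡⟨ xor-identityʳ _ ⟩
    (f * shift k g) n                      ≡⟨ *-shift f k g n ⟩
    shift k (f * g) n                      ∎
    where open ≡-Reasoning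

  shift-diag : ∀ k f → shift k f k ≡ f 0
  shift-diag zero    f = refl
  shift-diag (suc k) f = shift-diag k f

  -- The term added at place n + 1 is exactly the error of the current product there; since `f` has
  -- constant term 1 it cancels that error and leaves the lower places alone.
  inverse-prefix-inverse : ∀ f → f 0 ≡ true → ∀ n k → k ℕ.≤ n → (f * inverse-prefix f n) k ≡ 1ˢ k
  inverse-prefix-inverse f f₀ zero zero z≤n = trans (∧-identityʳ (f 0)) f₀
  inverse-prefix-inverse f f₀ (suc n) k k≤ = begin
    (f * (p + shift (suc n) c)) k             ≡⟨ *-comm-at k f _ ⟩
    ((p + shift (suc n) c) * f) k             ≡⟨ *-distribʳ-at f p (shift (suc n) c) k ⟩
    (p * f) k xor (shift (suc n) c * f) k     ≡⟨ cong₂ _xor_ (*-comm-at k p f) (*-comm-at k _ f) ⟩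
    (f * p) k xor (f * shift (suc n) c) k     ≡⟨ cong ((f * p) k xor_) (*-shift f (suc n) c k) ⟩
    (f * p) k xor shift (suc n) (f * c) k     ≡⟨ split (k ℕ.≟ suc n) ⟩
    1ˢ k                                      ∎
    where
    open ≡-Reasoning
    p = inverse-prefix f n
    c = const ((f * p) (suc n))
    const-at-0 : ∀ b → const b 0 ≡ b
    const-at-0 true  = refl
    const-at-0 false = refl
    split : Relation.Nullary.Dec (k ≡ suc n) → (f * p) k xor shift (suc n) (f * c) k ≡ 1ˢ k
    split (yes refl) = trans (cong ((f * p) (suc n) xor_) (trans (shift-diag (suc n) (f * c))
      (trans (cong (_∧ c 0) f₀) (const-at-0 ((f * p) (suc n)))))) (xor-same ((f * p) (suc n)))
    split (no k≢) = trans (cong ((f * p) k xor_) (shift-< (suc n) (f * c) k k<))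
      (trans (xor-identityʳ _) (inverse-prefix-inverse f f₀ n k (ℕ.≤-pred k<)))
      where k< = ℕ.≤∧≢⇒< k≤ k≢

  inverse-prefix-stable : ∀ f n k → k ℕ.≤ n → inverse-prefix f n k ≡ inverse f k
  inverse-prefix-stable f zero    zero z≤n = refl
  inverse-prefix-stable f (suc n) k k≤ with k ℕ.≟ suc n
  ... | yes refl = refl
  ... | no  k≢   = trans (cong (inverse-prefix f n k xor_) (shift-< (suc n) _ k k<))
      (trans (xor-identityʳ _) (inverse-prefix-stable f n k (ℕ.≤-pred k<)))
      where k< = ℕ.≤∧≢⇒< k≤ k≢

  *-inverse : ∀ f → f 0 ≡ true → f * inverse f ≈ 1ˢ
  *-inverse f f₀ = ext λ n → trans
    (*-local f n (λ k k≤n → sym (inverse-prefix-stable f n k k≤n)))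
    (inverse-prefix-inverse f f₀ n n ℕ.≤-refl)

  double : ℕ → ℕ
  double zero    = zero
  double (suc n) = suc (suc (double n))

  even-part : Series → Series
  even-part f n = f (double n)

  even-part-cong : ∀ {f g} → f ≈ g → even-part f ≈ even-part g
  even-part-cong e = ext λ n → at e (double n)

  const-suc : ∀ b n → const b (suc n) ≡ false
  const-suc true  n = refl
  const-suc false n = refl

  head-tail : ∀ f → f ≈ const (f 0) + q * tail f
  head-tail f = ext λ { zero → zero-at (f 0) ; (suc n) → sym (cong₂ _xor_ (const-suc (f 0) n) (q*-suc (tail f) n)) }
    where
    zero-at : ∀ b → b ≡ const b 0 xor false
    zero-at true  = refl
    zero-at false = refl

  const-idem : ∀ b → const b * const b ≈ const b
  const-idem true  = ext (1*-at 1ˢ)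
  const-idem false = ext (0*-at 0ˢ)

  const-* : ∀ b f n → (const b * f) n ≡ b ∧ f n
  const-* true  f n = 1*-at f n
  const-* false f n = 0*-at f n

  -- In characteristic 2 the cross terms in the square of `const (f 0) + q * tail f` cancel.
  square-unfold : ∀ f g → f * f * g ≈ const (f 0) * g + q * (q * (tail f * tail f * g))
  square-unfold f g = begin
    f * f * g
      ≈⟨ *-cong (*-cong (head-tail f) (head-tail f)) ≈-refl ⟩
    (c + q * t) * (c + q * t) * g
      ≈⟨ solve 4 (λ c q t g → (c :+ q :* t) :* (c :+ q :* t) :* g
                           := c :* c :* g :+ q :* (q :* (t :* t :* g))) ≈-refl c q t g ⟩
    c * c * g + q * (q * (t * t * g))
      ≈⟨ +-cong (*-cong (const-idem (f 0)) ≈-refl) ≈-refl ⟩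
    c * g + q * (q * (t * t * g)) ∎
    where
    open ≈-Reasoning
    open SeriesSolver
    c = const (f 0)
    t = tail f

  -- Over 𝔽₂ the square of f(q) is f(q²), which involves even exponents only and therefore leaves
  -- the extraction of even coefficients as f(q).
  even-part-square-* : ∀ f g → even-part (f * f * g) ≈ f * even-part g
  even-part-square-* f g = ext λ n → go n f
    where
    open ≡-Reasoning
    go : ∀ n f → (f * f * g) (double n) ≡ (f * even-part g) n
    go zero f with f 0
    ... | true  = refl
    ... | false = refl
    go (suc n) f = begin
      (f * f * g) (double (suc n))
        ≡⟨ at (square-unfold f g) (double (suc n)) ⟩
      (const (f 0) * g) (double (suc n)) xor (q * (q * (tail f * tail f * g))) (double (suc n))
        ≡⟨ cong₂ _xor_ (const-* (f 0) g (double (suc n)))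
             (trans (q*-suc (q * (tail f * tail f * g)) (suc (double n)))
                    (q*-suc (tail f * tail f * g) (double n))) ⟩
      (f 0 ∧ even-part g (suc n)) xor (tail f * tail f * g) (double n)
        ≡⟨ cong ((f 0 ∧ even-part g (suc n)) xor_) (go n (tail f)) ⟩
      (f * even-part g) (suc n) ∎

  even-part-square : ∀ f → even-part (f * f) ≈ f
  even-part-square f = begin
    even-part (f * f)        ≈⟨ even-part-cong (solve 1 (λ f → f :* f := f :* f :* con true) ≈-refl f) ⟩
    even-part (f * f * 1ˢ)   ≈⟨ even-part-square-* f 1ˢ ⟩
    f * even-part 1ˢ         ≈⟨ *-congˡ f (ext λ { zero → refl ; (suc n) → refl }) ⟩
    f * 1ˢ                   ≈⟨ solve 1 (λ f → f :* con true := f) ≈-refl f ⟩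
    f                        ∎
    where open ≈-Reasoning
          open SeriesSolver

  square-unfold₁ : ∀ f → f * f ≈ const (f 0) + q * (q * (tail f * tail f))
  square-unfold₁ f = begin
    f * f                                            ≈⟨ solve 1 (λ f → f :* f := f :* f :* con true) ≈-refl f ⟩
    f * f * 1ˢ                                       ≈⟨ square-unfold f 1ˢ ⟩
    c * 1ˢ + q * (q * (t * t * 1ˢ))                  ≈⟨ solve 3 (λ c q t → c :* con true :+ q :* (q :* (t :* t :* con true))
                                                                         := c :+ q :* (q :* (t :* t))) ≈-refl c q t ⟩
    c + q * (q * (t * t))                            ∎
    where
    open ≈-Reasoning
    open SeriesSolver
    c = const (f 0)
    t = tail f

  square-odd : ∀ n f → (f * f) (suc (double n)) ≡ false
  square-odd zero    f = trans (at (square-unfold₁ f) 1)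
    (cong₂ _xor_ (const-suc (f 0) 0) (q*-suc (q * (tail f * tail f)) 0))
  square-odd (suc n) f = trans (at (square-unfold₁ f) (suc (double (suc n))))
    (cong₂ _xor_ (const-suc (f 0) (double (suc n)))
      (trans (q*-suc (q * (tail f * tail f)) (double (suc n)))
        (trans (q*-suc (tail f * tail f) (suc (double n))) (square-odd n (tail f)))))

  even-part-q-square : ∀ f → even-part (q * (f * f)) ≈ 0ˢ
  even-part-q-square f = ext λ { zero → refl ; (suc n) → trans (q*-suc (f * f) (suc (double n))) (square-odd n f) }

-- Parities of finite sets and generating functions of weighted sets.

module WeightedSets where

  open PowerSeries
  open import Data.Nat as ℕ using (ℕ; zero; suc)
  import Data.Nat.Properties as ℕ
  open import Data.Integer as ℤ using (ℤ; +_)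
  import Data.Integer.Properties as ℤ
  open import Data.Bool as Bool using (Bool; true; false; not; _∧_; _xor_)
  import Data.Bool.Properties as Bool
  open import Data.Bool.Properties using (xor-same; xor-identityʳ)
  open import Data.Empty using (⊥-elim)
  open import Data.List using (List; []; _∷_; _++_; map; length; filter; cartesianProduct)
  open import Data.List.Properties using (length-++; length-map)
  open import Data.List.Membership.Propositional using (_∈_)
  open import Data.List.Membership.Propositional.Properties
    using (∈-map⁺; ∈-map⁻; ∈-filter⁺; ∈-filter⁻; ∈-++⁺ˡ; ∈-++⁺ʳ; ∈-++⁻; ∈-cartesianProduct⁺; ∈-cartesianProduct⁻)
  open import Data.List.Membership.Propositional.Properties.WithK using (unique∧set⇒bag)
  open import Data.List.Relation.Binary.BagAndSetEquality using (∼bag⇒↭)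
  open import Data.List.Relation.Binary.Permutation.Propositional.Properties using (↭-length)
  open import Data.List.Relation.Unary.All as All using (All; []; _∷_)
  open import Data.List.Relation.Unary.AllPairs using ([]; _∷_)
  open import Data.List.Relation.Unary.Unique.Propositional using (Unique)
  import Data.List.Relation.Unary.Unique.Propositional.Properties as Unique
  open import Data.Product using (∃; ∃₂; _×_; _,_; proj₁; proj₂)
  open import Data.Sum using (_⊎_; inj₁; inj₂)
  open import Function.Bundles using (mk⇔)
  open import Relation.Nullary using (¬_; Dec)
  open import Relation.Binary.PropositionalEquality
    using (_≡_; _≢_; refl; sym; trans; cong; cong₂; subst; module ≡-Reasoning)

  odd : ℕ → Bool
  odd zero    = false
  odd (suc n) = not (odd n)

  odd-+ : ∀ m n → odd (m ℕ.+ n) ≡ odd m xor odd n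
  odd-+ zero    n = refl
  odd-+ (suc m) n = trans (cong not (odd-+ m n)) (Bool.not-distribˡ-xor (odd m) (odd n))

  odd-* : ∀ m n → odd (m ℕ.* n) ≡ odd m ∧ odd n
  odd-* zero    n = refl
  odd-* (suc m) n = trans (odd-+ n (m ℕ.* n)) (trans (cong (odd n xor_) (odd-* m n)) (lemma (odd m) (odd n)))
    where
    lemma : ∀ a b → b xor (a ∧ b) ≡ not a ∧ b
    lemma true  b = xor-same b
    lemma false b = xor-identityʳ b

  -- A finite set with a chosen enumeration. Coefficients modulo 2 are parities of such sets, so
  -- equalities of coefficients can be proved by bijections and pairings.
  record Count {I : Set} (P : I → Set) : Set where
    field
      list     : List I
      unique   : Unique list
      sound    : ∀ {i} → i ∈ list → P i
      complete : ∀ {i} → P i → i ∈ list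

    parity : Bool
    parity = odd (length list)

  open Count

  map-unique : ∀ {I J : Set} {P : I → Set} (f : I → J) → (∀ {i i′} → P i → P i′ → f i ≡ f i′ → i ≡ i′) →
               ∀ {xs} → All P xs → Unique xs → Unique (map f xs)
  map-unique f inj [] [] = []
  map-unique {P = P} f inj {x ∷ xs} (px ∷ pxs) (x∉ ∷ u) = apart pxs x∉ ∷ map-unique f inj pxs u
    where
    apart : ∀ {ys} → All P ys → All (x ≢_) ys → All (f x ≢_) (map f ys)
    apart [] [] = []
    apart (py ∷ pys) (x≢y ∷ x≢ys) = (λ e → x≢y (inj px py e)) ∷ apart pys x≢ys

  count-map : ∀ {I J : Set} {P : I → Set} {Q : J → Set} (f : I → J) (g : J → I) →
              (∀ {i} → P i → Q (f i)) → (∀ {j} → Q j → P (g j)) →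
              (∀ {i} → P i → g (f i) ≡ i) → (∀ {j} → Q j → f (g j) ≡ j) → Count P → Count Q
  count-map {P = P} {Q} f g Pf Qg gf fg c = record
    { list = map f (list c)
    ; unique = map-unique f (λ p p′ e → trans (sym (gf p)) (trans (cong g e) (gf p′)))
                          (All.tabulate (sound c)) (unique c)
    ; sound = λ j∈ → let (i , i∈ , e) = ∈-map⁻ f j∈ in subst Q (sym e) (Pf (sound c i∈))
    ; complete = λ q → subst (_∈ map f (list c)) (fg q) (∈-map⁺ f (complete c (Qg q))) }

  -- Two enumerations of one set without repetitions are permutations of each other, so the parity
  -- belongs to the set.
  parity-unique : ∀ {I : Set} {P Q : I → Set} (c : Count P) (d : Count Q) →
                  (∀ {i} → P i → Q i) → (∀ {i} → Q i → P i) → parity c ≡ parity d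
  parity-unique c d PQ QP = cong odd (↭-length (∼bag⇒↭ (unique∧set⇒bag (unique c) (unique d)
    (mk⇔ (λ i∈ → complete d (PQ (sound c i∈))) (λ i∈ → complete c (QP (sound d i∈)))))))

  parity-bijection : ∀ {I J : Set} {P : I → Set} {Q : J → Set} (f : I → J) (g : J → I) →
    (∀ {i} → P i → Q (f i)) → (∀ {j} → Q j → P (g j)) →
    (∀ {i} → P i → g (f i) ≡ i) → (∀ {j} → Q j → f (g j) ≡ j) →
    (c : Count P) (d : Count Q) → parity c ≡ parity d
  parity-bijection f g Pf Qg gf fg c d = trans (cong odd (sym (length-map f (list c))))
    (parity-unique (count-map f g Pf Qg gf fg c) d (λ q → q) (λ q → q))

  count-filter : ∀ {I : Set} {P : I → Set} (L : List I) → Unique L → (∀ i → Dec (P i)) →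
                 (∀ {i} → P i → i ∈ L) → Count P
  count-filter L u P? ⊆L = record
    { list = filter P? L ; unique = Unique.filter⁺ P? u
    ; sound = λ i∈ → proj₂ (∈-filter⁻ P? {xs = L} i∈) ; complete = λ p → ∈-filter⁺ P? (⊆L p) p }

  restrict : ∀ {I : Set} {P : I → Set} → Count P → (H : I → Bool) (b : Bool) → Count (λ i → P i × H i ≡ b)
  restrict c H b = record
    { list = filter H? (list c) ; unique = Unique.filter⁺ H? (unique c)
    ; sound = λ i∈ → let (i∈′ , h) = ∈-filter⁻ H? {xs = list c} i∈ in sound c i∈′ , h
    ; complete = λ { (p , h) → ∈-filter⁺ H? (complete c p) h } }
    where H? = λ i → H i Bool.≟ b

  union : ∀ {I : Set} {P Q : I → Set} → (∀ {i} → P i → ¬ Q i) → Count P → Count Q → Count (λ i → P i ⊎ Q i)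
  union disj c d = record
    { list = list c ++ list d
    ; unique = Unique.++⁺ (unique c) (unique d) (λ { (i∈c , i∈d) → disj (sound c i∈c) (sound d i∈d) })
    ; sound = λ i∈ → Data.Sum.map (sound c) (sound d) (∈-++⁻ (list c) i∈)
    ; complete = λ { (inj₁ p) → ∈-++⁺ˡ (complete c p) ; (inj₂ q) → ∈-++⁺ʳ (list c) (complete d q) } }

  parity-union : ∀ {I : Set} {P Q : I → Set} (disj : ∀ {i} → P i → ¬ Q i) (c : Count P) (d : Count Q) →
                 parity (union disj c d) ≡ parity c xor parity d
  parity-union disj c d = trans (cong odd (length-++ (list c))) (odd-+ (length (list c)) _)

  parity-split : ∀ {I : Set} {P : I → Set} (c : Count P) (H : I → Bool) →
                 parity c ≡ parity (restrict c H true) xor parity (restrict c H false)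
  parity-split c H = trans
    (parity-unique c (union disj (restrict c H true) (restrict c H false)) (λ p → split p _ refl)
      (λ { (inj₁ (p , _)) → p ; (inj₂ (p , _)) → p }))
    (parity-union disj (restrict c H true) (restrict c H false))
    where
    disj : ∀ {i} → _ × H i ≡ true → ¬ (_ × H i ≡ false)
    disj (_ , t) (_ , f) with () ← trans (sym t) f
    split : ∀ {i} → _ → ∀ b → H i ≡ b → (_ × H i ≡ true) ⊎ (_ × H i ≡ false)
    split p true  e = inj₁ (p , e)
    split p false e = inj₂ (p , e)

  -- `φ` exchanges the half where `H` is true with the half where it is false. The function `H` thus
  -- witnesses that `φ` has no fixed point and selects one member of each pair.
  parity-involution : ∀ {I : Set} {P : I → Set} (φ : I → I) (H : I → Bool) →
    (∀ {i} → P i → P (φ i)) → (∀ {i} → P i → φ (φ i) ≡ i) → (∀ {i} → P i → H (φ i) ≡ not (H i)) →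
    (c : Count P) → parity c ≡ false
  parity-involution φ H Pφ φφ Hφ c = begin
    parity c ≡⟨ parity-split c H ⟩
    parity (restrict c H true) xor parity (restrict c H false)
      ≡⟨ cong (_xor parity (restrict c H false)) (parity-bijection φ φ
           (λ { (p , h) → Pφ p , trans (Hφ p) (cong not h) })
           (λ { (p , h) → Pφ p , trans (Hφ p) (cong not h) })
           (λ { (p , _) → φφ p }) (λ { (p , _) → φφ p }) (restrict c H true) (restrict c H false)) ⟩
    parity (restrict c H false) xor parity (restrict c H false)
      ≡⟨ xor-same (parity (restrict c H false)) ⟩
    false ∎
    where open ≡-Reasoning

  -- Two subsets X, Y of W have the same parity if their symmetric difference carries such an involution.
  parity-symmetric-difference : ∀ {I : Set} {W : I → Set} {X Y : I → Bool} (φ : I → I) (H : I → Bool) →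
    (∀ {i} → W i → W (φ i)) → (∀ {i} → W i → φ (φ i) ≡ i) →
    (∀ {i} → W i → X i xor Y i ≡ true → X (φ i) xor Y (φ i) ≡ true) →
    (∀ {i} → W i → X i xor Y i ≡ true → H (φ i) ≡ not (H i)) →
    (c : Count (λ i → W i × X i ≡ true)) (d : Count (λ i → W i × Y i ≡ true)) → parity c ≡ parity d
  parity-symmetric-difference {W = W} {X} {Y} φ H Wφ φφ XYφ Hφ c d = begin
    parity c                   ≡⟨ parity-split c Y ⟩
    parity cY xor parity c¬Y   ≡⟨ cong (parity cY xor_) c≡d ⟩
    parity cY xor parity d¬X   ≡⟨ cong (_xor parity d¬X) (parity-unique cY dX swap swap) ⟩
    parity dX xor parity d¬X   ≡⟨ sym (parity-split d X) ⟩
    parity d                   ∎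
    where
    open ≡-Reasoning
    cY = restrict c Y true ; c¬Y = restrict c Y false ; dX = restrict d X true ; d¬X = restrict d X false
    swap : ∀ {A B C : Set} → (A × B) × C → (A × C) × B
    swap ((a , b) , c) = (a , c) , b
    disj : ∀ {i} → (W i × X i ≡ true) × Y i ≡ false → ¬ ((W i × Y i ≡ true) × X i ≡ false)
    disj ((_ , x) , _) (_ , x′) with () ← trans (sym x) x′
    P = λ i → ((W i × X i ≡ true) × Y i ≡ false) ⊎ ((W i × Y i ≡ true) × X i ≡ false)
    toXor : ∀ {i} → P i → W i × X i xor Y i ≡ true
    toXor (inj₁ ((w , x) , y)) = w , cong₂ _xor_ x y
    toXor (inj₂ ((w , y) , x)) = w , cong₂ _xor_ x y
    fromXor : ∀ {i} → W i → ∀ x y → X i ≡ x → Y i ≡ y → x xor y ≡ true → P i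
    fromXor w true  false ex ey _ = inj₁ ((w , ex) , ey)
    fromXor w false true  ex ey _ = inj₂ ((w , ey) , ex)
    Pφ : ∀ {i} → P i → P (φ i)
    Pφ p = let (w , e) = toXor p in fromXor (Wφ w) _ _ refl refl (XYφ w e)
    xor-false : ∀ a b → a xor b ≡ false → a ≡ b
    xor-false true  true  _ = refl
    xor-false false false _ = refl
    c≡d : parity c¬Y ≡ parity d¬X
    c≡d = xor-false _ _ (trans (sym (parity-union disj c¬Y d¬X))
      (parity-involution φ H Pφ (λ p → φφ (proj₁ (toXor p)))
                         (λ p → let (w , e) = toXor p in Hφ w e) (union disj c¬Y d¬X)))

  -- Generating functions of weighted sets: w is the weight and X the characteristic function.

  Level : ∀ {I : Set} → (I → ℤ) → (I → Bool) → ℕ → I → Set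
  Level w X n i = w i ≡ + n × X i ≡ true

  Gen : ∀ {I : Set} → (I → ℤ) → (I → Bool) → Set
  Gen w X = ∀ n → Count (Level w X n)

  gf : ∀ {I : Set} {w : I → ℤ} {X : I → Bool} → Gen w X → Series
  gf c n = parity (c n)

  -- Weights are integers so that quadratic forms can be handled in a ring. Nonnegativity is what
  -- allows a weight n of a pair to be split into levels a + b = n of the two factors.
  NonNegative : ∀ {I : Set} → (I → ℤ) → (I → Bool) → Set
  NonNegative w X = ∀ i → X i ≡ true → ∃ λ n → w i ≡ + n

  all : ∀ {I : Set} → I → Bool
  all _ = true

  gf-bijection : ∀ {I J : Set} {w : I → ℤ} {X : I → Bool} {v : J → ℤ} {Y : J → Bool}
    (f : I → J) (g : J → I) →
    (∀ {i} → X i ≡ true → Y (f i) ≡ true) → (∀ {j} → Y j ≡ true → X (g j) ≡ true) →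
    (∀ {i} → X i ≡ true → g (f i) ≡ i) → (∀ {j} → Y j ≡ true → f (g j) ≡ j) →
    (∀ {i} → X i ≡ true → v (f i) ≡ w i) →
    (c : Gen w X) (d : Gen v Y) → gf c ≈ gf d
  gf-bijection {v = v} f g Xf Yg gf′ fg vf c d = ext λ n → parity-bijection f g
    (λ { (e , x) → trans (vf x) e , Xf x })
    (λ { (e , y) → trans (trans (sym (vf (Yg y))) (cong v (fg y))) e , Yg y })
    (λ { (_ , x) → gf′ x }) (λ { (_ , y) → fg y }) (c n) (d n)

  gen-bijection : ∀ {I J : Set} {w : I → ℤ} {X : I → Bool} {v : J → ℤ} {Y : J → Bool}
    (f : I → J) (g : J → I) →
    (∀ {i} → X i ≡ true → Y (f i) ≡ true) → (∀ {j} → Y j ≡ true → X (g j) ≡ true) →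
    (∀ {i} → X i ≡ true → g (f i) ≡ i) → (∀ {j} → Y j ≡ true → f (g j) ≡ j) →
    (∀ {i} → X i ≡ true → v (f i) ≡ w i) →
    Gen w X → Gen v Y
  gen-bijection {v = v} f g Xf Yg gf′ fg vf c n = count-map f g
    (λ { (e , x) → trans (vf x) e , Xf x })
    (λ { (e , y) → trans (trans (sym (vf (Yg y))) (cong v (fg y))) e , Yg y })
    (λ { (_ , x) → gf′ x }) (λ { (_ , y) → fg y }) (c n)

  gen-restrict : ∀ {I : Set} {w : I → ℤ} {X : I → Bool} → Gen w X → (H : I → Bool) →
                 Gen w (λ i → X i ∧ H i)
  gen-restrict {X = X} c H n = record
    { list = list r ; unique = unique r
    ; sound = λ i∈ → let ((e , x) , h) = sound r i∈ in e , cong₂ _∧_ x h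
    ; complete = λ { (e , xh) → complete r ((e , proj₁ (∧-true _ _ xh)) , proj₂ (∧-true _ _ xh)) } }
    where
    r = restrict (c n) H true
    ∧-true : ∀ a b → a ∧ b ≡ true → a ≡ true × b ≡ true
    ∧-true true true _ = refl , refl

  ∧-true⁻ : ∀ {a b} → a ∧ b ≡ true → a ≡ true × b ≡ true
  ∧-true⁻ {true} {true} _ = refl , refl

  gf-split : ∀ {I : Set} {w : I → ℤ} {X : I → Bool} (c : Gen w X) (H : I → Bool) →
             gf c ≈ gf (gen-restrict c H) + gf (gen-restrict c (λ i → not (H i)))
  gf-split c H = ext λ n → trans (parity-split (c n) H)
    (cong (parity (restrict (c n) H true) xor_)
      (parity-unique (restrict (c n) H false) (restrict (c n) (λ i → not (H i)) true)
        (λ { (p , h) → p , cong not h }) (λ { (p , h) → p , trans (sym (Bool.not-involutive _)) (cong not h) })))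

  module _ {I J : Set} {w : I → ℤ} {X : I → Bool} {v : J → ℤ} {Y : J → Bool} where

    private
      weight : I × J → ℤ
      weight (i , j) = w i ℤ.+ v j
      both : I × J → Bool
      both (i , j) = X i ∧ Y j

    convolution : (ℕ → List I) → (ℕ → List J) → ℕ → List (I × J)
    convolution c d zero    = cartesianProduct (c 0) (d 0)
    convolution c d (suc n) = cartesianProduct (c 0) (d (suc n)) ++ convolution (λ k → c (suc k)) d n

    length-cartesianProduct : ∀ (xs : List I) (ys : List J) →
                              length (cartesianProduct xs ys) ≡ length xs ℕ.* length ys
    length-cartesianProduct []       ys = refl
    length-cartesianProduct (x ∷ xs) ys = trans (length-++ (map (x ,_) ys))
      (cong₂ ℕ._+_ (length-map (x ,_) ys) (length-cartesianProduct xs ys))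

    convolution-parity : ∀ c d n → odd (length (convolution c d n)) ≡
                         ((λ k → odd (length (c k))) * (λ k → odd (length (d k)))) n
    convolution-parity c d zero =
      trans (cong odd (length-cartesianProduct (c 0) (d 0))) (odd-* (length (c 0)) (length (d 0)))
    convolution-parity c d (suc n) = begin
      odd (length (cp ++ rest))              ≡⟨ cong odd (length-++ cp) ⟩
      odd (length cp ℕ.+ length rest)        ≡⟨ odd-+ (length cp) (length rest) ⟩
      odd (length cp) xor odd (length rest)
        ≡⟨ cong₂ _xor_ (trans (cong odd (length-cartesianProduct (c 0) (d (suc n)))) (odd-* (length (c 0)) _))
                       (convolution-parity (λ k → c (suc k)) d n) ⟩
      _ ∎
      where
      open ≡-Reasoning
      cp = cartesianProduct (c 0) (d (suc n))
      rest = convolution (λ k → c (suc k)) d n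

    convolution-sound : ∀ c d n {i j} → (i , j) ∈ convolution c d n →
                        ∃₂ λ a b → a ℕ.+ b ≡ n × i ∈ c a × j ∈ d b
    convolution-sound c d zero m = let (i∈ , j∈) = ∈-cartesianProduct⁻ (c 0) (d 0) m in 0 , 0 , refl , i∈ , j∈
    convolution-sound c d (suc n) m with ∈-++⁻ (cartesianProduct (c 0) (d (suc n))) m
    ... | inj₁ m′ = let (i∈ , j∈) = ∈-cartesianProduct⁻ (c 0) (d (suc n)) m′ in 0 , suc n , refl , i∈ , j∈
    ... | inj₂ m′ = let (a , b , e , i∈ , j∈) = convolution-sound (λ k → c (suc k)) d n m′ in
                    suc a , b , cong suc e , i∈ , j∈

    convolution-complete : ∀ c d a b {i j} → i ∈ c a → j ∈ d b → (i , j) ∈ convolution c d (a ℕ.+ b)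
    convolution-complete c d zero    zero    i∈ j∈ = ∈-cartesianProduct⁺ i∈ j∈
    convolution-complete c d zero    (suc b) i∈ j∈ = ∈-++⁺ˡ (∈-cartesianProduct⁺ i∈ j∈)
    convolution-complete c d (suc a) b       i∈ j∈ =
      ∈-++⁺ʳ (cartesianProduct (c 0) (d (suc (a ℕ.+ b)))) (convolution-complete (λ k → c (suc k)) d a b i∈ j∈)

    convolution-unique : ∀ c d → (∀ k → Unique (c k)) → (∀ k → Unique (d k)) →
                         (∀ {a b i} → i ∈ c a → i ∈ c b → a ≡ b) → ∀ n → Unique (convolution c d n)
    convolution-unique c d uc ud disj zero    = Unique.cartesianProduct⁺ (uc 0) (ud 0)
    convolution-unique c d uc ud disj (suc n) = Unique.++⁺ (Unique.cartesianProduct⁺ (uc 0) (ud (suc n)))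
      (convolution-unique (λ k → c (suc k)) d (λ k → uc (suc k)) ud (λ x y → ℕ.suc-injective (disj x y)) n)
      λ { (m , m′) → apart (proj₁ (∈-cartesianProduct⁻ (c 0) (d (suc n)) m))
                           (convolution-sound (λ k → c (suc k)) d n m′) }
      where
      apart : ∀ {i j} → i ∈ c 0 → ¬ (∃₂ λ a b → a ℕ.+ b ≡ n × i ∈ c (suc a) × j ∈ d b)
      apart i∈ (a , b , e , i∈′ , j∈) with () ← disj i∈ i∈′

    gen-* : NonNegative w X → NonNegative v Y → Gen w X → Gen v Y → Gen weight both
    gen-* w≥0 v≥0 c d n = record
      { list = convolution lc ld n
      ; unique = convolution-unique lc ld (λ k → unique (c k)) (λ k → unique (d k))
          (λ {a} {b} x y → ℤ.+-injective (trans (sym (proj₁ (sound (c a) x))) (proj₁ (sound (c b) y)))) n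
      ; sound = λ m → let (a , b , e , i∈ , j∈) = convolution-sound lc ld n m
                          (ea , x) = sound (c a) i∈ ; (eb , y) = sound (d b) j∈ in
                      trans (cong₂ ℤ._+_ ea eb) (cong +_ e) , cong₂ _∧_ x y
      ; complete = λ { {i , j} (e , xy) → let (x , y) = ∧-true⁻ {X i} xy ; (a , ea) = w≥0 i x ; (b , eb) = v≥0 j y in
          subst (λ n → (i , j) ∈ convolution lc ld n)
            (ℤ.+-injective (trans (sym (cong₂ ℤ._+_ ea eb)) e))
            (convolution-complete lc ld a b (complete (c a) (ea , x)) (complete (d b) (eb , y))) } }
      where
      lc = λ k → list (c k)
      ld = λ k → list (d k)

    gf-* : ∀ (w≥0 : NonNegative w X) (v≥0 : NonNegative v Y) (c : Gen w X) (d : Gen v Y) →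
           gf (gen-* w≥0 v≥0 c d) ≈ gf c * gf d
    gf-* w≥0 v≥0 c d = ext (convolution-parity (λ k → list (c k)) (λ k → list (d k)))

  gen-q* : ∀ {I : Set} {w : I → ℤ} {X : I → Bool} → NonNegative w X → Gen w X → Gen (λ i → + 1 ℤ.+ w i) X
  gen-q* w≥0 c zero = record { list = [] ; unique = [] ; sound = λ () ; complete = λ { {i} (e , x) → ⊥-elim (absurd e (w≥0 i x)) } }
    where
    absurd : ∀ {z} → + 1 ℤ.+ z ≡ + 0 → ¬ ∃ λ n → z ≡ + n
    absurd () (n , refl)
  gen-q* w≥0 c (suc n) = record
    { list = list (c n) ; unique = unique (c n)
    ; sound = λ i∈ → let (e , x) = sound (c n) i∈ in cong (λ t → + 1 ℤ.+ t) e , x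
    ; complete = λ { {i} (e , x) → complete (c n) (pred e (w≥0 i x) , x) } }
    where
    pred : ∀ {z} → + 1 ℤ.+ z ≡ + suc n → (∃ λ m → z ≡ + m) → z ≡ + n
    pred refl (m , refl) = refl

  gf-q* : ∀ {I : Set} {w : I → ℤ} {X : I → Bool} (w≥0 : NonNegative w X) (c : Gen w X) →
          gf (gen-q* w≥0 c) ≈ q * gf c
  gf-q* w≥0 c = ext λ { zero → refl ; (suc n) → sym (q*-suc (gf c) n) }

  data DoubleView : ℕ → Set where
    even : ∀ m → DoubleView (double m)
    odd₁ : ∀ m → DoubleView (suc (double m))

  doubleView : ∀ n → DoubleView n
  doubleView zero = even 0
  doubleView (suc n) with doubleView n
  ... | even m = odd₁ m
  ... | odd₁ m = even (suc m)

  double-+ : ∀ m → double m ≡ m ℕ.+ m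
  double-+ zero    = refl
  double-+ (suc m) = trans (cong (λ t → suc (suc t)) (double-+ m)) (cong suc (sym (ℕ.+-suc m m)))

  double-injective : ∀ m n → double m ≡ double n → m ≡ n
  double-injective zero zero _ = refl
  double-injective (suc m) (suc n) e = cong suc (double-injective m n (ℕ.suc-injective (ℕ.suc-injective e)))

  double≢odd : ∀ m n → double m ≢ suc (double n)
  double≢odd (suc m) (suc n) e = double≢odd m n (ℕ.suc-injective (ℕ.suc-injective e))

  gen-double : ∀ {I : Set} {w : I → ℤ} {X : I → Bool} → NonNegative w X → Gen w X → Gen (λ i → w i ℤ.+ w i) X
  gen-double {w = w} {X} w≥0 c n = by (doubleView n)
    where
    twice : ∀ m → + m ℤ.+ + m ≡ + double m
    twice m = cong +_ (sym (double-+ m))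
    by : ∀ {n} → DoubleView n → Count (Level (λ i → w i ℤ.+ w i) X n)
    by (even m) = record
      { list = list (c m) ; unique = unique (c m)
      ; sound = λ i∈ → let (e , x) = sound (c m) i∈ in trans (cong₂ ℤ._+_ e e) (twice m) , x
      ; complete = λ { {i} (e , x) → complete (c m) (halve e (w≥0 i x) , x) } }
      where
      halve : ∀ {z} → z ℤ.+ z ≡ + double m → (∃ λ k → z ≡ + k) → z ≡ + m
      halve e (k , refl) = cong +_ (double-injective k m (ℤ.+-injective (trans (sym (twice k)) e)))
    by (odd₁ m) = record { list = [] ; unique = [] ; sound = λ () ; complete = λ { {i} (e , x) → ⊥-elim (absurd e (w≥0 i x)) } }
      where
      absurd : ∀ {z} → z ℤ.+ z ≡ + suc (double m) → ¬ ∃ λ k → z ≡ + k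
      absurd e (k , refl) = double≢odd k m (ℤ.+-injective (trans (sym (twice k)) e))

  -- Doubling all exponents is the Frobenius map over 𝔽₂, that is, squaring.
  gf-double : ∀ {I : Set} {w : I → ℤ} {X : I → Bool} (w≥0 : NonNegative w X) (c : Gen w X) →
              gf (gen-double w≥0 c) ≈ gf c * gf c
  gf-double {w = w} {X} w≥0 c = ext go
    where
    go : ∀ n → gf (gen-double w≥0 c) n ≡ (gf c * gf c) n
    go n with doubleView n
    ... | even m = sym (at (even-part-square (gf c)) m)
    ... | odd₁ m = sym (square-odd m (gf c))

-- Theta series and Lambert series as counts of lattice points.

module ThetaSeries where

  open PowerSeries
  open WeightedSets
  open import Data.Nat as ℕ using (ℕ; zero; suc; z≤n; s≤s)
  import Data.Nat.Properties as ℕ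
  open import Data.Nat.DivMod using (_/_)
  open import Data.Integer as ℤ using (ℤ; +_; -[1+_]; ∣_∣)
  import Data.Integer.Properties as ℤ
  open import Data.Integer.Tactic.RingSolver using (solve-∀)
  open import Data.Bool as Bool using (Bool; true; false; not; _xor_)
  import Data.Bool.Properties as Bool
  open import Data.List using (List; _++_; map; cartesianProduct; upTo)
  open import Data.List.Membership.Propositional using (_∈_)
  open import Data.List.Membership.Propositional.Properties
    using (∈-map⁺; ∈-map⁻; ∈-++⁺ˡ; ∈-++⁺ʳ; ∈-cartesianProduct⁺; ∈-upTo⁺)
  open import Data.List.Relation.Unary.Unique.Propositional using (Unique)
  import Data.List.Relation.Unary.Unique.Propositional.Properties as Unique
  open import Data.Product using (∃; ∃₂; _×_; _,_; proj₁; proj₂)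
  open import Relation.Nullary using (¬_)
  open import Relation.Nullary.Decidable using (_×-dec_)
  open import Relation.Binary.PropositionalEquality
    using (_≡_; refl; sym; trans; cong; cong₂; subst; module ≡-Reasoning)

  tri : ℕ → ℕ
  tri zero    = zero
  tri (suc n) = suc n ℕ.+ tri n

  -- x (x + 1) / 2 for integral x
  τ : ℤ → ℤ
  τ (+ n)    = + tri n
  τ -[1+ n ] = + tri n

  tri-double : ∀ n → + tri n ℤ.+ + tri n ≡ + n ℤ.* (+ n ℤ.+ + 1)
  tri-double zero    = refl
  tri-double (suc n) = begin
    + (suc n ℕ.+ tri n) ℤ.+ + (suc n ℕ.+ tri n)
      ≡⟨ lemma (+ n) (+ tri n) ⟩
    (+ tri n ℤ.+ + tri n) ℤ.+ (+ 2 ℤ.+ (+ n ℤ.+ + n))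
      ≡⟨ cong (ℤ._+ (+ 2 ℤ.+ (+ n ℤ.+ + n))) (tri-double n) ⟩
    + n ℤ.* (+ n ℤ.+ + 1) ℤ.+ (+ 2 ℤ.+ (+ n ℤ.+ + n))
      ≡⟨ lemma′ (+ n) ⟩
    + suc n ℤ.* (+ suc n ℤ.+ + 1) ∎
    where
    open ≡-Reasoning
    lemma : ∀ a t → ((+ 1 ℤ.+ a) ℤ.+ t) ℤ.+ ((+ 1 ℤ.+ a) ℤ.+ t) ≡ (t ℤ.+ t) ℤ.+ (+ 2 ℤ.+ (a ℤ.+ a))
    lemma = solve-∀
    lemma′ : ∀ a → a ℤ.* (a ℤ.+ + 1) ℤ.+ (+ 2 ℤ.+ (a ℤ.+ a)) ≡ (+ 1 ℤ.+ a) ℤ.* ((+ 1 ℤ.+ a) ℤ.+ + 1)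
    lemma′ = solve-∀
  τ-double : ∀ x → τ x ℤ.+ τ x ≡ x ℤ.* (x ℤ.+ + 1)
  τ-double (+ n)    = tri-double n
  τ-double -[1+ n ] = trans (tri-double n) (lemma (+ n))
    where
    lemma : ∀ a → a ℤ.* (a ℤ.+ + 1) ≡ (ℤ.- (+ 1 ℤ.+ a)) ℤ.* (ℤ.- (+ 1 ℤ.+ a) ℤ.+ + 1)
    lemma = solve-∀

  -- Weight identities are proved after doubling, where `τ-double` has removed the division by 2 and
  -- only polynomials remain.
  halve : ∀ {x y} → x ℤ.+ x ≡ y ℤ.+ y → x ≡ y
  halve {x} {y} e = ℤ.*-cancelˡ-≡ (+ 2) x y (trans (twice x) (trans e (sym (twice y))))
    where
    twice : ∀ z → + 2 ℤ.* z ≡ z ℤ.+ z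
    twice = solve-∀

  -- The map x ↦ -1 - x, the symmetry of x (x + 1) / 2. Given on constructors, it visibly switches
  -- the sign and so never fixes an integer.
  reflect : ℤ → ℤ
  reflect (+ n)    = -[1+ n ]
  reflect -[1+ n ] = + n

  reflect-involutive : ∀ x → reflect (reflect x) ≡ x
  reflect-involutive (+ n)    = refl
  reflect-involutive -[1+ n ] = refl

  reflect-≡ : ∀ x → reflect x ≡ ℤ.- (+ 1 ℤ.+ x)
  reflect-≡ (+ n)        = refl
  reflect-≡ -[1+ zero ]  = refl
  reflect-≡ -[1+ suc n ] = refl

  τ-reflect : ∀ x → τ (reflect x) ≡ τ x
  τ-reflect (+ n)    = refl
  τ-reflect -[1+ n ] = refl

  nonneg : ℤ → Bool
  nonneg (+ _)    = true
  nonneg -[1+ _ ] = false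

  nonneg-reflect : ∀ x → nonneg (reflect x) ≡ not (nonneg x)
  nonneg-reflect (+ n)    = refl
  nonneg-reflect -[1+ n ] = refl

  reflect-affine : ∀ {a b} y x → y ≡ ℤ.- (+ 1 ℤ.+ x) → a ≡ τ y → b ≡ τ x → a ≡ b
  reflect-affine y x e refl refl = trans (cong τ (trans e (sym (reflect-≡ x)))) (τ-reflect x)

  ball : ℕ → List ℤ
  ball n = map +_ (upTo n) ++ map -[1+_] (upTo n)

  ball-unique : ∀ n → Unique (ball n)
  ball-unique n = Unique.++⁺ (Unique.map⁺ ℤ.+-injective (Unique.upTo⁺ n))
                             (Unique.map⁺ ℤ.-[1+-injective (Unique.upTo⁺ n))
    λ { (x∈ , y∈) → apart (∈-map⁻ +_ x∈) (∈-map⁻ -[1+_] y∈) }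
    where
    apart : ∀ {v} {A B : ℕ → Set} → ∃ (λ x → A x × v ≡ + x) → ¬ ∃ (λ y → B y × v ≡ -[1+ y ])
    apart (_ , _ , refl) (_ , _ , ())

  ∈-ball : ∀ {n} x → ∣ x ∣ ℕ.< n → x ∈ ball n
  ∈-ball (+ k)    k<n = ∈-++⁺ˡ (∈-map⁺ +_ (∈-upTo⁺ k<n))
  ∈-ball {n} -[1+ k ] k<n = ∈-++⁺ʳ (map +_ (upTo n)) (∈-map⁺ -[1+_] (∈-upTo⁺ (ℕ.<-trans (ℕ.n<1+n k) k<n)))

  level? : ∀ {I : Set} (w : I → ℤ) (X : I → Bool) n i → Relation.Nullary.Dec (Level w X n i)
  level? w X n i = (w i ℤ.≟ + n) ×-dec (X i Bool.≟ true)

  gen-bounded : ∀ (w : ℤ → ℤ) X (bound : ℕ → ℕ) → (∀ {n x} → Level w X n x → ∣ x ∣ ℕ.≤ bound n) → Gen w X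
  gen-bounded w X bound bounded n = count-filter (ball (suc (bound n))) (ball-unique (suc (bound n))) (level? w X n)
    (λ {x} l → ∈-ball x (s≤s (bounded l)))

  gen-bounded₂ : ∀ (w : ℤ × ℤ → ℤ) X (bound : ℕ → ℕ) →
    (∀ {n x y} → Level w X n (x , y) → ∣ x ∣ ℕ.≤ bound n × ∣ y ∣ ℕ.≤ bound n) → Gen w X
  gen-bounded₂ w X bound bounded n = count-filter (cartesianProduct b b)
    (Unique.cartesianProduct⁺ (ball-unique (suc (bound n))) (ball-unique (suc (bound n)))) (level? w X n)
    (λ {xy} l → ∈-cartesianProduct⁺ (∈-ball (proj₁ xy) (s≤s (proj₁ (bounded l))))
                                    (∈-ball (proj₂ xy) (s≤s (proj₂ (bounded l)))))
    where b = ball (suc (bound n))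

  infix 8 5×_
  5×_ : ℤ → ℤ
  5× x = + 5 ℤ.* x

  n≤tri : ∀ n → n ℕ.≤ tri n
  n≤tri zero    = z≤n
  n≤tri (suc n) = ℕ.m≤m+n (suc n) (tri n)

  ∣∣≤τ : ∀ x {n} → τ x ≡ + n → ∣ x ∣ ℕ.≤ suc n
  ∣∣≤τ (+ m)    refl = ℕ.m≤n⇒m≤1+n (n≤tri m)
  ∣∣≤τ -[1+ m ] refl = s≤s (n≤tri m)

  ∣∣≤affine : ∀ x r → ∣ x ∣ ℕ.≤ ∣ 5× x ℤ.+ r ∣ ℕ.+ ∣ r ∣
  ∣∣≤affine x r = begin
    ∣ x ∣                             ≤⟨ ℕ.m≤n*m ∣ x ∣ 5 ⟩
    5 ℕ.* ∣ x ∣                       ≡⟨ sym (ℤ.abs-* (+ 5) x) ⟩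
    ∣ 5× x ∣                          ≡⟨ cong ∣_∣ (lemma (5× x) r) ⟩
    ∣ (5× x ℤ.+ r) ℤ.+ ℤ.- r ∣        ≤⟨ ℤ.∣i+j∣≤∣i∣+∣j∣ (5× x ℤ.+ r) (ℤ.- r) ⟩
    ∣ 5× x ℤ.+ r ∣ ℕ.+ ∣ ℤ.- r ∣      ≡⟨ cong (∣ 5× x ℤ.+ r ∣ ℕ.+_) (ℤ.∣-i∣≡∣i∣ r) ⟩
    ∣ 5× x ℤ.+ r ∣ ℕ.+ ∣ r ∣          ∎
    where
    open ℕ.≤-Reasoning
    lemma : ∀ a r → a ≡ (a ℤ.+ r) ℤ.+ ℤ.- r
    lemma = solve-∀

  j-weight : ℤ → ℤ → ℤ
  j-weight r m = τ (5× m ℤ.+ r)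

  τ-nonneg : ∀ x → ∃ λ n → τ x ≡ + n
  τ-nonneg (+ n)    = tri n , refl
  τ-nonneg -[1+ n ] = tri n , refl

  genJ : ∀ r → Gen (j-weight r) all
  genJ r = gen-bounded _ _ (λ n → suc n ℕ.+ ∣ r ∣)
    (λ {_} {x} l → ℕ.≤-trans (∣∣≤affine x r) (ℕ.+-monoˡ-≤ ∣ r ∣ (∣∣≤τ (5× x ℤ.+ r) (proj₁ l))))

  -- The part of Σ q^(x (x + 1) / 2), x ∈ ℤ, with x ≡ r (mod 5). For r = 0 and 1 these are the two
  -- Rogers-Ramanujan theta functions in q^5 without their signs, the second one times q.
  J : ℤ → Series
  J r = gf (genJ r)

  -- The class of 2 is stable under x ↦ -1 - x, so the full series `J (+ 2)` vanishes modulo 2; one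
  -- member of each pair is kept instead.
  Z-gen : Gen (j-weight (+ 2)) nonneg
  Z-gen = gen-restrict (genJ (+ 2)) nonneg

  Z : Series
  Z = gf Z-gen

  sq-weight : ℤ → ℤ → ℤ
  sq-weight r k = (5× k ℤ.+ r) ℤ.* (5× k ℤ.+ r)

  square-nonneg : ∀ x → x ℤ.* x ≡ + (∣ x ∣ ℕ.* ∣ x ∣)
  square-nonneg (+ n)    = sym (ℤ.pos-* n n)
  square-nonneg -[1+ n ] = refl

  m≤m*m : ∀ m → m ℕ.≤ m ℕ.* m
  m≤m*m zero    = z≤n
  m≤m*m (suc m) = ℕ.m≤m*n (suc m) (suc m)

  genSq : ∀ r → Gen (sq-weight r) all
  genSq r = gen-bounded _ _ (λ n → n ℕ.+ ∣ r ∣)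
    (λ {_} {x} l → ℕ.≤-trans (∣∣≤affine x r) (ℕ.+-monoˡ-≤ ∣ r ∣ (bound (5× x ℤ.+ r) (proj₁ l))))
    where
    bound : ∀ y {n} → y ℤ.* y ≡ + n → ∣ y ∣ ℕ.≤ n
    bound y e = subst (∣ y ∣ ℕ.≤_) (ℤ.+-injective (trans (sym (square-nonneg y)) e)) (m≤m*m ∣ y ∣)

  Sq : ℤ → Series
  Sq r = gf (genSq r)

  -- The index set of Kronecker's double sums: the quadrants r, s ≥ 0 and r, s < 0, whose opposite
  -- signs agree modulo 2.
  same : ℤ × ℤ → Bool
  same (r , s) = not (nonneg r xor nonneg s)

  e-weight : ℤ → ℤ × ℤ → ℤ
  e-weight c (r , s) = (5× r ℤ.+ + 1) ℤ.* (5× s ℤ.+ c)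

  -- 5 s + c is positive for s ≥ 0 and negative for s < 0 when 0 < c < 5 (here c = 5 − c′).
  affine-nonneg : ∀ b c → 5× (+ b) ℤ.+ + c ≡ + (5 ℕ.* b ℕ.+ c)
  affine-nonneg b c = cong (ℤ._+ + c) (sym (ℤ.pos-* 5 b))

  affine-neg : ∀ b c c′ → c ℕ.+ c′ ≡ 5 → 5× -[1+ b ] ℤ.+ + c ≡ ℤ.- (+ (5 ℕ.* b ℕ.+ c′))
  affine-neg b c c′ e = begin
    + 5 ℤ.* -[1+ b ] ℤ.+ + c
      ≡⟨ lemma (+ b) (+ c) (+ c′) ⟩
    (+ c ℤ.+ + c′ ℤ.+ -[1+ 4 ]) ℤ.+ ℤ.- (+ 5 ℤ.* + b ℤ.+ + c′)
      ≡⟨ cong₂ (λ t u → (+ t ℤ.+ -[1+ 4 ]) ℤ.+ ℤ.- u) e (affine-nonneg b c′) ⟩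
    + 0 ℤ.+ ℤ.- (+ (5 ℕ.* b ℕ.+ c′))
      ≡⟨ ℤ.+-identityˡ _ ⟩
    ℤ.- (+ (5 ℕ.* b ℕ.+ c′)) ∎
    where
    open ≡-Reasoning
    lemma : ∀ b c c′ → + 5 ℤ.* ℤ.- (+ 1 ℤ.+ b) ℤ.+ c ≡ (c ℤ.+ c′ ℤ.+ -[1+ 4 ]) ℤ.+ ℤ.- (+ 5 ℤ.* b ℤ.+ c′)
    lemma = solve-∀

  neg-*-neg : ∀ a b → ℤ.- (+ a) ℤ.* ℤ.- (+ b) ≡ + (a ℕ.* b)
  neg-*-neg a b = trans (lemma (+ a) (+ b)) (sym (ℤ.pos-* a b))
    where
    lemma : ∀ a b → ℤ.- a ℤ.* ℤ.- b ≡ a ℤ.* b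
    lemma = solve-∀

  module Lambert (c c′ : ℕ) (e : suc c ℕ.+ suc c′ ≡ 5) where

    -- In the negative quadrant both factors are negative, and -(5 (-1 - b) + `suc c`) = 5 b +
    -- `suc c′` is positive since the two residues add up to 5. The successors in the result record
    -- positivity, which bounds r and s by the exponent.
    e-value : ∀ {rs} → same rs ≡ true → ∃₂ λ a b → e-weight (+ suc c) rs ≡ + (suc a ℕ.* suc b) ×
              ∣ proj₁ rs ∣ ℕ.≤ suc a × ∣ proj₂ rs ∣ ℕ.≤ suc b
    e-value {+ r , + s} _ = 5 ℕ.* r , 5 ℕ.* s ℕ.+ c ,
      trans (cong₂ ℤ._*_ (affine-nonneg r 1) (affine-nonneg s (suc c)))
        (trans (sym (ℤ.pos-* (5 ℕ.* r ℕ.+ 1) (5 ℕ.* s ℕ.+ suc c)))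
          (cong₂ (λ x y → + (x ℕ.* y)) (ℕ.+-comm (5 ℕ.* r) 1) (ℕ.+-suc (5 ℕ.* s) c))) ,
      ℕ.m≤n⇒m≤1+n (ℕ.m≤n*m r 5) , ℕ.m≤n⇒m≤1+n (ℕ.≤-trans (ℕ.m≤n*m s 5) (ℕ.m≤m+n (5 ℕ.* s) c))
    e-value { -[1+ r ] , -[1+ s ]} _ = 5 ℕ.* r ℕ.+ 3 , 5 ℕ.* s ℕ.+ c′ ,
      trans (cong₂ ℤ._*_ (affine-neg r 1 4 refl) (affine-neg s (suc c) (suc c′) e))
        (trans (neg-*-neg (5 ℕ.* r ℕ.+ 4) (5 ℕ.* s ℕ.+ suc c′))
          (cong₂ (λ x y → + (x ℕ.* y)) (ℕ.+-suc (5 ℕ.* r) 3) (ℕ.+-suc (5 ℕ.* s) c′))) ,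
      s≤s (ℕ.≤-trans (ℕ.m≤n*m r 5) (ℕ.m≤m+n (5 ℕ.* r) 3)) , s≤s (ℕ.≤-trans (ℕ.m≤n*m s 5) (ℕ.m≤m+n (5 ℕ.* s) c′))

    e-nonneg : NonNegative (e-weight (+ suc c)) same
    e-nonneg rs x = let (_ , _ , eq , _) = e-value {rs} x in _ , eq

    genE : Gen (e-weight (+ suc c)) same
    genE = gen-bounded₂ _ _ (λ n → n) λ {n} {r} {s} l →
      let (a , b , eq , ra , sb) = e-value {r , s} (proj₂ l)
          n≡ = ℤ.+-injective (trans (sym eq) (proj₁ l)) in
      ℕ.≤-trans ra (subst (suc a ℕ.≤_) n≡ (ℕ.m≤m*n (suc a) (suc b))) ,
      ℕ.≤-trans sb (subst (suc b ℕ.≤_) n≡ (ℕ.m≤n*m (suc b) (suc a)))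

  open Lambert

  E₁ E₂ E₃ : Series
  E₁ = gf (genE 0 3 refl)
  E₂ = gf (genE 1 2 refl)
  E₃ = gf (genE 2 1 refl)

  -- What is left of the exponent in Kronecker's identity after the shear, once the theta exponent
  -- is split off. It is free of the residue c, so one series `Y` serves all residues and can be
  -- eliminated between them.
  y-weight : ℤ × ℤ → ℤ
  y-weight (r , s) = j-weight (+ 2) r ℤ.+ 5× s ℤ.* (5× r ℤ.+ + 1)

  y-value : ∀ {rs} → same rs ≡ true → ∃₂ λ t b → j-weight (+ 2) (proj₁ rs) ≡ + t ×
            5× (proj₂ rs) ℤ.* (5× (proj₁ rs) ℤ.+ + 1) ≡ + b × ∣ proj₂ rs ∣ ℕ.≤ b
  y-value {+ r , + s} _ = proj₁ (τ-nonneg (5× (+ r) ℤ.+ + 2)) , 5 ℕ.* s ℕ.* (5 ℕ.* r ℕ.+ 1) , proj₂ (τ-nonneg (5× (+ r) ℤ.+ + 2)) ,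
    trans (cong₂ ℤ._*_ (sym (ℤ.pos-* 5 s)) (affine-nonneg r 1)) (sym (ℤ.pos-* (5 ℕ.* s) (5 ℕ.* r ℕ.+ 1))) ,
    ℕ.≤-trans (ℕ.m≤n*m s 5) (subst (λ t → 5 ℕ.* s ℕ.≤ 5 ℕ.* s ℕ.* t) (ℕ.+-comm 1 (5 ℕ.* r)) (ℕ.m≤m*n (5 ℕ.* s) (suc (5 ℕ.* r))))
  y-value { -[1+ r ] , -[1+ s ]} _ = proj₁ (τ-nonneg (5× -[1+ r ] ℤ.+ + 2)) , 5 ℕ.* suc s ℕ.* (5 ℕ.* r ℕ.+ 4) , proj₂ (τ-nonneg (5× -[1+ r ] ℤ.+ + 2)) ,
    trans (cong₂ ℤ._*_ {x = 5× -[1+ s ]} refl (affine-neg r 1 4 refl)) (neg-*-neg (5 ℕ.* suc s) (5 ℕ.* r ℕ.+ 4)) ,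
    ℕ.≤-trans (ℕ.m≤n*m (suc s) 5) (subst (λ t → 5 ℕ.* suc s ℕ.≤ 5 ℕ.* suc s ℕ.* t) (ℕ.+-comm 4 (5 ℕ.* r)) (ℕ.m≤m*n (5 ℕ.* suc s) (suc (3 ℕ.+ 5 ℕ.* r))))

  y-nonneg : NonNegative y-weight same
  y-nonneg rs x = let (t , b , et , eb , _) = y-value {rs} x in t ℕ.+ b , cong₂ ℤ._+_ et eb

  genY : Gen y-weight same
  genY = gen-bounded₂ _ _ (λ n → suc n ℕ.+ 2) λ {n} {r} {s} l →
    let (t , b , et , eb , sb) = y-value {r , s} (proj₂ l)
        n≡ = ℤ.+-injective (trans (sym (cong₂ ℤ._+_ et eb)) (proj₁ l))
        t≤n = subst (t ℕ.≤_) n≡ (ℕ.m≤m+n t b)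
        b≤n = subst (b ℕ.≤_) n≡ (ℕ.m≤n+m b t) in
    ℕ.≤-trans (∣∣≤affine r (+ 2)) (ℕ.+-monoˡ-≤ 2 (ℕ.≤-trans (∣∣≤τ (5× r ℤ.+ + 2) et) (s≤s t≤n))) ,
    ℕ.≤-trans sb (ℕ.≤-trans b≤n (ℕ.≤-trans (ℕ.n≤1+n n) (ℕ.m≤m+n (suc n) 2)))

  Y : Series
  Y = gf genY

  J-nonneg : ∀ r → NonNegative (j-weight r) all
  J-nonneg r m _ = τ-nonneg (5× m ℤ.+ r)

  J-shift : ∀ r → J (+ 5 ℤ.+ r) ≈ J r
  J-shift r = gf-bijection (λ m → m ℤ.+ + 1) (λ m → m ℤ.+ ℤ.- (+ 1))
    (λ _ → refl) (λ _ → refl) (λ {m} _ → lemma₁ m) (λ {m} _ → lemma₂ m) (λ {m} _ → cong τ (lemma₃ m r))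
    (genJ (+ 5 ℤ.+ r)) (genJ r)
    where
    lemma₁ : ∀ m → m ℤ.+ + 1 ℤ.+ ℤ.- (+ 1) ≡ m
    lemma₁ = solve-∀
    lemma₂ : ∀ m → m ℤ.+ ℤ.- (+ 1) ℤ.+ + 1 ≡ m
    lemma₂ = solve-∀
    lemma₃ : ∀ m r → + 5 ℤ.* (m ℤ.+ + 1) ℤ.+ r ≡ + 5 ℤ.* m ℤ.+ (+ 5 ℤ.+ r)
    lemma₃ = solve-∀

  J-reflect : ∀ r → J (+ 4 ℤ.+ ℤ.- r) ≈ J r
  J-reflect r = gf-bijection reflect reflect
    (λ _ → refl) (λ _ → refl) (λ {m} _ → reflect-involutive m) (λ {m} _ → reflect-involutive m)
    (λ {m} _ → reflect-affine (5× (reflect m) ℤ.+ r) (5× m ℤ.+ (+ 4 ℤ.+ ℤ.- r))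
      (trans (cong (λ t → 5× t ℤ.+ r) (reflect-≡ m)) (lemma m r)) refl refl)
    (genJ (+ 4 ℤ.+ ℤ.- r)) (genJ r)
    where
    lemma : ∀ m r → + 5 ℤ.* (ℤ.- (+ 1 ℤ.+ m)) ℤ.+ r ≡ ℤ.- (+ 1 ℤ.+ (+ 5 ℤ.* m ℤ.+ (+ 4 ℤ.+ ℤ.- r)))
    lemma = solve-∀

-- Kronecker's identity and a transformation of binary theta series.

module KroneckerIdentity where

  open PowerSeries renaming (_+_ to _⊕_; _*_ to _⊛_)
  open WeightedSets
  open ThetaSeries
  open import Data.Nat as ℕ using (ℕ; zero; suc)
  import Data.Nat.Properties as ℕ
  open import Data.Nat using (⌊_/2⌋)
  open import Data.Integer as ℤ using (_+_; _*_; -_; ℤ; +_; -[1+_]; ∣_∣)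
  import Data.Integer.Properties as ℤ
  open import Data.Integer.Tactic.RingSolver using (solve-∀)
  open import Data.Bool as Bool using (Bool; true; false; not; _∧_; _xor_)
  import Data.Bool.Properties as Bool
  open import Data.Product using (_×_; _,_; proj₁; proj₂)
  import Data.List.Relation.Unary.Unique.Propositional.Properties as Unique
  open import Relation.Binary.PropositionalEquality
    using (_≡_; refl; sym; trans; cong; cong₂; subst; module ≡-Reasoning)

  -- Kronecker's identity relates E c to J for every c with the same factor Y.  After the shear (m, r, s) ↦ (m + r, r, s − m − r − 1)
  -- the two index sets carry the same weight and differ by pairs (r, −r − 1 − 2s).
  module _ (c c′ : ℕ) (e : suc c ℕ.+ suc c′ ≡ 5) where

    private
      k : ℤ
      k = + suc c

      W : ℤ × (ℤ × ℤ) → ℤ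
      W (i , rs) = j-weight (+ 3 + k) i + y-weight rs

      X₁ X₂ : ℤ × (ℤ × ℤ) → Bool
      X₁ (i , (r , s)) = same (r , s + i + + 1)
      X₂ (i , rs)      = all i ∧ same rs

      gen₁′ : Gen (λ mrs → + 1 + (j-weight (+ 2 + k) (proj₁ mrs) + e-weight k (proj₂ mrs)))
                  (λ mrs → all (proj₁ mrs) ∧ same (proj₂ mrs))
      nonneg₁ : NonNegative (λ mrs → j-weight (+ 2 + k) (proj₁ mrs) + e-weight k (proj₂ mrs))
                            (λ mrs → all (proj₁ mrs) ∧ same (proj₂ mrs))
      nonneg₁ (m , rs) x = let (a , ea) = J-nonneg (+ 2 + k) m refl ; (b , eb) = Lambert.e-nonneg c c′ e rs x in
                           a ℕ.+ b , cong₂ ℤ._+_ ea eb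
      gen₁″ = gen-* (J-nonneg (+ 2 + k)) (Lambert.e-nonneg c c′ e)
                    (genJ (+ 2 + k)) (Lambert.genE c c′ e)
      gen₁′ = gen-q* nonneg₁ gen₁″

      to from : ℤ × (ℤ × ℤ) → ℤ × (ℤ × ℤ)
      to   (m , (r , s)) = m + r , (r , s + - (m + r) + - (+ 1))
      from (i , (r , s)) = i + - r , (r , s + i + + 1)

      s-to : ∀ s t → s + - t + - (+ 1) + t + + 1 ≡ s
      s-to = solve-∀
      m-to : ∀ m r → m + r + - r ≡ m
      m-to = solve-∀
      i-from : ∀ i r → i + - r + r ≡ i
      i-from = solve-∀
      s-from : ∀ i r s → s + i + + 1 + - (i + - r + r) + - (+ 1) ≡ s
      s-from = solve-∀

      weights : ∀ m r s → W (to (m , (r , s))) ≡ + 1 + (j-weight (+ 2 + k) m + e-weight k (r , s))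
      weights m r s = halve (begin
        W (to (m , (r , s))) + W (to (m , (r , s)))
          ≡⟨ regroup (τ u) (τ v) (5× s″ * (5× r + + 1)) ⟩
        (τ u + τ u) + ((τ v + τ v) + (p + p))
          ≡⟨ cong₂ (λ x y → x + (y + (p + p))) (τ-double u) (τ-double v) ⟩
        u * (u + + 1) + (v * (v + + 1) + (p + p))
          ≡⟨ identity m r s k ⟩
        + 2 + (t * (t + + 1) + (d + d))
          ≡⟨ cong (λ x → + 2 + (x + (d + d))) (sym (τ-double t)) ⟩
        + 2 + ((τ t + τ t) + (d + d))
          ≡⟨ regroup′ (τ t) d ⟩
        (+ 1 + (τ t + d)) + (+ 1 + (τ t + d)) ∎)
        where
        open ≡-Reasoning
        s″ = s + - (m + r) + - (+ 1)
        u = 5× (m + r) + (+ 3 + k)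
        v = 5× r + + 2
        p = 5× s″ * (5× r + + 1)
        t = 5× m + (+ 2 + k)
        d = e-weight k (r , s)
        regroup : ∀ a b c → (a + (b + c)) + (a + (b + c)) ≡ (a + a) + ((b + b) + (c + c))
        regroup = solve-∀
        regroup′ : ∀ a b → + 2 + ((a + a) + (b + b)) ≡ (+ 1 + (a + b)) + (+ 1 + (a + b))
        regroup′ = solve-∀
        identity : ∀ m r s c →
          (+ 5 * (m + r) + (+ 3 + c)) * ((+ 5 * (m + r) + (+ 3 + c)) + + 1)
            + ((+ 5 * r + + 2) * ((+ 5 * r + + 2) + + 1)
                 + (+ 5 * (s + - (m + r) + - (+ 1)) * (+ 5 * r + + 1)
                      + + 5 * (s + - (m + r) + - (+ 1)) * (+ 5 * r + + 1)))
          ≡ + 2 + ((+ 5 * m + (+ 2 + c)) * ((+ 5 * m + (+ 2 + c)) + + 1)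
                 + ((+ 5 * r + + 1) * (+ 5 * s + c) + (+ 5 * r + + 1) * (+ 5 * s + c)))
        identity = solve-∀

      sheared : ∀ {mrs} → all (proj₁ mrs) ∧ same (proj₂ mrs) ≡ true → X₁ (to mrs) ≡ true
      sheared {m , (r , s)} x = subst (λ t → same (r , t) ≡ true) (sym (s-to s (m + r))) x
      from-to : ∀ mrs → from (to mrs) ≡ mrs
      from-to (m , (r , s)) = cong₂ (λ a b → a , (r , b)) (m-to m r) (s-to s (m + r))
      to-from : ∀ irs → to (from irs) ≡ irs
      to-from (i , (r , s)) = cong₂ (λ a b → a , (r , b)) (i-from i r) (s-from i r s)

      gen₁ : Gen W X₁
      gen₁ = gen-bijection to from (λ {mrs} → sheared {mrs}) (λ x → x)
        (λ {mrs} _ → from-to mrs) (λ {irs} _ → to-from irs) (λ { {m , (r , s)} _ → weights m r s }) gen₁′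

      gen₂ : Gen W X₂
      gen₂ = gen-* (J-nonneg (+ 3 + k)) y-nonneg (genJ (+ 3 + k)) genY

      φ : ℤ × (ℤ × ℤ) → ℤ × (ℤ × ℤ)
      φ (i , (r , s)) = i , (reflect (r + (s + s)) , s)

      φ-involutive : ∀ irs → φ (φ irs) ≡ irs
      φ-involutive (i , (r , s)) = cong (λ t → i , (t , s)) (begin
        reflect (reflect (r + (s + s)) + (s + s))
          ≡⟨ reflect-≡ (reflect (r + (s + s)) + (s + s)) ⟩
        - (+ 1 + (reflect (r + (s + s)) + (s + s)))
          ≡⟨ cong (λ t → - (+ 1 + (t + (s + s)))) (reflect-≡ (r + (s + s))) ⟩
        - (+ 1 + (- (+ 1 + (r + (s + s))) + (s + s)))
          ≡⟨ lemma r s ⟩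
        r ∎)
        where
        open ≡-Reasoning
        lemma : ∀ r s → - (+ 1 + (- (+ 1 + (r + (s + s))) + (s + s))) ≡ r
        lemma = solve-∀

      -- `φ` acts on r + s as x ↦ -1 - x, so the sign of r + s tells the two members of each pair
      -- apart.
      H : ℤ × (ℤ × ℤ) → Bool
      H (i , (r , s)) = nonneg (r + s)

      H-φ : ∀ irs → H (φ irs) ≡ not (H irs)
      H-φ (i , (r , s)) = trans (cong nonneg (trans (cong (_+ s) (reflect-≡ (r + (s + s))))
                                                    (trans (lemma r s) (sym (reflect-≡ (r + s))))))
                                (nonneg-reflect (r + s))
        where
        lemma : ∀ r s → - (+ 1 + (r + (s + s))) + s ≡ - (+ 1 + (r + s))
        lemma = solve-∀

      y-φ : ∀ r s → y-weight (reflect (r + (s + s)) , s) ≡ y-weight (r , s)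
      y-φ r s = halve (begin
        y-weight (r′ , s) + y-weight (r′ , s)
          ≡⟨ expand r′ ⟩
        v r′ * (v r′ + + 1) + (p r′ + p r′)
          ≡⟨ cong (λ t → v t * (v t + + 1) + (p t + p t)) (reflect-≡ (r + (s + s))) ⟩
        v r″ * (v r″ + + 1) + (p r″ + p r″)
          ≡⟨ identity r s ⟩
        v r * (v r + + 1) + (p r + p r)
          ≡⟨ sym (expand r) ⟩
        y-weight (r , s) + y-weight (r , s) ∎)
        where
        open ≡-Reasoning
        r′ = reflect (r + (s + s))
        r″ = - (+ 1 + (r + (s + s)))
        v p : ℤ → ℤ
        v r = 5× r + + 2
        p r = 5× s * (5× r + + 1)
        regroup : ∀ a b → (a + b) + (a + b) ≡ (a + a) + (b + b)
        regroup = solve-∀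
        expand : ∀ r → y-weight (r , s) + y-weight (r , s) ≡ v r * (v r + + 1) + (p r + p r)
        expand r = trans (regroup (τ (v r)) (p r)) (cong (_+ (p r + p r)) (τ-double (v r)))
        identity : ∀ r s →
          (+ 5 * (- (+ 1 + (r + (s + s)))) + + 2) * ((+ 5 * (- (+ 1 + (r + (s + s)))) + + 2) + + 1)
            + (+ 5 * s * (+ 5 * (- (+ 1 + (r + (s + s)))) + + 1)
                 + + 5 * s * (+ 5 * (- (+ 1 + (r + (s + s)))) + + 1))
          ≡ (+ 5 * r + + 2) * ((+ 5 * r + + 2) + + 1)
            + (+ 5 * s * (+ 5 * r + + 1) + + 5 * s * (+ 5 * r + + 1))
        identity = solve-∀

      -- the symmetric difference of X₁ and X₂ does not depend on r
      difference : ∀ r a b → not (r xor a) xor not (r xor b) ≡ a xor b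
      difference true  a b = trans (Bool.xor-annihilates-not (not a) (not b)) (Bool.xor-annihilates-not a b)
      difference false a b = Bool.xor-annihilates-not a b

      gf₁≈gf₂ : gf gen₁ ≈ gf gen₂
      gf₁≈gf₂ = ext λ n → parity-symmetric-difference φ H
        (λ { {i , (r , s)} w → trans (cong (λ t → j-weight (+ 3 + k) i + t) (y-φ r s)) w })
        (λ {irs} _ → φ-involutive irs)
        (λ { {i , (r , s)} _ x → trans (difference (nonneg (reflect (r + (s + s)))) _ _)
                                   (trans (sym (difference (nonneg r) (nonneg (s + i + + 1)) (nonneg s))) x) })
        (λ {irs} _ _ → H-φ irs) (gen₁ n) (gen₂ n)

    kronecker : q ⊛ (J (+ 2 + + suc c) ⊛ gf (Lambert.genE c c′ e)) ≈ Y ⊛ J (+ 3 + + suc c)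
    kronecker = begin
      q ⊛ (J (+ 2 + k) ⊛ gf (Lambert.genE c c′ e))
        ≈⟨ *-congˡ q (≈-sym (gf-* (J-nonneg (+ 2 + k)) (Lambert.e-nonneg c c′ e)
             (genJ (+ 2 + k)) (Lambert.genE c c′ e))) ⟩
      q ⊛ gf gen₁″      ≈⟨ ≈-sym (gf-q* nonneg₁ gen₁″) ⟩
      gf gen₁′          ≈⟨ gf-bijection to from (λ {mrs} → sheared {mrs}) (λ x → x)
                             (λ {mrs} _ → from-to mrs) (λ {irs} _ → to-from irs) (λ { {m , (r , s)} _ → weights m r s }) gen₁′ gen₁ ⟩
      gf gen₁           ≈⟨ gf₁≈gf₂ ⟩
      gf gen₂           ≈⟨ gf-* (J-nonneg (+ 3 + k)) y-nonneg (genJ (+ 3 + k)) genY ⟩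
      J (+ 3 + k) ⊛ Y ≈⟨ *ˢ-comm (J (+ 3 + k)) Y ⟩
      Y ⊛ J (+ 3 + k) ∎
      where open ≈-Reasoning

  oddℤ : ℤ → Bool
  oddℤ x = odd ∣ x ∣

  odd-⊖ : ∀ m n → oddℤ (m ℤ.⊖ n) ≡ odd m xor odd n
  odd-⊖ m       zero    = sym (Bool.xor-identityʳ (odd m))
  odd-⊖ zero    (suc n) = refl
  odd-⊖ (suc m) (suc n) = trans (cong oddℤ (ℤ.[1+m]⊖[1+n]≡m⊖n m n))
    (trans (odd-⊖ m n) (sym (Bool.xor-annihilates-not (odd m) (odd n))))

  oddℤ-+ : ∀ x y → oddℤ (x + y) ≡ oddℤ x xor oddℤ y
  oddℤ-+ (+ m)    (+ n)    = odd-+ m n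
  oddℤ-+ (+ m)    -[1+ n ] = odd-⊖ m (suc n)
  oddℤ-+ -[1+ m ] (+ n)    = trans (odd-⊖ n (suc m)) (Bool.xor-comm (odd n) (odd (suc m)))
  oddℤ-+ -[1+ m ] -[1+ n ] = trans (Bool.not-involutive _) (trans (odd-+ m n) (sym (Bool.xor-annihilates-not (odd m) (odd n))))

  oddℤ-double : ∀ x → oddℤ (x + x) ≡ false
  oddℤ-double x = trans (oddℤ-+ x x) (Bool.xor-same (oddℤ x))

  oddℤ-reflect : ∀ x → oddℤ (reflect x) ≡ not (oddℤ x)
  oddℤ-reflect (+ n)    = refl
  oddℤ-reflect -[1+ n ] = sym (Bool.not-involutive (odd n))

  half : ℤ → ℤ
  half (+ n)    = + ⌊ n /2⌋
  half -[1+ n ] = -[1+ ⌊ n /2⌋ ]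

  odd-double : ∀ m → odd (double m) ≡ false
  odd-double zero    = refl
  odd-double (suc m) = trans (Bool.not-involutive _) (odd-double m)

  ⌊double/2⌋ : ∀ m → ⌊ double m /2⌋ ≡ m
  ⌊double/2⌋ zero    = refl
  ⌊double/2⌋ (suc m) = cong suc (⌊double/2⌋ m)

  ⌊1+double/2⌋ : ∀ m → ⌊ suc (double m) /2⌋ ≡ m
  ⌊1+double/2⌋ zero    = refl
  ⌊1+double/2⌋ (suc m) = cong suc (⌊1+double/2⌋ m)

  half-even : ∀ x → oddℤ x ≡ false → half x + half x ≡ x
  half-even (+ n) e with doubleView n
  ... | even m = trans (cong (λ t → + t + + t) (⌊double/2⌋ m)) (cong +_ (sym (double-+ m)))
  ... | odd₁ m with () ← trans (sym e) (cong not (odd-double m))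
  half-even -[1+ n ] e with doubleView n
  ... | even m with () ← trans (sym e) (cong not (odd-double m))
  ... | odd₁ m = trans (cong (λ t → -[1+ t ] + -[1+ t ]) (⌊1+double/2⌋ m)) (cong (λ t → -[1+ suc t ]) (sym (double-+ m)))

  half-double : ∀ x → half (x + x) ≡ x
  half-double x = halve (half-even (x + x) (oddℤ-double x))

  nonneg-double : ∀ {I : Set} {w : I → ℤ} {X : I → Bool} → NonNegative w X → NonNegative (λ i → w i + w i) X
  nonneg-double w≥0 i x = let (n , e) = w≥0 i x in n ℕ.+ n , cong₂ ℤ._+_ e e

  -- τ (N + k) + τ (N − k) = 2 τ N + k², and the pairs (N + k, N − k) are those of a fixed parity; reflecting the first
  -- entry exchanges both the parity and the sign.
  module _ (α : ℤ) where

    private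
      -- With N = 5 m + α and K = 5 k + β, the choice α + β = 2 puts N + K into the class of 2, the
      -- one stable under reflection; N - K then lies in the class of γ.
      β γ : ℤ
      β = + 2 + - α
      γ = α + α + - (+ 2)

      W : ℤ × ℤ → ℤ
      W (x , i) = j-weight (+ 2) x + j-weight γ i

      X₁ X₂ : ℤ × ℤ → Bool
      X₁ (x , i) = not (oddℤ (x + i))
      X₂ (x , i) = (all x ∧ nonneg x) ∧ all i

      2J-nonneg : NonNegative (λ m → j-weight α m + j-weight α m) all
      2J-nonneg = nonneg-double (J-nonneg α)

      sq-nonneg : NonNegative (sq-weight β) all
      sq-nonneg k _ = _ , square-nonneg (5× k + β)

      gen₁′ : Gen (λ mk → (j-weight α (proj₁ mk) + j-weight α (proj₁ mk)) + sq-weight β (proj₂ mk))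
                  (λ mk → all (proj₁ mk) ∧ all (proj₂ mk))
      gen₁′ = gen-* 2J-nonneg sq-nonneg (gen-double (J-nonneg α) (genJ α)) (genSq β)

      to from : ℤ × ℤ → ℤ × ℤ
      to   (m , k) = m + k , m + - k
      from (x , i) = half (x + i) , x + - half (x + i)

      sum : ∀ m k → m + k + (m + - k) ≡ m + m
      sum = solve-∀

      to-even : ∀ mk → X₁ (to mk) ≡ true
      to-even (m , k) = cong not (trans (cong oddℤ (sum m k)) (oddℤ-double m))

      from-to : ∀ mk → from (to mk) ≡ mk
      from-to (m , k) = trans (cong (λ h → h , m + k + - h) (trans (cong half (sum m k)) (half-double m)))
                              (cong (m ,_) (lemma m k))
        where
        lemma : ∀ m k → m + k + - m ≡ k
        lemma = solve-∀

      to-from : ∀ xi → X₁ xi ≡ true → to (from xi) ≡ xi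
      to-from (x , i) e = cong₂ _,_ (lemma (half (x + i)) x)
        (trans (lemma′ (half (x + i)) x) (trans (cong (_+ - x) (half-even (x + i) (not-true e))) (lemma″ x i)))
        where
        not-true : ∀ {b} → not b ≡ true → b ≡ false
        not-true {false} _ = refl
        lemma : ∀ h x → h + (x + - h) ≡ x
        lemma = solve-∀
        lemma′ : ∀ h x → h + - (x + - h) ≡ h + h + - x
        lemma′ = solve-∀
        lemma″ : ∀ x i → x + i + - x ≡ i
        lemma″ = solve-∀

      weights : ∀ m k → W (to (m , k)) ≡ (j-weight α m + j-weight α m) + sq-weight β k
      weights m k = halve (begin
        W (to (m , k)) + W (to (m , k))
          ≡⟨ regroup (τ u) (τ v) ⟩
        (τ u + τ u) + (τ v + τ v)
          ≡⟨ cong₂ ℤ._+_ (τ-double u) (τ-double v) ⟩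
        u * (u + + 1) + v * (v + + 1)
          ≡⟨ identity m k α ⟩
        (n * (n + + 1) + sq-weight β k) + (n * (n + + 1) + sq-weight β k)
          ≡⟨ cong (λ t → (t + sq-weight β k) + (t + sq-weight β k)) (sym (τ-double n)) ⟩
        ((τ n + τ n) + sq-weight β k) + ((τ n + τ n) + sq-weight β k) ∎)
        where
        open ≡-Reasoning
        u = 5× (m + k) + + 2
        v = 5× (m + - k) + γ
        n = 5× m + α
        regroup : ∀ a b → (a + b) + (a + b) ≡ (a + a) + (b + b)
        regroup = solve-∀
        identity : ∀ m k α →
          (+ 5 * (m + k) + + 2) * ((+ 5 * (m + k) + + 2) + + 1)
            + (+ 5 * (m + - k) + (α + α + - (+ 2)))
                  * ((+ 5 * (m + - k) + (α + α + - (+ 2))) + + 1)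
          ≡ ((+ 5 * m + α) * ((+ 5 * m + α) + + 1)
              + (+ 5 * k + (+ 2 + - α)) * (+ 5 * k + (+ 2 + - α)))
            + ((+ 5 * m + α) * ((+ 5 * m + α) + + 1)
              + (+ 5 * k + (+ 2 + - α)) * (+ 5 * k + (+ 2 + - α)))
        identity = solve-∀

      gen₁ : Gen W X₁
      gen₁ = gen-bijection to from (λ {mk} _ → to-even mk) (λ _ → refl)
        (λ {mk} _ → from-to mk) (λ {xi} e → to-from xi e) (λ { {m , k} _ → weights m k }) gen₁′

      gen₂ : Gen W X₂
      gen₂ = gen-* (λ x _ → J-nonneg (+ 2) x refl) (J-nonneg γ) Z-gen (genJ γ)

      φ : ℤ × ℤ → ℤ × ℤ
      φ (x , i) = reflect x , i

      W-φ : ∀ x i → W (φ (x , i)) ≡ W (x , i)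
      W-φ x i = cong (λ t → t + j-weight γ i)
        (reflect-affine (5× (reflect x) + + 2) (5× x + + 2)
          (trans (cong (λ t → 5× t + + 2) (reflect-≡ x)) (lemma x)) refl refl)
        where
        lemma : ∀ x → + 5 * (- (+ 1 + x)) + + 2 ≡ - (+ 1 + (+ 5 * x + + 2))
        lemma = solve-∀

      X₁-φ : ∀ x i → X₁ (φ (x , i)) ≡ not (X₁ (x , i))
      X₁-φ x i = cong not (begin
        oddℤ (reflect x + i)          ≡⟨ oddℤ-+ (reflect x) i ⟩
        oddℤ (reflect x) xor oddℤ i     ≡⟨ cong (_xor oddℤ i) (oddℤ-reflect x) ⟩
        not (oddℤ x) xor oddℤ i         ≡⟨ sym (Bool.not-distribˡ-xor (oddℤ x) (oddℤ i)) ⟩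
        not (oddℤ x xor oddℤ i)         ≡⟨ cong not (sym (oddℤ-+ x i)) ⟩
        not (oddℤ (x + i))            ∎)
        where open ≡-Reasoning

      X₂-φ : ∀ x i → X₂ (φ (x , i)) ≡ not (X₂ (x , i))
      X₂-φ (+ _)    i = refl
      X₂-φ -[1+ _ ] i = refl

      gf₁≈gf₂ : gf gen₁ ≈ gf gen₂
      gf₁≈gf₂ = ext λ n → parity-symmetric-difference φ (λ xi → nonneg (proj₁ xi))
        (λ { {x , i} w → trans (W-φ x i) w })
        (λ { {x , i} _ → cong (_, i) (reflect-involutive x) })
        (λ { {x , i} _ e → trans (cong₂ _xor_ (X₁-φ x i) (X₂-φ x i))
                                 (trans (Bool.xor-annihilates-not (X₁ (x , i)) (X₂ (x , i))) e) })
        (λ { {x , i} _ _ → nonneg-reflect x }) (gen₁ n) (gen₂ n)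

    J-square*Sq : J α ⊛ J α ⊛ Sq (+ 2 + - α) ≈ Z ⊛ J (α + α + - (+ 2))
    J-square*Sq = begin
      J α ⊛ J α ⊛ Sq β
        ≈⟨ *-cong (≈-sym (gf-double (J-nonneg α) (genJ α))) ≈-refl ⟩
      gf (gen-double (J-nonneg α) (genJ α)) ⊛ Sq β
        ≈⟨ ≈-sym (gf-* 2J-nonneg sq-nonneg (gen-double (J-nonneg α) (genJ α)) (genSq β)) ⟩
      gf gen₁′
        ≈⟨ gf-bijection to from (λ {mk} _ → to-even mk) (λ _ → refl)
             (λ {mk} _ → from-to mk) (λ {xi} e → to-from xi e) (λ { {m , k} _ → weights m k }) gen₁′ gen₁ ⟩
      gf gen₁
        ≈⟨ gf₁≈gf₂ ⟩
      gf gen₂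
        ≈⟨ gf-* (λ x _ → J-nonneg (+ 2) x refl) (J-nonneg γ) Z-gen (genJ γ) ⟩
      Z ⊛ J γ ∎
      where open ≈-Reasoning

-- Dissections of squares by parity and of triangular numbers modulo 5.

module Dissections where

  open ResidueClasses
  open PowerSeries renaming (_+_ to _⊕_; _*_ to _⊛_)
  open WeightedSets
  open ThetaSeries
  open KroneckerIdentity
  open import Data.Nat as ℕ using (ℕ; suc; z≤n; s≤s)
  import Data.Nat.Properties as ℕ
  open import Data.Nat.DivMod using (_%_; _/_; m≡m%n+[m/n]*n; m%n<n; [m+kn]%n≡m%n; m<n⇒m%n≡m)
  open import Data.Integer as ℤ using (_+_; _*_; -_; ℤ; +_; -[1+_]; ∣_∣)
  import Data.Integer.Properties as ℤ
  open import Data.Integer.Tactic.RingSolver using (solve-∀)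
  open import Data.Bool as Bool using (_xor_; Bool; true; false; not; _∧_; if_then_else_)
  import Data.Bool.Properties as Bool
  open import Data.List using (upTo)
  open import Data.List.Membership.Propositional.Properties using (∈-upTo⁺)
  import Data.List.Relation.Unary.Unique.Propositional.Properties as Unique
  open import Data.Product using (_×_; _,_; proj₁; proj₂)
  open import Data.Sum using (_⊎_; inj₁; inj₂)
  open import Relation.Nullary using (Dec; yes; no; contradiction)
  open import Relation.Nullary.Decidable using (⌊_⌋)
  open import Relation.Binary.PropositionalEquality
    using (_≡_; _≢_; refl; sym; trans; cong; cong₂; subst; module ≡-Reasoning)

  not-true : ∀ {b} → not b ≡ true → b ≡ false
  not-true {false} _ = refl

  module _ {r : ℤ} {v u : ℤ → ℤ} (d : Gen v all) (d′ : Gen u all)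
           (v-even : ∀ m → v m ≡ sq-weight r (m + m)) (u-odd : ∀ m → u m ≡ sq-weight r (m + m + + 1)) where

    private
      half-odd : ∀ k → oddℤ k ≡ true → half (k + - (+ 1)) + half (k + - (+ 1)) + + 1 ≡ k
      half-odd k e = trans (cong (λ t → t + + 1) (half-even (k + - (+ 1))
                        (trans (oddℤ-+ k (- (+ 1))) (cong (_xor true) e)))) (lemma k)
        where
        lemma : ∀ k → k + - (+ 1) + + 1 ≡ k
        lemma = solve-∀
      odd-half : ∀ m → half (m + m + + 1 + - (+ 1)) ≡ m
      odd-half m = trans (cong half (lemma m)) (half-double m)
        where
        lemma : ∀ m → m + m + + 1 + - (+ 1) ≡ m + m
        lemma = solve-∀

    -- Splitting by the parity of k separates even from odd values of 5 k + r. In the two uses below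
    -- the even squares are four times squares of another class, and the odd ones lead back to `J`.
    Sq-parity : Sq r ≈ gf d ⊕ gf d′
    Sq-parity = begin
      Sq r
        ≈⟨ gf-split (genSq r) (λ k → not (oddℤ k)) ⟩
      gf (gen-restrict (genSq r) (λ k → not (oddℤ k))) ⊕ gf (gen-restrict (genSq r) (λ k → not (not (oddℤ k))))
        ≈⟨ +-cong
            (gf-bijection half (λ m → m + m) (λ _ → refl) (λ {m} _ → cong not (oddℤ-double m))
               (λ {k} e → half-even k (not-true e)) (λ {m} _ → half-double m)
               (λ {k} e → trans (v-even (half k)) (cong (sq-weight r) (half-even k (not-true e))))
               (gen-restrict (genSq r) (λ k → not (oddℤ k))) d)
            (gf-bijection (λ k → half (k + - (+ 1))) (λ m → m + m + + 1) (λ _ → refl)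
               (λ {m} _ → trans (Bool.not-involutive _) (trans (oddℤ-+ (m + m) (+ 1)) (cong (_xor true) (oddℤ-double m))))
               (λ {k} e → half-odd k (trans (sym (Bool.not-involutive _)) e)) (λ {m} _ → odd-half m)
               (λ {k} e → trans (u-odd (half (k + - (+ 1))))
                            (cong (sq-weight r) (half-odd k (trans (sym (Bool.not-involutive _)) e))))
               (gen-restrict (genSq r) (λ k → not (not (oddℤ k)))) d′) ⟩
      gf d ⊕ gf d′ ∎
      where open ≈-Reasoning

  quadruple : (ℤ → ℤ) → ℤ → ℤ
  quadruple w i = (w i + w i) + (w i + w i)

  nonneg-quadruple : ∀ {w : ℤ → ℤ} → NonNegative w all → NonNegative (quadruple w) all
  nonneg-quadruple w≥0 = nonneg-double (nonneg-double w≥0)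

  gen-quadruple : ∀ {w : ℤ → ℤ} → NonNegative w all → Gen w all → Gen (quadruple w) all
  gen-quadruple w≥0 c = gen-double (nonneg-double w≥0) (gen-double w≥0 c)

  gf-quadruple : ∀ {w : ℤ → ℤ} (w≥0 : NonNegative w all) (c : Gen w all) →
                 gf (gen-quadruple w≥0 c) ≈ (gf c ⊛ gf c) ⊛ (gf c ⊛ gf c)
  gf-quadruple w≥0 c = ≈-trans
    (gf-double (nonneg-double w≥0) (gen-double w≥0 c))
    (*-cong (gf-double w≥0 c) (gf-double w≥0 c))

  Sq-nonneg : ∀ r → NonNegative (sq-weight r) all
  Sq-nonneg r k _ = _ , square-nonneg (5× k + r)

  gen4Sq : ∀ r → Gen (quadruple (sq-weight r)) all
  gen4Sq r = gen-quadruple (Sq-nonneg r) (genSq r)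

  -- Since (2 x + 1)² = 1 + 8 x (x + 1) / 2, these weights are the odd squares in the class of 2 r +
  -- 1 modulo 10. As a series they form q times an eighth power.
  8J-weight : ℤ → ℤ → ℤ
  8J-weight r i = + 1 + (quadruple (j-weight r) i + quadruple (j-weight r) i)

  4J-nonneg : ∀ r → NonNegative (quadruple (j-weight r)) all
  4J-nonneg r = nonneg-quadruple (J-nonneg r)

  8J-nonneg : ∀ r → NonNegative (λ i → quadruple (j-weight r) i + quadruple (j-weight r) i) all
  8J-nonneg r = nonneg-double (4J-nonneg r)

  gen8J : ∀ r → Gen (8J-weight r) all
  gen8J r = gen-q* (8J-nonneg r) (gen-double (4J-nonneg r)
              (gen-quadruple (J-nonneg r) (genJ r)))

  infix 8 _⁴ _⁸
  _⁴ _⁸ : Series → Series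
  f ⁴ = (f ⊛ f) ⊛ (f ⊛ f)
  f ⁸ = (f ⁴) ⊛ (f ⁴)

  gf-8J : ∀ r → gf (gen8J r) ≈ q ⊛ (J r ⁸)
  gf-8J r = ≈-trans
    (gf-q* (8J-nonneg r) (gen-double (4J-nonneg r) (gen-quadruple (J-nonneg r) (genJ r))))
    (*-congˡ q (≈-trans (gf-double (4J-nonneg r) (gen-quadruple (J-nonneg r) (genJ r)))
      (*-cong (gf-quadruple (J-nonneg r) (genJ r)) (gf-quadruple (J-nonneg r) (genJ r)))))

  8J-value : ∀ r m → 8J-weight r m ≡ (+ 10 * m + (r + r + + 1)) * (+ 10 * m + (r + r + + 1))
  8J-value r m = begin
    8J-weight r m                                        ≡⟨ regroup (j-weight r m) ⟩
    + 1 + + 4 * (j-weight r m + j-weight r m)      ≡⟨ cong (λ t → + 1 + + 4 * t) (τ-double (5× m + r)) ⟩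
    + 1 + + 4 * ((5× m + r) * (5× m + r + + 1)) ≡⟨ identity m r ⟩
    _ ∎
    where
    open ≡-Reasoning
    regroup : ∀ t → + 1 + (((t + t) + (t + t)) + ((t + t) + (t + t))) ≡ + 1 + + 4 * (t + t)
    regroup = solve-∀
    identity : ∀ m r → + 1 + + 4 * ((+ 5 * m + r) * (+ 5 * m + r + + 1))
                       ≡ (+ 10 * m + (r + r + + 1)) * (+ 10 * m + (r + r + + 1))
    identity = solve-∀

  -- 5 k + 1 is odd for k = 2 m. For k = 2 m + 1 it equals 2 (5 m + 3) = -2 (5 (-1 - m) + 2), hence
  -- the reflected index.
  Sq-1 : Sq (+ 1) ≈ Sq (+ 2) ⁴ ⊕ q ⊛ (J (+ 0) ⁸)
  Sq-1 = begin
    Sq (+ 1)               ≈⟨ Sq-parity (gen8J (+ 0)) 4Sq-2 (λ m → trans (8J-value (+ 0) m) (lemma m)) (λ m → lemma′ m) ⟩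
    gf (gen8J (+ 0)) ⊕ gf 4Sq-2
                           ≈⟨ +ˢ-comm (gf (gen8J (+ 0))) (gf 4Sq-2) ⟩
    gf 4Sq-2 ⊕ gf (gen8J (+ 0))
                           ≈⟨ +-cong (≈-trans (gf-bijection reflect reflect (λ _ → refl) (λ _ → refl)
                                (λ {i} _ → reflect-involutive i) (λ {i} _ → reflect-involutive i) (λ _ → refl) 4Sq-2 (gen4Sq (+ 2)))
                                (gf-quadruple (Sq-nonneg (+ 2)) (genSq (+ 2)))) (gf-8J (+ 0)) ⟩
    Sq (+ 2) ⁴ ⊕ q ⊛ (J (+ 0) ⁸) ∎
    where
    open ≈-Reasoning
    w : ℤ → ℤ
    w m = quadruple (sq-weight (+ 2)) (reflect m)
    4Sq-2 : Gen w all
    4Sq-2 = gen-bijection reflect reflect (λ _ → refl) (λ _ → refl)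
      (λ {i} _ → reflect-involutive i) (λ {i} _ → reflect-involutive i)
      (λ {i} _ → cong (quadruple (sq-weight (+ 2))) (reflect-involutive i)) (gen4Sq (+ 2))
    lemma : ∀ m → (+ 10 * m + + 1) * (+ 10 * m + + 1) ≡ (+ 5 * (m + m) + + 1) * (+ 5 * (m + m) + + 1)
    lemma = solve-∀
    lemma′ : ∀ m → w m ≡ sq-weight (+ 1) (m + m + + 1)
    lemma′ m = trans (cong (quadruple (sq-weight (+ 2))) (reflect-≡ m)) (identity m)
      where
      identity : ∀ m → let s = (+ 5 * (- (+ 1 + m)) + + 2) * (+ 5 * (- (+ 1 + m)) + + 2) in
        (s + s) + (s + s) ≡ (+ 5 * (m + m + + 1) + + 1) * (+ 5 * (m + m + + 1) + + 1)
      identity = solve-∀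

  -- Here k = 2 m gives 2 (5 m + 1), and k = 2 m + 1 gives the odd number 10 m + 7 = 2 (5 m + 3) +
  -- 1.
  Sq-2 : Sq (+ 2) ≈ Sq (+ 1) ⁴ ⊕ q ⊛ (J (+ 3) ⁸)
  Sq-2 = ≈-trans (Sq-parity (gen4Sq (+ 1)) (gen8J (+ 3)) lemma (λ m → trans (8J-value (+ 3) m) (lemma′ m)))
                 (+-cong (gf-quadruple (Sq-nonneg (+ 1)) (genSq (+ 1))) (gf-8J (+ 3)))
    where
    lemma : ∀ m → let s = (+ 5 * m + + 1) * (+ 5 * m + + 1) in
      (s + s) + (s + s) ≡ (+ 5 * (m + m) + + 2) * (+ 5 * (m + m) + + 2)
    lemma = solve-∀
    lemma′ : ∀ m → (+ 10 * m + + 7) * (+ 10 * m + + 7)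
                   ≡ (+ 5 * (m + m + + 1) + + 2) * (+ 5 * (m + m + + 1) + + 2)
    lemma′ = solve-∀

  -- Swapping r and s leaves the diagonal.
  E₁≈Sq-1 : E₁ ≈ Sq (+ 1)
  E₁≈Sq-1 = begin
    E₁                                  ≈⟨ gf-split genE₁ diagonal ⟩
    gf on ⊕ gf off                      ≈⟨ +-congˡ (gf on) (ext λ n → parity-involution (λ rs → proj₂ rs , proj₁ rs) above
                                             (λ { {r , s} (e , x) → trans (ℤ.*-comm (5× s + + 1) (5× r + + 1)) e , swap r s x })
                                             (λ _ → refl) (λ { {r , s} (_ , x) → flip r s (proj₂ (∧-true⁻ {same (r , s)} x)) }) (off n)) ⟩
    gf on ⊕ 0ˢ                          ≈⟨ ext (λ n → Bool.xor-identityʳ (gf on n)) ⟩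
    gf on                               ≈⟨ gf-bijection proj₁ (λ k → k , k) (λ _ → refl)
                                             (λ {k} _ → cong₂ (λ a b → not a ∧ b) (Bool.xor-same (nonneg k)) (⌊⌋-true (k ℤ.≟ k) refl))
                                             (λ { {r , s} x → cong (r ,_) (⌊⌋-proof (r ℤ.≟ s) (proj₂ (∧-true⁻ {same (r , s)} x))) })
                                             (λ _ → refl)
                                             (λ { {r , s} x → cong (λ t → (5× r + + 1) * (5× t + + 1)) (⌊⌋-proof (r ℤ.≟ s) (proj₂ (∧-true⁻ {same (r , s)} x))) })
                                             on (genSq (+ 1)) ⟩
    Sq (+ 1)                            ∎
    where
    open ≈-Reasoning
    genE₁ = Lambert.genE 0 3 refl
    diagonal above : ℤ × ℤ → Bool
    diagonal (r , s) = ⌊ r ℤ.≟ s ⌋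
    above (r , s) = ⌊ r ℤ.<? s ⌋
    on = gen-restrict genE₁ diagonal
    off = gen-restrict genE₁ (λ rs → not (diagonal rs))
    ⌊⌋-true : ∀ {A : Set} (d : Dec A) → A → ⌊ d ⌋ ≡ true
    ⌊⌋-true (yes _) _ = refl
    ⌊⌋-true (no ¬a) a = contradiction a ¬a
    ⌊⌋-proof : ∀ {A : Set} (d : Dec A) → ⌊ d ⌋ ≡ true → A
    ⌊⌋-proof (yes a) _ = a
    swap : ∀ r s → same (r , s) ∧ not (diagonal (r , s)) ≡ true → same (s , r) ∧ not (diagonal (s , r)) ≡ true
    swap r s x with s ℤ.≟ r | r ℤ.≟ s | ∧-true⁻ {same (r , s)} x
    ... | yes _  | yes _  | _ , ()
    ... | yes e  | no ne  | _ = contradiction (sym e) ne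
    ... | no _   | _      | y , _ = trans (Bool.∧-identityʳ _) (trans (cong not (Bool.xor-comm (nonneg s) (nonneg r))) y)
    flip : ∀ r s → not (diagonal (r , s)) ≡ true → above (s , r) ≡ not (above (r , s))
    flip r s x with r ℤ.≟ s | s ℤ.<? r | r ℤ.<? s
    ... | no _  | yes _   | no _    = refl
    ... | no _  | no _    | yes _   = refl
    ... | no _  | yes s<r | yes r<s = contradiction s<r (ℤ.<-asym r<s)
    ... | no ne | no s≮r  | no r≮s  = contradiction (ℤ.≤-antisym (ℤ.≮⇒≥ s≮r) (ℤ.≮⇒≥ r≮s)) ne

  -- ψ d = Σ q^((d + 1) n (n + 1) / 2); the successor keeps the exponents distinct

  tri-weight : ℕ → ℕ → ℤ
  tri-weight d n = + (d ℕ.* tri n)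

  genψ : ∀ d → Gen (tri-weight (suc d)) all
  genψ d n = count-filter (upTo (suc n)) (Unique.upTo⁺ (suc n)) (level? (tri-weight (suc d)) all n)
    (λ {k} l → ∈-upTo⁺ (s≤s (ℕ.≤-trans (n≤tri k) (subst (tri k ℕ.≤_) (ℤ.+-injective (proj₁ l)) (ℕ.m≤n*m (tri k) (suc d))))))

  ψ : ℕ → Series
  ψ d = gf (genψ d)

  [i+5m]%5 : ∀ {i} → i ℕ.< 5 → ∀ m → (i ℕ.+ m ℕ.* 5) % 5 ≡ i
  [i+5m]%5 {i} i<5 m = trans ([m+kn]%n≡m%n i m 5) (m<n⇒m%n≡m i<5)

  [i+5m]/5 : ∀ {i} → i ℕ.< 5 → ∀ m → (i ℕ.+ m ℕ.* 5) / 5 ≡ m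
  [i+5m]/5 {i} i<5 m = ℕ.*-cancelʳ-≡ _ m 5 (ℕ.+-cancelˡ-≡ i _ _ (sym (trans (m≡m%n+[m/n]*n n 5)
    (cong (ℕ._+ n / 5 ℕ.* 5) ([i+5m]%5 i<5 m)))))
    where n = i ℕ.+ m ℕ.* 5

  i+5[n/5] : ∀ {i} n → n % 5 ≡ i → i ℕ.+ n / 5 ℕ.* 5 ≡ n
  i+5[n/5] n e = sym (trans (m≡m%n+[m/n]*n n 5) (cong (ℕ._+ n / 5 ℕ.* 5) e))

  residue : ℕ → ℕ → Bool
  residue r n = ⌊ n % 5 ℕ.≟ r ⌋

  residue-refl : ∀ r {n} → n % 5 ≡ r → residue r n ≡ true
  residue-refl r {n} e with n % 5 ℕ.≟ r
  ... | yes _ = refl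
  ... | no ne = contradiction e ne

  residue-other : ∀ r {r′ n} → n % 5 ≡ r′ → r′ ≢ r → residue r n ≡ false
  residue-other r {n = n} e r′≢r with n % 5 ℕ.≟ r
  ... | yes e′ = contradiction (trans (sym e) e′) r′≢r
  ... | no _   = refl

  τ-affine : ∀ c a → τ (5× (+ a) + + c) ≡ tri-weight 1 (c ℕ.+ a ℕ.* 5)
  τ-affine c a = trans (cong τ (trans (affine-nonneg a c) (cong +_ (trans (ℕ.+-comm (5 ℕ.* a) c) (cong (c ℕ.+_) (ℕ.*-comm 5 a))))))
    (cong +_ (sym (ℕ.*-identityˡ (tri (c ℕ.+ a ℕ.* 5)))))

  -- a bijection between ℤ and the natural numbers ≡ c, c′ (mod 5); 5 i + c is ± magnitude i if c + c′ = 5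
  module Signed (c c′ : ℕ) (c<5 : c ℕ.< 5) (c′<5 : c′ ℕ.< 5) (c′≢c : c′ ≢ c) where

    magnitude : ℤ → ℕ
    magnitude (+ a)    = c ℕ.+ a ℕ.* 5
    magnitude -[1+ a ] = c′ ℕ.+ a ℕ.* 5

    signed : ℕ → ℤ
    signed k = if residue c k then + (k / 5) else -[1+ k / 5 ]

    signed-magnitude : ∀ i → signed (magnitude i) ≡ i
    signed-magnitude (+ a)
      rewrite residue-refl c {c ℕ.+ a ℕ.* 5} ([i+5m]%5 c<5 a) | [i+5m]/5 c<5 a = refl
    signed-magnitude -[1+ a ]
      rewrite residue-other c {n = c′ ℕ.+ a ℕ.* 5} ([i+5m]%5 c′<5 a) c′≢c | [i+5m]/5 c′<5 a = refl

    magnitude-signed : ∀ k → k % 5 ≡ c ⊎ k % 5 ≡ c′ → magnitude (signed k) ≡ k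
    magnitude-signed k (inj₁ e) rewrite residue-refl c {k} e = i+5[n/5] k e
    magnitude-signed k (inj₂ e) rewrite residue-other c {n = k} e c′≢c = i+5[n/5] k e

    magnitude-class : ∀ (f : ℕ → Bool) → f c ≡ true → f c′ ≡ true → ∀ i → class f (magnitude i) ≡ true
    magnitude-class f fc fc′ (+ a)    = trans (cong f ([i+5m]%5 c<5 a)) fc
    magnitude-class f fc fc′ -[1+ a ] = trans (cong f ([i+5m]%5 c′<5 a)) fc′

    τ-magnitude : c ℕ.+ c′ ≡ 4 → ∀ i → τ (5× i + + c) ≡ tri-weight 1 (magnitude i)
    τ-magnitude e (+ a)    = τ-affine c a
    τ-magnitude e -[1+ a ] = trans
      (cong τ (trans (affine-neg a c (suc c′) (trans (ℕ.+-suc c c′) (cong suc e)))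
        (cong (λ t → - (+ t)) (trans (ℕ.+-comm (5 ℕ.* a) (suc c′)) (cong (suc c′ ℕ.+_) (ℕ.*-comm 5 a))))))
      (cong +_ (sym (ℕ.*-identityˡ (tri (c′ ℕ.+ a ℕ.* 5)))))

    J-class : c ℕ.+ c′ ≡ 4 → {X : ℕ → Bool} → (∀ n → X n ≡ true → n % 5 ≡ c ⊎ n % 5 ≡ c′) →
              (∀ i → X (magnitude i) ≡ true) → (g : Gen (tri-weight 1) X) → gf g ≈ J (+ c)
    J-class e X→ →X g = gf-bijection signed magnitude (λ _ → refl) (λ {i} _ → →X i)
      (λ {n} x → magnitude-signed n (X→ n x)) (λ {i} _ → signed-magnitude i)
      (λ {n} x → trans (τ-magnitude e (signed n)) (cong (tri-weight 1) (magnitude-signed n (X→ n x)))) g (genJ (+ c))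

  -- Under x ↦ -1 - x the naturals with residue 0 or 4 represent all integers ≡ 0 (mod 5), and those
  -- with residue 1 or 3 all integers ≡ 1. Residue 2 is paired with itself, so its naturals make
  -- only half a class, which is `Z`.
  ψ-dissection : ψ 0 ≈ J (+ 0) ⊕ J (+ 1) ⊕ Z
  ψ-dissection = begin
    ψ 0
      ≈⟨ ≈-trans (gf-split (genψ 0) (class is-04)) (+-congˡ (gf g₀) (gf-split g₁ (class is-13))) ⟩
    gf g₀ ⊕ (gf g₂ ⊕ gf g₃)
      ≈⟨ +-cong (C₀.J-class refl (λ n → residues₀ (n % 5)) (C₀.magnitude-class is-04 refl refl) g₀)
                (+-cong (C₁.J-class refl (λ n → residues₁ (n % 5)) (C₁.magnitude-class (λ r → not (is-04 r) ∧ is-13 r) refl refl) g₂)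
                        rest) ⟩
    J (+ 0) ⊕ (J (+ 1) ⊕ Z)
      ≈⟨ ≈-sym (+ˢ-assoc (J (+ 0)) (J (+ 1)) Z) ⟩
    J (+ 0) ⊕ J (+ 1) ⊕ Z ∎
    where
    open ≈-Reasoning
    module C₀ = Signed 0 4 (s≤s z≤n) (s≤s (s≤s (s≤s (s≤s (s≤s z≤n))))) (λ ())
    module C₁ = Signed 1 3 (s≤s (s≤s z≤n)) (s≤s (s≤s (s≤s (s≤s z≤n)))) (λ ())
    is-04 is-13 : ℕ → Bool
    is-04 0 = true
    is-04 4 = true
    is-04 _ = false
    is-13 1 = true
    is-13 3 = true
    is-13 _ = false
    g₀ = gen-restrict (genψ 0) (class is-04)
    g₁ = gen-restrict (genψ 0) (λ n → not (class is-04 n))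
    g₂ = gen-restrict g₁ (class is-13)
    g₃ = gen-restrict g₁ (λ n → not (class is-13 n))
    residues₀ : ∀ r → is-04 r ≡ true → r ≡ 0 ⊎ r ≡ 4
    residues₀ 0 _ = inj₁ refl
    residues₀ 4 _ = inj₂ refl
    residues₁ : ∀ r → not (is-04 r) ∧ is-13 r ≡ true → r ≡ 1 ⊎ r ≡ 3
    residues₁ 1 _ = inj₁ refl
    residues₁ 3 _ = inj₂ refl
    residues₁ 4 ()
    residues₁ (suc (suc (suc (suc (suc _))))) ()
    only-2 : ∀ r → r ℕ.< 5 → not (is-04 r) ∧ not (is-13 r) ≡ true → r ≡ 2
    only-2 2 _ _ = refl
    only-2 4 _ ()
    only-2 (suc (suc (suc (suc (suc _))))) (s≤s (s≤s (s≤s (s≤s (s≤s ()))))) _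
    rest : gf g₃ ≈ Z
    rest = gf-bijection (λ n → + (n / 5)) (λ m → 2 ℕ.+ ∣ m ∣ ℕ.* 5) (λ _ → refl)
      (λ {m} _ → cong (λ r → not (is-04 r) ∧ not (is-13 r)) ([i+5m]%5 2<5 ∣ m ∣))
      (λ {n} x → back n x) (λ { {+ m} _ → cong +_ ([i+5m]/5 2<5 m) ; { -[1+ _ ]} () })
      (λ {n} x → trans (τ-affine 2 (n / 5)) (cong (tri-weight 1) (back n x))) g₃ Z-gen
      where
      2<5 = s≤s (s≤s (s≤s (z≤n {2})))
      back : ∀ n → (true ∧ not (class is-04 n)) ∧ not (class is-13 n) ≡ true → 2 ℕ.+ n / 5 ℕ.* 5 ≡ n
      back n x = i+5[n/5] n (only-2 (n % 5) (m%n<n n 5) x)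

  -- (5 n + 2) (5 n + 3) / 2 = 3 + 25 n (n + 1) / 2.
  Z≈q³ψ : Z ≈ q ⊛ (q ⊛ (q ⊛ ψ 24))
  Z≈q³ψ = ≈-sym (begin
    q ⊛ (q ⊛ (q ⊛ ψ 24))
      ≈⟨ *-congˡ q (*-congˡ q (≈-sym (gf-q* nonneg₀ (genψ 24)))) ⟩
    q ⊛ (q ⊛ gf g₁)
      ≈⟨ *-congˡ q (≈-sym (gf-q* nonneg₁ g₁)) ⟩
    q ⊛ gf g₂
      ≈⟨ ≈-sym (gf-q* nonneg₂ g₂) ⟩
    gf g₃
      ≈⟨ gf-bijection +_ ∣_∣ (λ _ → refl) (λ _ → refl) (λ _ → refl) (λ { {+ m} _ → refl ; { -[1+ _ ]} () })
           (λ {n} _ → halve (value n)) g₃ Z-gen ⟩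
    Z ∎)
    where
    open ≈-Reasoning
    nonneg₀ : NonNegative (tri-weight 25) all
    nonneg₀ n _ = 0 ℕ.+ 25 ℕ.* tri n , refl
    g₁ = gen-q* nonneg₀ (genψ 24)
    nonneg₁ : NonNegative (λ n → + 1 + tri-weight 25 n) all
    nonneg₁ n _ = 1 ℕ.+ 25 ℕ.* tri n , refl
    g₂ = gen-q* nonneg₁ g₁
    nonneg₂ : NonNegative (λ n → + 1 + (+ 1 + tri-weight 25 n)) all
    nonneg₂ n _ = 2 ℕ.+ 25 ℕ.* tri n , refl
    g₃ = gen-q* nonneg₂ g₂
    value : ∀ n → j-weight (+ 2) (+ n) + j-weight (+ 2) (+ n)
                ≡ (+ 1 + (+ 1 + (+ 1 + tri-weight 25 n))) + (+ 1 + (+ 1 + (+ 1 + tri-weight 25 n)))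
    value n = trans (τ-double (5× (+ n) + + 2)) (trans (lemma (+ n)) (trans (cong (λ t → + 6 + + 25 * t) (sym (tri-double n)))
      (trans (lemma′ (+ tri n)) (cong (λ t → (+ 3 + t) + (+ 3 + t)) (sym (ℤ.pos-* 25 (tri n)))))))
      where
      lemma : ∀ n → (+ 5 * n + + 2) * (+ 5 * n + + 2 + + 1) ≡ + 6 + + 25 * (n * (n + + 1))
      lemma = solve-∀
      lemma′ : ∀ t → + 6 + + 25 * (t + t) ≡ (+ 3 + + 25 * t) + (+ 3 + + 25 * t)
      lemma′ = solve-∀

-- Jacobi's identity modulo 2 and the product for regular partitions.

module EulerProducts where

  open PowerSeries
  open WeightedSets
  open ThetaSeries
  open KroneckerIdentity
  open Dissections
  open import Defs using (pc)
  open import Data.Nat as ℕ using (ℕ; zero; suc; z≤n; s≤s)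
  import Data.Nat.Properties as ℕ
  open import Data.Nat.Divisibility using (_∣_; _∣?_; m∣m*n; ∣m+n∣m⇒∣n; >⇒∤)
  open import Data.Nat.ListAction using (sum)
  open import Data.Integer as ℤ using (ℤ; +_)
  import Data.Integer.Properties as ℤ
  open import Data.Bool as Bool using (Bool; true; false; _xor_; if_then_else_)
  import Data.Bool.Properties as Bool
  open import Data.List using (map; upTo; applyUpTo; downFrom; filter; length)
  open import Data.List.Properties using (map-upTo; filter-accept; filter-reject)
  open import Data.List.Membership.Propositional.Properties using (∈-downFrom⁺)
  import Data.List.Relation.Unary.Unique.Propositional.Properties as Unique
  open import Data.Product using (_,_; proj₁)
  open import Relation.Nullary using (yes; no; contradiction)
  open import Relation.Nullary.Decidable using (⌊_⌋)
  open import Relation.Binary.PropositionalEquality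
    using (_≡_; refl; sym; trans; cong; cong₂; subst; module ≡-Reasoning)
  open import Algebra.Bundles using (CommutativeRing)
  open import Algebra.Properties.Semiring.Exp semiring using (^-homo-*; ^-assocʳ)
  open import Algebra.Properties.CommutativeSemiring.Exp (CommutativeRing.commutativeSemiring seriesRing)
    using (^-distrib-*)

  infix 4 _≈[_]_
  -- Congruence modulo q^N, through which infinite products are reached as limits of finite ones.
  _≈[_]_ : Series → ℕ → Series → Set
  f ≈[ N ] g = ∀ k → k ℕ.< N → f k ≡ g k

  ≈⇒≈[] : ∀ {f g N} → f ≈ g → f ≈[ N ] g
  ≈⇒≈[] e k _ = at e k

  []-sym : ∀ {f g N} → f ≈[ N ] g → g ≈[ N ] f
  []-sym e k k<N = sym (e k k<N)

  []-trans : ∀ {f g h N} → f ≈[ N ] g → g ≈[ N ] h → f ≈[ N ] h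
  []-trans e e′ k k<N = trans (e k k<N) (e′ k k<N)

  []-weaken : ∀ {f g M N} → M ℕ.≤ N → f ≈[ N ] g → f ≈[ M ] g
  []-weaken M≤N e k k<M = e k (ℕ.≤-trans k<M M≤N)

  []-+ : ∀ {f f′ g g′ N} → f ≈[ N ] f′ → g ≈[ N ] g′ → f + g ≈[ N ] f′ + g′
  []-+ e e′ k k<N = cong₂ _xor_ (e k k<N) (e′ k k<N)

  []-* : ∀ {f f′ g g′ N} → f ≈[ N ] f′ → g ≈[ N ] g′ → f * g ≈[ N ] f′ * g′
  []-* {f} {f′} {g} {g′} e e′ k k<N = begin
    (f * g) k    ≡⟨ *-local f k (λ j j≤k → e′ j (ℕ.≤-<-trans j≤k k<N)) ⟩
    (f * g′) k   ≡⟨ *-comm-at k f g′ ⟩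
    (g′ * f) k   ≡⟨ *-local g′ k (λ j j≤k → e j (ℕ.≤-<-trans j≤k k<N)) ⟩
    (g′ * f′) k  ≡⟨ *-comm-at k g′ f′ ⟩
    (f′ * g′) k  ∎
    where open ≡-Reasoning

  []-limit : ∀ {f g} → (∀ N → f ≈[ N ] g) → f ≈ g
  []-limit e = ext λ n → e (suc n) n ℕ.≤-refl

  Σ< : ℕ → (ℕ → Series) → Series
  Σ< zero    f = 0ˢ
  Σ< (suc m) f = Σ< m f + f m

  -- Shanks' finite form of Gauss's identity Σ Q^(k (k + 1) / 2) = Π (1 − Q^(2 i)) / (1 − Q^(2 i − 1))
  module Shanks (Q : Series) where

    open SeriesSolver
    open ≈-Reasoning

    -- This is Q^(2 n + 1), written so that the ring solver sees a polynomial in the atoms `Q` and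
    -- `Q ^ n`.
    y : ℕ → Series
    y n = Q * (Q ^ n * Q ^ n)

    odds : ℕ → Series
    odds zero    = 1ˢ
    odds (suc n) = odds n * (1ˢ + y n)

    e-factor : ℕ → Series
    e-factor j = 1ˢ + Q ^ j * Q ^ j

    evens : ℕ → ℕ → Series
    evens s zero    = 1ˢ
    evens s (suc k) = evens s k * e-factor (suc (s ℕ.+ k))

    evens-head : ∀ s k → evens s (suc k) ≈ e-factor (suc s) * evens (suc s) k
    evens-head s zero rewrite ℕ.+-identityʳ s = *ˢ-comm 1ˢ (e-factor (suc s))
    evens-head s (suc k) = begin
      evens s (suc k) * e-factor (suc (s ℕ.+ suc k))
        ≈⟨ *-cong (evens-head s k) ≈-refl ⟩
      e-factor (suc s) * evens (suc s) k * e-factor (suc (s ℕ.+ suc k))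
        ≈⟨ *ˢ-assoc _ _ _ ⟩
      e-factor (suc s) * (evens (suc s) k * e-factor (suc (s ℕ.+ suc k)))
        ≡⟨ cong (λ t → e-factor (suc s) * (evens (suc s) k * e-factor (suc t))) (ℕ.+-suc s k) ⟩
      e-factor (suc s) * evens (suc s) (suc k) ∎

    -- Shanks' summand (P_n / P_s) Q^(s (2 n + 1)), where P_n = Π (1 - Q^(2 i)) / (1 - Q^(2 i - 1))
    -- over i ≤ n, multiplied by the odd factors up to n. The quotient of the even factors is the
    -- product over s < j ≤ n, so no division remains.
    term : ℕ → ℕ → Series
    term n s = evens s (n ℕ.∸ s) * odds s * y n ^ s

    R : ℕ → Series
    R n = Σ< n (term n)

    y^-suc : ∀ n s → y (suc n) ^ s ≈ Q ^ s * Q ^ s * y n ^ s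
    y^-suc n s = begin
      y (suc n) ^ s                 ≈⟨ ^-congˡ s (solve 2 (λ Q b → Q :* ((Q :* b) :* (Q :* b)) := (Q :* Q) :* (Q :* (b :* b))) ≈-refl Q (Q ^ n)) ⟩
      (Q * Q * y n) ^ s             ≈⟨ ^-distrib-* (Q * Q) (y n) s ⟩
      (Q * Q) ^ s * y n ^ s         ≈⟨ *-cong (^-distrib-* Q Q s) ≈-refl ⟩
      Q ^ s * Q ^ s * y n ^ s       ∎

    private
      boundary : ℕ → ℕ → Series
      boundary n m = evens m (n ℕ.∸ m) * odds m * (1ˢ + Q ^ m * Q ^ m) * y n ^ m

    -- `boundary` is a closed form of the difference between the partial sum for n + 1 and the one
    -- for n times the new odd factor. It vanishes at m = 0 because of its factor 1 + Q^(2 m); the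
    -- hypothesis on k keeps truncated subtraction exact.
    telescope : ∀ n m k → m ℕ.+ k ≡ n →
                Σ< m (term (suc n)) + (1ˢ + y n) * Σ< m (term n) ≈ boundary n m
    telescope n zero k _ = solve 3 (λ y e o → con false :+ (con true :+ y) :* con false
      := e :* o :* (con true :+ con true :* con true) :* con true) ≈-refl (y n) (evens 0 n) 1ˢ
    telescope n (suc m) k refl = begin
      (Σ< m (term (suc n)) + term (suc n) m) + (1ˢ + y n) * (Σ< m (term n) + term n m)
        ≈⟨ solve 5 (λ s t y s′ t′ → (s :+ t) :+ (con true :+ y) :* (s′ :+ t′)
                                 := (s :+ (con true :+ y) :* s′) :+ (t :+ (con true :+ y) :* t′)) ≈-refl
             (Σ< m (term (suc n))) (term (suc n) m) (y n) (Σ< m (term n)) (term n m) ⟩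
      (Σ< m (term (suc n)) + (1ˢ + y n) * Σ< m (term n)) + (term (suc n) m + (1ˢ + y n) * term n m)
        ≈⟨ +-cong (telescope n m (suc k) (ℕ.+-suc m k)) (+-cong new ≈-refl) ⟩
      boundary n m + ((e * (1ˢ + (Q * b) * (Q * b))) * odds m * (a * a * p) + (1ˢ + y n) * term n m)
        ≡⟨ cong (λ j → evens m j * odds m * (1ˢ + a * a) * p
             + ((e * (1ˢ + (Q * b) * (Q * b))) * odds m * (a * a * p) + (1ˢ + y n) * (evens m j * odds m * p))) n∸m ⟩
      e * odds m * (1ˢ + a * a) * p + ((e * (1ˢ + (Q * b) * (Q * b))) * odds m * (a * a * p) + (1ˢ + y n) * (e * odds m * p))
        ≈⟨ solve 6 (λ e o a b p Q →
             e :* o :* (con true :+ a :* a) :* p :+ ((e :* (con true :+ (Q :* b) :* (Q :* b))) :* o :* (a :* a :* p)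
               :+ (con true :+ Q :* (b :* b)) :* (e :* o :* p))
             := e :* (o :* (con true :+ Q :* (a :* a))) :* ((Q :* (b :* b)) :* p)) ≈-refl e (odds m) a b p Q ⟩
      e * odds (suc m) * (y n * p)
        ≈⟨ *-cong (*-cong (evens-head m k) ≈-refl) ≈-refl ⟩
      e-factor (suc m) * evens (suc m) k * odds (suc m) * (y n * p)
        ≈⟨ solve 4 (λ f e o p → f :* e :* o :* p := e :* o :* f :* p) ≈-refl (e-factor (suc m)) (evens (suc m) k) (odds (suc m)) (y n * p) ⟩
      evens (suc m) k * odds (suc m) * e-factor (suc m) * (y n * p)
        ≡⟨ cong (λ j → evens (suc m) j * odds (suc m) * e-factor (suc m) * (y n * p)) (sym n∸1+m) ⟩
      boundary n (suc m) ∎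
      where
      n∸m : n ℕ.∸ m ≡ suc k
      n∸m = trans (cong (ℕ._∸ m) (sym (ℕ.+-suc m k))) (ℕ.m+n∸m≡n m (suc k))
      n∸1+m : n ℕ.∸ suc m ≡ k
      n∸1+m = ℕ.m+n∸m≡n m k
      1+n∸m : suc n ℕ.∸ m ≡ suc (suc k)
      1+n∸m = trans (cong (ℕ._∸ m) (trans (cong suc (sym (ℕ.+-suc m k))) (sym (ℕ.+-suc m (suc k)))))
                    (ℕ.m+n∸m≡n m (suc (suc k)))
      e = evens m (suc k)
      a = Q ^ m
      b = Q ^ n
      p = y n ^ m
      new : term (suc n) m ≈ (e * (1ˢ + (Q * b) * (Q * b))) * odds m * (a * a * p)
      new = begin
        evens m (suc n ℕ.∸ m) * odds m * y (suc n) ^ m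
          ≡⟨ cong (λ j → evens m j * odds m * y (suc n) ^ m) 1+n∸m ⟩
        e * e-factor (suc (m ℕ.+ suc k)) * odds m * y (suc n) ^ m
          ≡⟨ cong (λ j → e * e-factor (suc j) * odds m * y (suc n) ^ m) (ℕ.+-suc m k) ⟩
        e * e-factor (suc n) * odds m * y (suc n) ^ m
          ≈⟨ *-cong ≈-refl (y^-suc n m) ⟩
        _ ∎

    Ψ : ℕ → Series
    Ψ n = Σ< (double n) (λ k → Q ^ tri k)

    Q^double : ∀ n → Q ^ double n ≈ Q ^ n * Q ^ n
    Q^double n = ≈-trans (≈-reflexive (cong (Q ^_) (double-+ n))) (^-homo-* Q n n)
      where
      ≈-reflexive : ∀ {f g} → f ≡ g → f ≈ g
      ≈-reflexive refl = ≈-refl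

    Q^tri-double : ∀ n → Q ^ tri (double n) ≈ y n ^ n
    Q^tri-double zero    = ≈-refl
    Q^tri-double (suc n) = begin
      Q ^ (suc (suc d) ℕ.+ (suc d ℕ.+ tri d))
        ≈⟨ ^-homo-* Q (suc (suc d)) (suc d ℕ.+ tri d) ⟩
      Q ^ suc (suc d) * Q ^ (suc d ℕ.+ tri d)
        ≈⟨ *-congˡ (Q ^ suc (suc d)) (^-homo-* Q (suc d) (tri d)) ⟩
      (Q * (Q * Q ^ d)) * ((Q * Q ^ d) * Q ^ tri d)
        ≈⟨ *-cong (*-congˡ Q (*-congˡ Q (Q^double n))) (*-cong (*-congˡ Q (Q^double n)) (Q^tri-double n)) ⟩
      (Q * (Q * (b * b))) * ((Q * (b * b)) * y n ^ n)
        ≈⟨ solve 3 (λ Q b p → (Q :* (Q :* (b :* b))) :* ((Q :* (b :* b)) :* p)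
                           := (Q :* ((Q :* b) :* (Q :* b))) :* (b :* b :* p)) ≈-refl Q b (y n ^ n) ⟩
      y (suc n) * (b * b * y n ^ n)
        ≈⟨ *-congˡ (y (suc n)) (≈-sym (y^-suc n n)) ⟩
      y (suc n) ^ suc n ∎
      where
      d = double n
      b = Q ^ n

    -- From n to n + 1 the left side gains the exponents `tri (2 n)` and `tri (2 n + 1)`, which
    -- contribute `y n ^ n` and `y n ^ suc n`. On the right the telescoping sum at m = n and the one
    -- new term account for the change.
    odds*Ψ : ∀ n → odds n * Ψ n ≈ R n
    odds*Ψ zero    = solve 1 (λ o → o :* con false := con false) ≈-refl 1ˢ
    odds*Ψ (suc n) = begin
      odds n * (1ˢ + y n) * (Ψ n + Q ^ tri d + Q ^ (suc d ℕ.+ tri d))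
        ≈⟨ *-cong ≈-refl (+-cong (+-congˡ (Ψ n) (Q^tri-double n))
             (≈-trans (^-homo-* Q (suc d) (tri d)) (*-cong (*-congˡ Q (Q^double n)) (Q^tri-double n)))) ⟩
      odds n * (1ˢ + y n) * (Ψ n + p + y n * p)
        ≈⟨ solve 4 (λ o y s p → o :* (con true :+ y) :* (s :+ p :+ y :* p)
                             := (con true :+ y) :* (o :* s) :+ o :* p :* (con true :+ y :* y)) ≈-refl (odds n) (y n) (Ψ n) p ⟩
      (1ˢ + y n) * (odds n * Ψ n) + odds n * p * (1ˢ + y n * y n)
        ≈⟨ +-cong (*-cong ≈-refl (odds*Ψ n)) ≈-refl ⟩
      (1ˢ + y n) * R n + odds n * p * (1ˢ + y n * y n)
        ≈⟨ solve 5 (λ t o p Q b → t :+ o :* p :* (con true :+ (Q :* (b :* b)) :* (Q :* (b :* b)))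
             := t :+ (con true :* o :* (con true :+ b :* b) :* p)
                  :+ (con true :* (con true :+ (Q :* b) :* (Q :* b)) :* o :* (b :* b :* p))) ≈-refl
             ((1ˢ + y n) * R n) (odds n) p Q b ⟩
      ((1ˢ + y n) * R n + 1ˢ * odds n * (1ˢ + b * b) * p) + (1ˢ * (1ˢ + (Q * b) * (Q * b)) * odds n * (b * b * p))
        ≈⟨ +-cong (+-congˡ ((1ˢ + y n) * R n) (≈-sym tele)) (≈-sym last) ⟩
      ((1ˢ + y n) * R n + (Σ< n (term (suc n)) + (1ˢ + y n) * R n)) + term (suc n) n
        ≈⟨ solve 3 (λ a b c → (a :+ (b :+ a)) :+ c := b :+ c) ≈-refl ((1ˢ + y n) * R n) (Σ< n (term (suc n))) (term (suc n) n) ⟩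
      R (suc n) ∎
      where
      d = double n
      p = y n ^ n
      b = Q ^ n
      tele : Σ< n (term (suc n)) + (1ˢ + y n) * R n ≈ 1ˢ * odds n * (1ˢ + b * b) * p
      tele = begin
        Σ< n (term (suc n)) + (1ˢ + y n) * R n
          ≈⟨ telescope n n 0 (ℕ.+-identityʳ n) ⟩
        boundary n n
          ≡⟨ cong (λ k → evens n k * odds n * (1ˢ + b * b) * p) (ℕ.n∸n≡0 n) ⟩
        1ˢ * odds n * (1ˢ + b * b) * p ∎
      last : term (suc n) n ≈ 1ˢ * (1ˢ + (Q * b) * (Q * b)) * odds n * (b * b * p)
      last = begin
        evens n (suc n ℕ.∸ n) * odds n * y (suc n) ^ n
          ≡⟨ cong (λ j → evens n j * odds n * y (suc n) ^ n) (ℕ.m+n∸n≡m 1 n) ⟩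
        1ˢ * e-factor (suc (n ℕ.+ 0)) * odds n * y (suc n) ^ n
          ≡⟨ cong (λ j → 1ˢ * e-factor (suc j) * odds n * y (suc n) ^ n) (ℕ.+-identityʳ n) ⟩
        1ˢ * e-factor (suc n) * odds n * y (suc n) ^ n
          ≈⟨ *-cong ≈-refl (y^-suc n n) ⟩
        _ ∎

    euler : ℕ → Series
    euler zero    = 1ˢ
    euler (suc n) = euler n * (1ˢ + Q ^ suc n)

    -- (1 + Q^j)² = 1 + Q^(2 j) over 𝔽₂
    evens-square : ∀ n → evens 0 n ≈ euler n * euler n
    evens-square zero    = solve 1 (λ x → con true := con true :* con true) ≈-refl 1ˢ
    evens-square (suc n) = begin
      evens 0 n * (1ˢ + Q ^ suc n * Q ^ suc n)
        ≈⟨ *-cong (evens-square n) ≈-refl ⟩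
      euler n * euler n * (1ˢ + Q ^ suc n * Q ^ suc n)
        ≈⟨ solve 2 (λ x b → x :* x :* (con true :+ b :* b) := x :* (con true :+ b) :* (x :* (con true :+ b))) ≈-refl (euler n) (Q ^ suc n) ⟩
      euler (suc n) * euler (suc n) ∎

    odds*evens : ∀ n → odds n * evens 0 n ≈ euler (double n)
    odds*evens zero    = solve 1 (λ x → con true :* con true := con true) ≈-refl 1ˢ
    odds*evens (suc n) = begin
      odds n * (1ˢ + y n) * (evens 0 n * (1ˢ + (Q * b) * (Q * b)))
        ≈⟨ solve 4 (λ o e Q b → o :* (con true :+ Q :* (b :* b)) :* (e :* (con true :+ (Q :* b) :* (Q :* b)))
               := o :* e :* (con true :+ Q :* (b :* b)) :* (con true :+ Q :* (Q :* (b :* b)))) ≈-refl (odds n) (evens 0 n) Q b ⟩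
      odds n * evens 0 n * (1ˢ + Q * (b * b)) * (1ˢ + Q * (Q * (b * b)))
        ≈⟨ *-cong (*-cong (odds*evens n) (+-congˡ 1ˢ (*-congˡ Q (≈-sym (Q^double n)))))
                  (+-congˡ 1ˢ (*-congˡ Q (*-congˡ Q (≈-sym (Q^double n))))) ⟩
      euler (double (suc n)) ∎
      where b = Q ^ n

  q^-low : ∀ m f → q ^ m * f ≈[ m ] 0ˢ
  q^-low m f k k<m = trans (at (q^-shift m f) k) (shift-< m f k k<m)

  module Limit (d : ℕ) where

    Q : Series
    Q = q ^ suc d

    open Shanks Q public

    Q^ : ∀ m → Q ^ m ≈ q ^ (suc d ℕ.* m)
    Q^ m = ^-assocʳ q (suc d) m

    Q^-low : ∀ m → Q ^ m ≈[ m ] 0ˢ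
    Q^-low m = []-trans (≈⇒≈[] (≈-trans (Q^ m) (solve 1 (λ x → x := x :* con true) ≈-refl (q ^ (suc d ℕ.* m)))))
                        ([]-weaken (ℕ.m≤n*m m (suc d)) (q^-low (suc d ℕ.* m) 1ˢ))
      where open SeriesSolver

    euler-suc : ∀ n → euler (suc n) ≈[ suc n ] euler n
    euler-suc n = []-trans ([]-* {euler n} (λ _ _ → refl) ([]-+ {1ˢ} (λ _ _ → refl) (Q^-low (suc n))))
      (≈⇒≈[] (solve 1 (λ x → x :* (con true :+ con false) := x) ≈-refl (euler n)))
      where open SeriesSolver

    euler∞ : Series
    euler∞ n = euler n n

    euler-limit : ∀ j n k → k ℕ.≤ n → euler (j ℕ.+ n) k ≡ euler n k
    euler-limit zero    n k k≤n = refl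
    euler-limit (suc j) n k k≤n =
      trans (euler-suc (j ℕ.+ n) k (s≤s (ℕ.≤-trans k≤n (ℕ.m≤n+m n j)))) (euler-limit j n k k≤n)

    euler∞-≈ : ∀ n → euler∞ ≈[ suc n ] euler n
    euler∞-≈ n k (s≤s k≤n) = trans (sym (euler-limit (n ℕ.∸ k) k k ℕ.≤-refl))
                                   (cong (λ j → euler j k) (ℕ.m∸n+n≡m k≤n))

    -- Every term with s ≥ 1 contains `y N` and hence a factor `Q ^ N`; the term s = 0 survives.
    R-low : ∀ n → R (suc n) ≈[ suc n ] evens 0 (suc n)
    R-low n = go n
      where
      open SeriesSolver
      N = suc n
      go : ∀ m → Σ< (suc m) (term N) ≈[ N ] evens 0 N
      go zero    = ≈⇒≈[] (solve 1 (λ e → con false :+ e :* con true :* con true := e) ≈-refl (evens 0 N))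
      go (suc m) = []-trans ([]-+ (go m) vanish) (≈⇒≈[] (solve 1 (λ e → e :+ con false := e) ≈-refl (evens 0 N)))
        where
        c = evens (suc m) (N ℕ.∸ suc m) * odds (suc m)
        p = y N ^ m
        vanish : term N (suc m) ≈[ N ] 0ˢ
        vanish = []-trans (≈⇒≈[] (solve 4 (λ c Q b p → c :* (Q :* (b :* b) :* p) := c :* Q :* b :* p :* b) ≈-refl c Q (Q ^ N) p))
          ([]-trans ([]-* {c * Q * Q ^ N * p} (λ _ _ → refl) (Q^-low N))
                    (≈⇒≈[] (solve 1 (λ x → x :* con false := con false) ≈-refl (c * Q * Q ^ N * p))))

    q^-at : ∀ m k → (q ^ m) k ≡ ⌊ m ℕ.≟ k ⌋
    q^-at zero    zero    = refl
    q^-at zero    (suc k) = refl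
    q^-at (suc m) zero    = refl
    q^-at (suc m) (suc k) = trans (q*-suc (q ^ m) k) (trans (q^-at m k) lemma)
      where
      lemma : ⌊ m ℕ.≟ k ⌋ ≡ ⌊ suc m ℕ.≟ suc k ⌋
      lemma with m ℕ.≟ k | suc m ℕ.≟ suc k
      ... | yes _ | yes _ = refl
      ... | no _  | no _  = refl
      ... | yes e | no ne = contradiction (cong suc e) ne
      ... | no ne | yes e = contradiction (ℕ.suc-injective e) ne

    private
      level = level? (tri-weight (suc d)) all

    Σ<-count : ∀ m k → Σ< m (λ j → Q ^ tri j) k ≡ odd (length (filter (level k) (downFrom m)))
    Σ<-count zero    k = refl
    Σ<-count (suc m) k = begin
      Σ< m (λ j → Q ^ tri j) k xor (Q ^ tri m) k
        ≡⟨ cong₂ _xor_ (Σ<-count m k) (trans (at (Q^ (tri m)) k) (q^-at (suc d ℕ.* tri m) k)) ⟩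
      odd (length rest) xor ⌊ suc d ℕ.* tri m ℕ.≟ k ⌋
        ≡⟨ last ⟩
      odd (length (filter (level k) (downFrom (suc m)))) ∎
      where
      open ≡-Reasoning
      rest = filter (level k) (downFrom m)
      last : odd (length rest) xor ⌊ suc d ℕ.* tri m ℕ.≟ k ⌋ ≡ odd (length (filter (level k) (downFrom (suc m))))
      last with suc d ℕ.* tri m ℕ.≟ k
      ... | yes e = trans (Bool.xor-comm (odd (length rest)) true)
                          (cong (λ xs → odd (length xs)) (sym (filter-accept (level k) {x = m} {xs = downFrom m} (cong +_ e , refl))))
      ... | no ne = trans (Bool.xor-identityʳ _)
                          (cong (λ xs → odd (length xs)) (sym (filter-reject (level k) {x = m} {xs = downFrom m} (λ l → ne (ℤ.+-injective (proj₁ l))))))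

    ψ-Ψ : ∀ n → ψ d ≈[ n ] Ψ n
    ψ-Ψ n k k<n = trans
      (parity-unique (genψ d k) (count-filter (downFrom (double n)) (Unique.downFrom⁺ (double n)) (level k)
        (λ {j} l → ∈-downFrom⁺ (ℕ.≤-<-trans (j≤k j l) (ℕ.<-≤-trans k<n (subst (n ℕ.≤_) (sym (double-+ n)) (ℕ.m≤m+n n n))))))
        (λ l → l) (λ l → l))
      (sym (Σ<-count (double n) k))
      where
      j≤k : ∀ j → Level (tri-weight (suc d)) all k j → j ℕ.≤ k
      j≤k j (e , _) = ℕ.≤-trans (n≤tri j) (subst (tri j ℕ.≤_) (ℤ.+-injective e) (ℕ.m≤n*m (tri j) (suc d)))

    -- Jacobi's identity modulo 2
    euler∞-cube : euler∞ * (euler∞ * euler∞) ≈ ψ d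
    euler∞-cube = ≈-sym (unit-cancel {euler∞} refl ([]-limit λ N → []-weaken (ℕ.n≤1+n N) (congruence N)))
      where
      open SeriesSolver
      X = euler∞
      -- Both sides agree with the square of `evens 0 N`. On the left X is `odds N * evens 0 N` and
      -- `odds N * Ψ N` reduces to `evens 0 N`; on the right the fourth power of `euler N` is that
      -- square.
      congruence : ∀ n → X * ψ d ≈[ suc n ] X * (X * (X * X))
      congruence n =
        []-trans ([]-* ([]-trans ([]-weaken (s≤s (ℕ.≤-trans (ℕ.m≤m+n N N) (ℕ.≤-reflexive (sym (double-+ N))))) (euler∞-≈ (double N)) ⟨weaken⟩)
                                 (≈⇒≈[] (≈-sym (odds*evens N)))) (ψ-Ψ N))
        ([]-trans (≈⇒≈[] (≈-trans (solve 3 (λ o e s → o :* e :* s := e :* (o :* s)) ≈-refl (odds N) (evens 0 N) (Ψ N))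
                                  (*-congˡ (evens 0 N) (odds*Ψ N))))
        ([]-trans ([]-* {evens 0 N} (λ _ _ → refl) (R-low n))
        ([]-trans (≈⇒≈[] (≈-trans (*-cong (evens-square N) (evens-square N))
                                  (solve 1 (λ x → x :* x :* (x :* x) := x :* (x :* (x :* x))) ≈-refl (euler N))))
        ([]-sym ([]-* X≈ ([]-* X≈ ([]-* X≈ X≈)))))))
        where
        N = suc n
        X≈ : X ≈[ N ] euler N
        X≈ = []-weaken (ℕ.n≤1+n N) (euler∞-≈ N)
        _⟨weaken⟩ : X ≈[ suc N ] euler (double N) → X ≈[ N ] euler (double N)
        e ⟨weaken⟩ = []-weaken (ℕ.n≤1+n N) e

  sum-vanish : ∀ f m → (∀ j → f j ≡ 0) → sum (applyUpTo f m) ≡ 0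
  sum-vanish f zero    e = refl
  sum-vanish f (suc m) e = cong₂ ℕ._+_ (e 0) (sum-vanish (λ j → f (suc j)) m (λ j → e (suc j)))

  sum-extend : ∀ f m e → (∀ j → m ℕ.≤ j → f j ≡ 0) → sum (applyUpTo f (m ℕ.+ e)) ≡ sum (applyUpTo f m)
  sum-extend f zero    e z = sum-vanish f e (λ j → z j z≤n)
  sum-extend f (suc m) e z = cong (f 0 ℕ.+_) (sum-extend (λ j → f (suc j)) m e (λ j m≤j → z (suc j) (s≤s m≤j)))

  sum-cong : ∀ {f g} m → (∀ j → f j ≡ g j) → sum (applyUpTo f m) ≡ sum (applyUpTo g m)
  sum-cong zero    e = refl
  sum-cong (suc m) e = cong₂ ℕ._+_ (e 0) (sum-cong m (λ j → e (suc j)))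

  module _ (K : ℕ) (g : ℕ → ℕ) where

    private
      summand : ℕ → ℕ → ℕ
      summand n j = if ⌊ j ℕ.* suc K ℕ.≤? n ⌋ then g (n ℕ.∸ j ℕ.* suc K) else 0

    -- The inner sum of `pc`, over the multiplicity of the part K + 1, with the remaining count left
    -- abstract.
    multiples : ℕ → ℕ
    multiples n = sum (map (summand n) (upTo (suc n)))

    private
      multiples≡ : ∀ n → multiples n ≡ g n ℕ.+ sum (applyUpTo (λ j → summand n (suc j)) n)
      multiples≡ n = cong sum (map-upTo (summand n) (suc n))

      summand-> : ∀ n j → n ℕ.< j ℕ.* suc K → summand n j ≡ 0
      summand-> n j n< with j ℕ.* suc K ℕ.≤? n
      ... | yes ≤n = contradiction n< (ℕ.≤⇒≯ ≤n)
      ... | no _   = refl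

      summand-shift : ∀ n j → summand (suc K ℕ.+ n) (suc j) ≡ summand n j
      summand-shift n j with suc K ℕ.+ j ℕ.* suc K ℕ.≤? suc K ℕ.+ n | j ℕ.* suc K ℕ.≤? n
      ... | yes _ | yes _ = cong g (ℕ.[m+n]∸[m+o]≡n∸o (suc K) n (j ℕ.* suc K))
      ... | no _  | no _  = refl
      ... | yes ≤ | no ≰  = contradiction (ℕ.+-cancelˡ-≤ (suc K) _ _ ≤) ≰
      ... | no ≰  | yes ≤ = contradiction (ℕ.+-monoʳ-≤ (suc K) ≤) ≰

    multiples-< : ∀ n → n ℕ.< suc K → multiples n ≡ g n
    multiples-< n n< = trans (multiples≡ n) (trans
      (cong (g n ℕ.+_) (sum-vanish (λ j → summand n (suc j)) n
        (λ j → summand-> n (suc j) (ℕ.<-≤-trans n< (ℕ.m≤m+n (suc K) _)))))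
      (ℕ.+-identityʳ (g n)))

    multiples-shift : ∀ n → multiples (suc K ℕ.+ n) ≡ g (suc K ℕ.+ n) ℕ.+ multiples n
    multiples-shift n = trans (multiples≡ (suc K ℕ.+ n)) (cong (g (suc K ℕ.+ n) ℕ.+_) (begin
      sum (applyUpTo (λ j → summand (suc K ℕ.+ n) (suc j)) (suc K ℕ.+ n))
        ≡⟨ sum-cong (suc K ℕ.+ n) (summand-shift n) ⟩
      sum (applyUpTo (summand n) (suc (K ℕ.+ n)))
        ≡⟨ cong (λ m → sum (applyUpTo (summand n) (suc m))) (ℕ.+-comm K n) ⟩
      sum (applyUpTo (summand n) (suc n ℕ.+ K))
        ≡⟨ sum-extend (summand n) (suc n) K (λ j n<j → summand-> n j (ℕ.<-≤-trans n<j (ℕ.m≤m*n j (suc K)))) ⟩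
      sum (applyUpTo (summand n) (suc n))
        ≡⟨ cong sum (sym (map-upTo (summand n) (suc n))) ⟩
      multiples n ∎))
      where open ≡-Reasoning

  shift-≥ : ∀ k f n → shift k f (k ℕ.+ n) ≡ f n
  shift-≥ zero    f n = refl
  shift-≥ (suc k) f n = shift-≥ k f n

  -- Summing over the multiplicity of a part is a geometric series, that is, division by 1 - q^(K +
  -- 1).
  multiples-series : ∀ K g → (λ n → odd (multiples K g n)) * (1ˢ + q ^ suc K) ≈ (λ n → odd (g n))
  multiples-series K g = begin
    M * (1ˢ + q ^ suc K)       ≈⟨ solve 2 (λ m x → m :* (con true :+ x) := m :+ x :* m) ≈-refl M (q ^ suc K) ⟩
    M + q ^ suc K * M          ≈⟨ +-congˡ M (q^-shift (suc K) M) ⟩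
    M + shift (suc K) M        ≈⟨ ext step ⟩
    (λ n → odd (g n))          ∎
    where
    open ≈-Reasoning
    open SeriesSolver
    M : Series
    M n = odd (multiples K g n)
    step : ∀ n → M n xor shift (suc K) M n ≡ odd (g n)
    step n with suc K ℕ.≤? n
    ... | no ≰n = trans (cong₂ _xor_ (cong odd (multiples-< K g n (ℕ.≰⇒> ≰n))) (shift-< (suc K) M n (ℕ.≰⇒> ≰n))) (Bool.xor-identityʳ _)
    ... | yes ≤n = subst (λ n → M n xor shift (suc K) M n ≡ odd (g n)) (ℕ.m+[n∸m]≡n ≤n) (above (n ℕ.∸ suc K))
      where
      above : ∀ n → M (suc K ℕ.+ n) xor shift (suc K) M (suc K ℕ.+ n) ≡ odd (g (suc K ℕ.+ n))
      above n = trans (cong₂ _xor_ (trans (cong odd (multiples-shift K g n)) (odd-+ (g (suc K ℕ.+ n)) (multiples K g n))) (shift-≥ (suc K) M n))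
        (trans (Bool.xor-assoc (odd (g (suc K ℕ.+ n))) _ _) (trans (cong (odd (g (suc K ℕ.+ n)) xor_) (Bool.xor-same (M n))) (Bool.xor-identityʳ _)))

  pc-suc : ∀ t k n → pc t n (suc k) ≡ (if ⌊ t ∣? suc k ⌋ then pc t n k else multiples k (λ i → pc t i k) n)
  pc-suc t k zero    = refl
  pc-suc t k (suc n) = refl

  module _ (t : ℕ) where

    partitions : ℕ → Series
    partitions k n = odd (pc t n k)

    multiples-product : ℕ → Series
    multiples-product zero    = 1ˢ
    multiples-product (suc k) = if ⌊ t ∣? suc k ⌋ then multiples-product k * (1ˢ + q ^ suc k) else multiples-product k

    open Limit 0 using (euler; Q^)

    private
      Q₁ : Series
      Q₁ = Limit.Q 0
      Q₁^ : ∀ m → Q₁ ^ m ≈ q ^ m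
      Q₁^ m = ≈-trans (Q^ m) (ext λ n → cong (λ j → (q ^ j) n) (ℕ.*-identityˡ m))

    -- Each factor of `euler k` cancels one admissible part; the factors belonging to multiples of t
    -- meet no part and stay.
    partitions-product : ∀ k → partitions k * euler k ≈ multiples-product k
    partitions-product zero = ≈-trans (*-cong {g = 1ˢ} (ext λ { zero → refl ; (suc n) → refl }) ≈-refl)
                                      (solve 1 (λ x → con true :* con true := con true) ≈-refl 1ˢ)
      where open SeriesSolver
    partitions-product (suc k) with ⌊ t ∣? suc k ⌋ | pc-suc t k
    ... | true | e = begin
      partitions (suc k) * (euler k * (1ˢ + Q₁ ^ suc k))
        ≈⟨ *-cong (ext λ n → cong odd (e n)) (*-congˡ (euler k) (+-congˡ 1ˢ (Q₁^ (suc k)))) ⟩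
      partitions k * (euler k * (1ˢ + q ^ suc k))
        ≈⟨ ≈-sym (*ˢ-assoc (partitions k) (euler k) (1ˢ + q ^ suc k)) ⟩
      partitions k * euler k * (1ˢ + q ^ suc k)
        ≈⟨ *-cong (partitions-product k) ≈-refl ⟩
      multiples-product k * (1ˢ + q ^ suc k) ∎
      where open ≈-Reasoning
    ... | false | e = begin
      partitions (suc k) * (euler k * (1ˢ + Q₁ ^ suc k))
        ≈⟨ *-cong (ext λ n → cong odd (e n)) (*-congˡ (euler k) (+-congˡ 1ˢ (Q₁^ (suc k)))) ⟩
      M * (euler k * (1ˢ + q ^ suc k))
        ≈⟨ solve 3 (λ m e f → m :* (e :* f) := m :* f :* e) ≈-refl M (euler k) (1ˢ + q ^ suc k) ⟩
      M * (1ˢ + q ^ suc k) * euler k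
        ≈⟨ *-cong (multiples-series k (λ i → pc t i k)) ≈-refl ⟩
      partitions k * euler k
        ≈⟨ partitions-product k ⟩
      multiples-product k ∎
      where
      open ≈-Reasoning
      open SeriesSolver
      M : Series
      M n = odd (multiples k (λ i → pc t i k) n)

    pc-stable-suc : ∀ k n → n ℕ.< suc k → pc t n (suc k) ≡ pc t n k
    pc-stable-suc k n n≤k with ⌊ t ∣? suc k ⌋ | pc-suc t k n
    ... | true  | e = e
    ... | false | e = trans e (multiples-< k (λ i → pc t i k) n n≤k)

    pc-stable : ∀ j n → pc t n (j ℕ.+ n) ≡ pc t n n
    pc-stable zero    n = refl
    pc-stable (suc j) n = trans (pc-stable-suc (j ℕ.+ n) n (s≤s (ℕ.m≤n+m n j))) (pc-stable j n)

    regular : Series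
    regular n = odd (pc t n n)

    regular-≈ : ∀ k → regular ≈[ suc k ] partitions k
    regular-≈ k n (s≤s n≤k) = cong odd (trans (sym (pc-stable (k ℕ.∸ n) n)) (cong (pc t n) (ℕ.m∸n+n≡m n≤k)))

  module _ (d : ℕ) where

    private
      t = suc d
      module E₁ = Limit 0
      module Eₜ = Limit d

    multiples-product-gap : ∀ m i → i ℕ.< t → multiples-product t (i ℕ.+ t ℕ.* m) ≈ multiples-product t (t ℕ.* m)
    multiples-product-gap m zero    _ = ≈-refl
    multiples-product-gap m (suc i) i<t with t ∣? suc (i ℕ.+ t ℕ.* m)
    ... | yes t∣ = contradiction (∣m+n∣m⇒∣n (subst (t ∣_) (ℕ.+-comm (suc i) (t ℕ.* m)) t∣) (m∣m*n m)) (>⇒∤ i<t)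
    ... | no _   = multiples-product-gap m i (ℕ.<-trans (ℕ.n<1+n i) i<t)

    multiples-product-euler : ∀ m → multiples-product t (t ℕ.* m) ≈ Eₜ.euler m
    multiples-product-euler zero = ext λ n → cong (λ j → multiples-product t j n) (ℕ.*-zeroʳ t)
    multiples-product-euler (suc m) = begin
      multiples-product t (t ℕ.* suc m)
        ≡⟨ cong (multiples-product t) (ℕ.*-suc t m) ⟩
      multiples-product t (suc (d ℕ.+ t ℕ.* m))
        ≈⟨ last ⟩
      multiples-product t (d ℕ.+ t ℕ.* m) * (1ˢ + q ^ suc (d ℕ.+ t ℕ.* m))
        ≈⟨ *-cong (≈-trans (multiples-product-gap m d ℕ.≤-refl) (multiples-product-euler m))
             (+-congˡ 1ˢ (≈-trans (ext λ n → cong (λ j → (q ^ j) n) (sym (ℕ.*-suc t m))) (≈-sym (Eₜ.Q^ (suc m))))) ⟩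
      Eₜ.euler m * (1ˢ + Eₜ.Q ^ suc m) ∎
      where
      open ≈-Reasoning
      last : multiples-product t (suc (d ℕ.+ t ℕ.* m))
             ≈ multiples-product t (d ℕ.+ t ℕ.* m) * (1ˢ + q ^ suc (d ℕ.+ t ℕ.* m))
      last with t ∣? suc (d ℕ.+ t ℕ.* m)
      ... | yes _ = ≈-refl
      ... | no t∤ = contradiction (subst (t ∣_) (ℕ.*-suc t m) (m∣m*n (suc m))) t∤

    regular-product : regular t * E₁.euler∞ ≈ Eₜ.euler∞
    regular-product = []-limit λ N →
      []-trans ([]-* ([]-weaken (bound N) (regular-≈ t (t ℕ.* N))) ([]-weaken (bound N) (E₁.euler∞-≈ (t ℕ.* N))))
      ([]-trans (≈⇒≈[] (≈-trans (partitions-product t (t ℕ.* N)) (multiples-product-euler N)))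
                ([]-sym ([]-weaken (ℕ.n≤1+n N) (Eₜ.euler∞-≈ N))))
      where
      bound : ∀ N → N ℕ.≤ suc (t ℕ.* N)
      bound N = ℕ.m≤n⇒m≤1+n (ℕ.m≤n*m N t)

-- Algebraic relations of the theta series with `w`, and the even part of `G`.

module RationalParametrisation where

  open PowerSeries
  open WeightedSets
  open ThetaSeries
  open KroneckerIdentity
  open Dissections
  open EulerProducts
  open import Data.Integer as ℤ using (+_; -[1+_])
  open import Data.Bool using (true; false)
  open import Relation.Binary.PropositionalEquality using (refl)

  open SeriesSolver
  open ≈-Reasoning

  A B S T L₁ L₂ w G a : Series
  A  = J (+ 0)
  B  = J (+ 1)
  S  = Sq (+ 1)
  T  = Sq (+ 2)
  L₁ = E₂
  L₂ = E₃
  w  = B * inverse A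
  G  = q * regular 25
  a  = 1ˢ + w + w * w

  A*w : A * w ≈ B
  A*w = begin
    A * (B * inverse A)  ≈⟨ solve 3 (λ a b c → a :* (b :* c) := b :* (a :* c)) ≈-refl A B (inverse A) ⟩
    B * (A * inverse A)  ≈⟨ *-congˡ B (*-inverse A refl) ⟩
    B * 1ˢ               ≈⟨ solve 1 (λ b → b :* con true := b) ≈-refl B ⟩
    B                    ∎

  A-cancel : ∀ {f g} → A * f ≈ A * g → f ≈ g
  A-cancel = unit-cancel {A} refl

  -- For residue 2 both theta factors in Kronecker's identity are `A`: one is the reflection of
  -- `J (+ 0)`, the other its shift. Cancelling them identifies the factor common to all residues.
  Y≈qL₁ : Y ≈ q * L₁
  Y≈qL₁ = A-cancel (begin
    A * Y              ≈⟨ *ˢ-comm A Y ⟩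
    Y * A              ≈⟨ *-congˡ Y (≈-sym (J-shift (+ 0))) ⟩
    Y * J (+ 5)        ≈⟨ ≈-sym (kronecker 1 2 refl) ⟩
    q * (J (+ 4) * L₁) ≈⟨ *-congˡ q (*-cong (J-reflect (+ 0)) ≈-refl) ⟩
    q * (A * L₁)       ≈⟨ solve 3 (λ q a l → q :* (a :* l) := a :* (q :* l)) ≈-refl q A L₁ ⟩
    A * (q * L₁)       ∎)

  -- Kronecker's identity for residue 1, whose theta factors are `B` on the side of the Lambert
  -- series and `A` on the side of `Y`.
  L₁≈wS : L₁ ≈ w * S
  L₁≈wS = A-cancel (q-cancel (begin
    q * (A * L₁)       ≈⟨ solve 3 (λ q a l → q :* (a :* l) := q :* l :* a) ≈-refl q A L₁ ⟩
    q * L₁ * A         ≈⟨ *-cong (≈-sym Y≈qL₁) (≈-sym (J-reflect (+ 0))) ⟩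
    Y * J (+ 4)        ≈⟨ ≈-sym (kronecker 0 3 refl) ⟩
    q * (J (+ 3) * E₁) ≈⟨ *-congˡ q (*-cong (J-reflect (+ 1)) E₁≈Sq-1) ⟩
    q * (B * S)        ≈⟨ *-congˡ q (*-cong (≈-sym A*w) ≈-refl) ⟩
    q * (A * w * S)    ≈⟨ solve 4 (λ q a w s → q :* (a :* w :* s) := q :* (a :* (w :* s))) ≈-refl q A w S ⟩
    q * (A * (w * S))  ∎))

  -- Residue 3, where the theta factors `A` and `B` have exchanged sides.
  L₂≈wL₁ : L₂ ≈ w * L₁
  L₂≈wL₁ = A-cancel (q-cancel (begin
    q * (A * L₂)        ≈⟨ *-congˡ q (*-cong (≈-sym (J-shift (+ 0))) ≈-refl) ⟩
    q * (J (+ 5) * L₂)  ≈⟨ kronecker 2 1 refl ⟩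
    Y * J (+ 6)         ≈⟨ *-cong Y≈qL₁ (J-shift (+ 1)) ⟩
    q * L₁ * B          ≈⟨ *-congˡ (q * L₁) (≈-sym A*w) ⟩
    q * L₁ * (A * w)    ≈⟨ solve 4 (λ q l a w → q :* l :* (a :* w) := q :* (a :* (w :* l))) ≈-refl q L₁ A w ⟩
    q * (A * (w * L₁))  ∎))

  -- The binary theta transformation at α = 1, where the other theta factor has class 2 α - 2 = 0.
  Z≈w²SA : Z ≈ w * w * S * A
  Z≈w²SA = A-cancel (begin
    A * Z                      ≈⟨ *ˢ-comm A Z ⟩
    Z * A                      ≈⟨ ≈-sym (J-square*Sq (+ 1)) ⟩
    B * B * S                  ≈⟨ *-cong (*-cong (≈-sym A*w) (≈-sym A*w)) ≈-refl ⟩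
    A * w * (A * w) * S        ≈⟨ solve 3 (λ a w s → a :* w :* (a :* w) :* s := a :* (w :* w :* s :* a)) ≈-refl A w S ⟩
    A * (w * w * S * A)        ∎)

  -- The same transformation at α = 0; its class -2 ≡ 3 is the reflection of 1, so the other factor
  -- is `B`.
  T≈w³S : T ≈ w * w * w * S
  T≈w³S = A-cancel (A-cancel (begin
    A * (A * T)                ≈⟨ ≈-sym (*ˢ-assoc A A T) ⟩
    A * A * T                  ≈⟨ J-square*Sq (+ 0) ⟩
    Z * J -[1+ 1 ]             ≈⟨ *-cong Z≈w²SA (≈-trans (≈-sym (J-shift -[1+ 1 ])) (J-reflect (+ 1))) ⟩
    w * w * S * A * B          ≈⟨ *-congˡ (w * w * S * A) (≈-sym A*w) ⟩
    w * w * S * A * (A * w)    ≈⟨ solve 3 (λ a w s → w :* w :* s :* a :* (a :* w) := a :* (a :* (w :* w :* w :* s))) ≈-refl A w S ⟩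
    A * (A * (w * w * w * S))  ∎))

  1+w⁵ : Series
  1+w⁵ = 1ˢ + w * (w * w) * (w * w)

  -- In the combination (T + S⁴) + w⁸ (S + T⁴) of the two parity dissections the terms q w⁸ A⁸
  -- cancel. With T = w³ S only `S` and `w` remain: S times w³ (1 + w⁵) + S³ (1 + w⁵)⁴.
  S*X≈0 : S * (w * (w * w) * 1+w⁵ + S * (S * S) * ((1+w⁵ * 1+w⁵) * (1+w⁵ * 1+w⁵))) ≈ 0ˢ
  S*X≈0 = begin
    S * (w * (w * w) * 1+w⁵ + S * (S * S) * ((1+w⁵ * 1+w⁵) * (1+w⁵ * 1+w⁵)))
      ≈⟨ solve 2 (λ s w → let f = con true :+ w :* (w :* w) :* (w :* w) ; t = w :* w :* w :* s ; p = (w :* w) :* (w :* w) in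
           s :* (w :* (w :* w) :* f :+ s :* (s :* s) :* ((f :* f) :* (f :* f)))
           := (t :+ (s :* s) :* (s :* s)) :+ (p :* p) :* (s :+ (t :* t) :* (t :* t))) ≈-refl S w ⟩
    (t + S ⁴) + w ⁸ * (S + t ⁴)
      ≈⟨ +-cong (+-cong (≈-sym T≈w³S) ≈-refl) (*-congˡ (w ⁸) (+-congˡ S
           (*-cong (*-cong (≈-sym T≈w³S) (≈-sym T≈w³S)) (*-cong (≈-sym T≈w³S) (≈-sym T≈w³S))))) ⟩
    (T + S ⁴) + w ⁸ * (S + T ⁴)
      ≈⟨ +-cong T+S⁴ (*-congˡ (w ⁸) S+T⁴) ⟩
    q * (w * A) ⁸ + w ⁸ * (q * A ⁸)
      ≈⟨ solve 3 (λ q w a → let v = w :* a in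
           q :* (((v :* v) :* (v :* v)) :* ((v :* v) :* (v :* v)))
             :+ (((w :* w) :* (w :* w)) :* ((w :* w) :* (w :* w))) :* (q :* (((a :* a) :* (a :* a)) :* ((a :* a) :* (a :* a))))
           := con false) ≈-refl q w A ⟩
    0ˢ ∎
    where
    t = w * w * w * S
    S+T⁴ : S + T ⁴ ≈ q * A ⁸
    S+T⁴ = ≈-trans (+-cong Sq-1 ≈-refl) (solve 2 (λ x y → x :+ y :+ x := y) ≈-refl (T ⁴) (q * A ⁸))
    T+S⁴ : T + S ⁴ ≈ q * (w * A) ⁸
    T+S⁴ = ≈-trans (+-cong Sq-2 ≈-refl) (≈-trans (solve 2 (λ x y → x :+ y :+ x := y) ≈-refl (S ⁴) (q * J (+ 3) ⁸))
      (*-congˡ q (8th (≈-trans (J-reflect (+ 1)) (≈-trans (≈-sym A*w) (*ˢ-comm A w))))))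
      where
      4th : ∀ {f g} → f ≈ g → f ⁴ ≈ g ⁴
      4th e = *-cong (*-cong e e) (*-cong e e)
      8th : ∀ {f g} → f ≈ g → f ⁸ ≈ g ⁸
      8th e = *-cong (4th e) (4th e)

  -- Dividing the preceding relation by `S` and by one factor `1+w⁵` shows that both sides have the
  -- same cube.
  S*1+w⁵ : S * 1+w⁵ ≈ w
  S*1+w⁵ = cube-injective {S * 1+w⁵} {w} refl refl refl refl (unit-cancel {1+w⁵} refl (begin
    1+w⁵ * (S * 1+w⁵ * (S * 1+w⁵ * (S * 1+w⁵)))
      ≈⟨ solve 2 (λ s f → f :* (s :* f :* (s :* f :* (s :* f))) := s :* (s :* s) :* ((f :* f) :* (f :* f))) ≈-refl S 1+w⁵ ⟩
    S * (S * S) * ((1+w⁵ * 1+w⁵) * (1+w⁵ * 1+w⁵))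
      -- `S` begins with q, so it is cancelled as q times the unit `tail S`.
      ≈⟨ ≈-sym (+≈0⇒≈ (unit-cancel₀ {tail S} refl (q-cancel (begin
           q * (tail S * X) ≈⟨ ≈-sym (*ˢ-assoc q (tail S) X) ⟩
           q * tail S * X   ≈⟨ *-cong (≈-sym (q*tail S refl)) ≈-refl ⟩
           S * X            ≈⟨ S*X≈0 ⟩
           0ˢ               ≈⟨ solve 1 (λ q → con false := q :* con false) ≈-refl q ⟩
           q * 0ˢ           ∎)))) ⟩
    w * (w * w) * 1+w⁵
      ≈⟨ *ˢ-comm (w * (w * w)) 1+w⁵ ⟩
    1+w⁵ * (w * (w * w)) ∎))
    where
    X = w * (w * w) * 1+w⁵ + S * (S * S) * ((1+w⁵ * 1+w⁵) * (1+w⁵ * 1+w⁵))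

  -- Cubing the product for 25-regular partitions makes both Euler products cubes, which Jacobi's
  -- identity turns into triangular theta series in q and in q^25.
  G³ψ≈Z : G * (G * G) * ψ 0 ≈ Z
  G³ψ≈Z = begin
    G * (G * G) * ψ 0
      ≈⟨ *-congˡ (G * (G * G)) (≈-sym (Limit.euler∞-cube 0)) ⟩
    G * (G * G) * (x * (x * x))
      ≈⟨ solve 3 (λ q r x → (q :* r) :* ((q :* r) :* (q :* r)) :* (x :* (x :* x))
           := q :* (q :* (q :* ((r :* x) :* ((r :* x) :* (r :* x)))))) ≈-refl q (regular 25) x ⟩
    q * (q * (q * ((regular 25 * x) * ((regular 25 * x) * (regular 25 * x)))))
      ≈⟨ *-congˡ q (*-congˡ q (*-congˡ q (≈-trans
           (*-cong (regular-product 24) (*-cong (regular-product 24) (regular-product 24))) (Limit.euler∞-cube 24)))) ⟩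
    q * (q * (q * ψ 24))
      ≈⟨ ≈-sym Z≈q³ψ ⟩
    Z ∎
    where x = Limit.euler∞ 0

  -- The dissection gives ψ = A (1 + w + w² S), hence G³ (1 + w + w² S) = w² S. Multiplication by 1
  -- + w⁵ and the relation S (1 + w⁵) = w make the bracket (1 + w + w²)³ and the right side w³; the
  -- cube root is then taken.
  G*a : G * a ≈ w
  G*a = cube-injective {G * a} {w} refl refl refl refl (begin
    G * a * (G * a * (G * a))
      ≈⟨ solve 2 (λ g w → let a = con true :+ w :+ w :* w ; f = con true :+ w :* (w :* w) :* (w :* w) in
           (g :* a) :* ((g :* a) :* (g :* a)) := g :* (g :* g) :* (f :+ w :* f :+ w :* w :* w)) ≈-refl G w ⟩
    G * (G * G) * (1+w⁵ + w * 1+w⁵ + w * w * w)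
      ≈⟨ *-congˡ (G * (G * G)) (+-congˡ (1+w⁵ + w * 1+w⁵) (*-congˡ (w * w) (≈-sym S*1+w⁵))) ⟩
    G * (G * G) * (1+w⁵ + w * 1+w⁵ + w * w * (S * 1+w⁵))
      ≈⟨ solve 4 (λ g w s f → g :* (f :+ w :* f :+ w :* w :* (s :* f)) := f :* (g :* (con true :+ w :+ w :* w :* s)))
           ≈-refl (G * (G * G)) w S 1+w⁵ ⟩
    1+w⁵ * (G * (G * G) * (1ˢ + w + w * w * S))
      ≈⟨ *-congˡ 1+w⁵ (A-cancel (begin
           A * (G * (G * G) * (1ˢ + w + w * w * S))
             ≈⟨ solve 4 (λ a g w s → a :* (g :* (con true :+ w :+ w :* w :* s)) := g :* (a :+ a :* w :+ w :* w :* s :* a))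
                  ≈-refl A (G * (G * G)) w S ⟩
           G * (G * G) * (A + A * w + w * w * S * A)
             ≈⟨ *-congˡ (G * (G * G)) (+-cong (+-congˡ A A*w) (≈-sym Z≈w²SA)) ⟩
           G * (G * G) * (A + B + Z)
             ≈⟨ *-congˡ (G * (G * G)) (≈-sym ψ-dissection) ⟩
           G * (G * G) * ψ 0
             ≈⟨ G³ψ≈Z ⟩
           Z
             ≈⟨ Z≈w²SA ⟩
           w * w * S * A
             ≈⟨ *ˢ-comm (w * w * S) A ⟩
           A * (w * w * S) ∎)) ⟩
    1+w⁵ * (w * w * S)
      ≈⟨ solve 3 (λ f w s → f :* (w :* w :* s) := (s :* f) :* (w :* w)) ≈-refl 1+w⁵ w S ⟩
    S * 1+w⁵ * (w * w)
      ≈⟨ *-cong S*1+w⁵ ≈-refl ⟩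
    w * (w * w) ∎)

  even-part-S : even-part S ≈ T * T
  even-part-S = begin
    even-part S
      ≈⟨ even-part-cong Sq-1 ⟩
    even-part ((T * T) * (T * T)) + even-part (q * ((A ⁴) * (A ⁴)))
      ≈⟨ +-cong (even-part-square (T * T)) (even-part-q-square (A ⁴)) ⟩
    T * T + 0ˢ
      ≈⟨ solve 1 (λ t → t :+ con false := t) ≈-refl (T * T) ⟩
    T * T ∎

  -- Adding the square w⁶ helps: w + w⁶ = (1 + w⁵) w = (1 + w⁵)² S, and the even part of `S` is
  -- known from its parity dissection.
  even-part-w : even-part w ≈ w * w * S
  even-part-w = begin
    even-part w
      ≈⟨ even-part-cong (solve 1 (λ w → w := (w :+ w :* w :* w :* (w :* w :* w)) :+ w :* w :* w :* (w :* w :* w)) ≈-refl w) ⟩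
    even-part (w + w³ * w³) + even-part (w³ * w³)
      ≈⟨ +-cong (even-part-cong w+w⁶) (even-part-square w³) ⟩
    even-part (1+w⁵ * 1+w⁵ * S) + w³
      ≈⟨ +-cong (≈-trans (even-part-square-* 1+w⁵ S) (*-congˡ 1+w⁵ (≈-trans even-part-S (*-cong T≈w³S T≈w³S)))) ≈-refl ⟩
    1+w⁵ * (w³ * S * (w³ * S)) + w³
      ≈⟨ solve 3 (λ f w s → f :* ((w :* w :* w :* s) :* (w :* w :* w :* s)) :+ w :* w :* w
           := (s :* f) :* (w :* w :* w :* (w :* w :* w) :* s) :+ w :* w :* w) ≈-refl 1+w⁵ w S ⟩
    (S * 1+w⁵) * (w³ * w³ * S) + w³
      ≈⟨ +-cong (*-cong S*1+w⁵ ≈-refl) (*-congˡ (w * w) (≈-sym S*1+w⁵)) ⟩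
    w * (w³ * w³ * S) + w * w * (S * 1+w⁵)
      ≈⟨ solve 2 (λ w s → w :* (w :* w :* w :* (w :* w :* w) :* s) :+ w :* w :* (s :* (con true :+ w :* (w :* w) :* (w :* w)))
           := w :* w :* s) ≈-refl w S ⟩
    w * w * S ∎
    where
    w³ = w * w * w
    w+w⁶ : w + w³ * w³ ≈ 1+w⁵ * 1+w⁵ * S
    w+w⁶ = begin
      w + w³ * w³       ≈⟨ solve 1 (λ w → w :+ w :* w :* w :* (w :* w :* w) := (con true :+ w :* (w :* w) :* (w :* w)) :* w) ≈-refl w ⟩
      1+w⁵ * w          ≈⟨ *-congˡ 1+w⁵ (≈-sym S*1+w⁵) ⟩
      1+w⁵ * (S * 1+w⁵) ≈⟨ solve 2 (λ f s → f :* (s :* f) := f :* f :* s) ≈-refl 1+w⁵ S ⟩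
      1+w⁵ * 1+w⁵ * S   ∎

  -- The factor a² leaves the even part as `a`, and a² G = a w = w + w² + w³, so the even parts of
  -- powers of `w` decide. Cancelling the unit `a` leaves the four series.
  even-part-G : even-part G ≈ S + T + (L₁ + L₂)
  even-part-G = unit-cancel {a} refl (begin
    a * even-part G
      ≈⟨ ≈-sym (even-part-square-* a G) ⟩
    even-part (a * a * G)
      ≈⟨ even-part-cong (≈-trans (solve 2 (λ a g → a :* a :* g := a :* (g :* a)) ≈-refl a G) (≈-trans (*-congˡ a G*a)
           (solve 1 (λ w → (con true :+ w :+ w :* w) :* w := w :+ w :* w :+ w :* w :* w) ≈-refl w))) ⟩
    even-part w + even-part (w * w) + even-part (w * w * w)
      ≈⟨ +-cong (+-cong even-part-w (even-part-square w)) (≈-trans (even-part-square-* w w) (*-congˡ w even-part-w)) ⟩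
    w * w * S + w + w * (w * w * S)
      ≈⟨ +-cong (+-congˡ (w * w * S) (≈-sym S*1+w⁵)) ≈-refl ⟩
    w * w * S + S * 1+w⁵ + w * (w * w * S)
      ≈⟨ solve 2 (λ w s → w :* w :* s :+ s :* (con true :+ w :* (w :* w) :* (w :* w)) :+ w :* (w :* w :* s)
           := (con true :+ w :+ w :* w) :* (s :+ w :* w :* w :* s :+ (w :* s :+ w :* (w :* s)))) ≈-refl w S ⟩
    a * (S + w * w * w * S + (w * S + w * (w * S)))
      ≈⟨ *-congˡ a (+-cong (+-congˡ S (≈-sym T≈w³S))
           (+-cong (≈-sym L₁≈wS) (≈-trans (*-congˡ w (≈-sym L₁≈wS)) (≈-sym L₂≈wL₁)))) ⟩
    a * (S + T + (L₁ + L₂)) ∎)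

-- The even part of `G` as a count of squares and divisor pairs.

module DivisorCoefficients where

  open ResidueClasses
  open PowerSeries
  open WeightedSets
  open ThetaSeries
  open KroneckerIdentity
  open Dissections
  open RationalParametrisation
  open import Data.Nat as ℕ using (ℕ; zero; suc; z≤n; s≤s; NonZero)
  import Data.Nat.Properties as ℕ
  open import Data.Nat.DivMod using (_%_; _/_)
  open import Data.Integer as ℤ using (ℤ; +_; -[1+_])
  import Data.Integer.Properties as ℤ
  open import Data.Bool as Bool using (Bool; true; false; not; _∧_; _xor_)
  import Data.Bool.Properties as Bool
  open import Data.List using (upTo; cartesianProduct)
  open import Data.List.Membership.Propositional.Properties using (∈-upTo⁺; ∈-cartesianProduct⁺)
  import Data.List.Relation.Unary.Unique.Propositional.Properties as Unique
  open import Data.Product using (_×_; _,_; proj₁; proj₂)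
  open import Data.Sum using (_⊎_; inj₁; inj₂)
  open import Relation.Binary.PropositionalEquality
    using (_≡_; _≢_; refl; sym; trans; cong; cong₂; subst)

  square-weight : ℕ → ℤ
  square-weight k = + (k ℕ.* k)

  product-weight : ℕ × ℕ → ℤ
  product-weight (d , e) = + (d ℕ.* e)

  divisor-class : ℕ × ℕ → Bool
  divisor-class (d , e) = class is-±1 d ∧ class is-±2 e

  genSquares : Gen square-weight (class is-unit)
  genSquares n = count-filter (upTo (suc n)) (Unique.upTo⁺ (suc n)) (level? square-weight (class is-unit) n)
    (λ {k} l → ∈-upTo⁺ (s≤s (subst (k ℕ.≤_) (ℤ.+-injective (proj₁ l)) (m≤m*m k))))

  class-≢0 : ∀ f → f 0 ≡ false → ∀ {n} → class f n ≡ true → NonZero n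
  class-≢0 f f0 {zero}  x with () ← trans (sym f0) x
  class-≢0 f f0 {suc n} x = _

  genDivisors : Gen product-weight divisor-class
  genDivisors n = count-filter (cartesianProduct box box) (Unique.cartesianProduct⁺ (Unique.upTo⁺ (suc n)) (Unique.upTo⁺ (suc n)))
    (level? product-weight divisor-class n) λ { {d , e} (eq , x) →
      let (x₁ , x₂) = ∧-true⁻ {class is-±1 d} x ; de≡n = ℤ.+-injective eq in
      ∈-cartesianProduct⁺ (∈-upTo⁺ (s≤s (subst (d ℕ.≤_) de≡n (ℕ.m≤m*n d e {{class-≢0 is-±2 refl {e} x₂}}))))
                          (∈-upTo⁺ (s≤s (subst (e ℕ.≤_) de≡n (ℕ.m≤n*m e d {{class-≢0 is-±1 refl {d} x₁}})))) }
    where box = upTo (suc n)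

  module SignedValue (c c′ : ℕ) (c<5 : c ℕ.< 5) (c′<5 : c′ ℕ.< 5) (c′≢c : c′ ≢ c) where

    open Signed c c′ c<5 c′<5 c′≢c public

    value-nonneg : ∀ a → 5× (+ a) ℤ.+ + c ≡ + magnitude (+ a)
    value-nonneg a = trans (affine-nonneg a c) (cong +_ (trans (ℕ.+-comm (5 ℕ.* a) c) (cong (c ℕ.+_) (ℕ.*-comm 5 a))))

    value-neg : c ℕ.+ c′ ≡ 5 → ∀ a → 5× -[1+ a ] ℤ.+ + c ≡ ℤ.- (+ magnitude -[1+ a ])
    value-neg e a = trans (affine-neg a c c′ e)
      (cong (λ t → ℤ.- (+ t)) (trans (ℕ.+-comm (5 ℕ.* a) c′) (cong (c′ ℕ.+_) (ℕ.*-comm 5 a))))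

    square-value : c ℕ.+ c′ ≡ 5 → ∀ i → square-weight (magnitude i) ≡ sq-weight (+ c) i
    square-value e (+ a)    = sym (trans (cong₂ ℤ._*_ (value-nonneg a) (value-nonneg a)) (sym (ℤ.pos-* (magnitude (+ a)) _)))
    square-value e -[1+ a ] = sym (trans (cong₂ ℤ._*_ (value-neg e a) (value-neg e a)) (neg-*-neg (magnitude -[1+ a ]) (magnitude -[1+ a ])))

  private
    1<5 = s≤s (s≤s (z≤n {3}))
    2<5 = s≤s (s≤s (s≤s (z≤n {2})))
    3<5 = s≤s (s≤s (s≤s (s≤s (z≤n {1}))))
    4<5 = s≤s (s≤s (s≤s (s≤s (s≤s (z≤n {0})))))

    module ±1 = SignedValue 1 4 1<5 4<5 (λ ())
    module ±2 = SignedValue 2 3 2<5 3<5 (λ ())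
    module ±3 = SignedValue 3 2 3<5 2<5 (λ ())

  squares : S + T ≈ gf genSquares
  squares = ≈-sym (≈-trans (gf-split genSquares (class is-±1)) (+-cong
    (gf-bijection ±1.signed ±1.magnitude (λ _ → refl)
      (λ {i} _ → cong₂ _∧_ (±1.magnitude-class is-unit refl refl i) (±1.magnitude-class is-±1 refl refl i))
      (λ {k} x → back₁ k x) (λ {i} _ → ±1.signed-magnitude i)
      (λ {k} x → trans (sym (±1.square-value refl (±1.signed k))) (cong square-weight (back₁ k x)))
      (gen-restrict genSquares (class is-±1)) (genSq (+ 1)))
    (gf-bijection ±2.signed ±2.magnitude (λ _ → refl)
      (λ {i} _ → cong₂ _∧_ (±2.magnitude-class is-unit refl refl i) (±2.magnitude-class (λ r → not (is-±1 r)) refl refl i))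
      (λ {k} x → back₂ k x) (λ {i} _ → ±2.signed-magnitude i)
      (λ {k} x → trans (sym (±2.square-value refl (±2.signed k))) (cong square-weight (back₂ k x)))
      (gen-restrict genSquares (λ k → not (class is-±1 k))) (genSq (+ 2)))))
    where
    back₁ : ∀ k → class is-unit k ∧ class is-±1 k ≡ true → ±1.magnitude (±1.signed k) ≡ k
    back₁ k x = ±1.magnitude-signed k (±1-residue (k % 5) (proj₂ (∧-true⁻ {class is-unit k} x)))
    back₂ : ∀ k → class is-unit k ∧ not (class is-±1 k) ≡ true → ±2.magnitude (±2.signed k) ≡ k
    back₂ k x = ±2.magnitude-signed k (other (k % 5) x)
      where
      other : ∀ r → is-unit r ∧ not (is-±1 r) ≡ true → r ≡ 2 ⊎ r ≡ 3
      other 2 _ = inj₁ refl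
      other 3 _ = inj₂ refl
      other 4 ()
      other (suc (suc (suc (suc (suc _))))) ()

  module _ (c c′ : ℕ) (e : suc c ℕ.+ suc c′ ≡ 5) (c<5 : suc c ℕ.< 5) (c′<5 : suc c′ ℕ.< 5) (c′≢c : suc c′ ≢ suc c)
           (fc : is-±2 (suc c) ≡ true) (fc′ : is-±2 (suc c′) ≡ true)
           (residues : ∀ r → is-±2 r ≡ true → r ≡ suc c ⊎ r ≡ suc c′) where

    private
      module ±c = SignedValue (suc c) (suc c′) c<5 c′<5 c′≢c

    -- Writing d = ±(5 r + 1) and e = ±(5 s + `suc c`), equal signs mean e ≡ `suc c` · d (mod 5).
    aligned : ℕ × ℕ → Bool
    aligned (d , e) = same (±1.signed d , ±c.signed e)

    E-divisors : (g : Gen product-weight (λ de → divisor-class de ∧ aligned de)) → gf (Lambert.genE c c′ e) ≈ gf g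
    E-divisors g = ≈-sym (gf-bijection (λ { (d , e) → ±1.signed d , ±c.signed e }) (λ { (r , s) → ±1.magnitude r , ±c.magnitude s })
      (λ { {d , e} x → proj₂ (∧-true⁻ {divisor-class (d , e)} x) })
      (λ { {r , s} x → cong₂ _∧_ (cong₂ _∧_ (±1.magnitude-class is-±1 refl refl r) (±c.magnitude-class is-±2 fc fc′ s))
                         (trans (cong same (cong₂ _,_ (±1.signed-magnitude r) (±c.signed-magnitude s))) x) })
      (λ {de} x → back de x)
      (λ { {r , s} _ → cong₂ _,_ (±1.signed-magnitude r) (±c.signed-magnitude s) })
      (λ { {d , e} x → trans (sym (weight (±1.signed d) (±c.signed e) (proj₂ (∧-true⁻ {divisor-class (d , e)} x))))
                             (cong product-weight (back (d , e) x)) }) g (Lambert.genE c c′ e))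
      where
      back : ∀ de → divisor-class de ∧ aligned de ≡ true →
             (±1.magnitude (±1.signed (proj₁ de)) , ±c.magnitude (±c.signed (proj₂ de))) ≡ de
      back (d , e) x = let (x₁ , x₂) = ∧-true⁻ {class is-±1 d} (proj₁ (∧-true⁻ {divisor-class (d , e)} x)) in
        cong₂ _,_ (±1.magnitude-signed d (±1-residue (d % 5) x₁)) (±c.magnitude-signed e (residues (e % 5) x₂))
      weight : ∀ r s → same (r , s) ≡ true → product-weight (±1.magnitude r , ±c.magnitude s) ≡ e-weight (+ suc c) (r , s)
      weight (+ a)    (+ b)    _ = sym (trans (cong₂ ℤ._*_ (±1.value-nonneg a) (±c.value-nonneg b)) (sym (ℤ.pos-* (±1.magnitude (+ a)) _)))
      weight -[1+ a ] -[1+ b ] _ = sym (trans (cong₂ ℤ._*_ (±1.value-neg refl a) (±c.value-neg e b)) (neg-*-neg (±1.magnitude -[1+ a ]) (±c.magnitude -[1+ b ])))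

  -- Every admissible pair has e ≡ 2 d or e ≡ 3 d (mod 5). The sign of e relative to 3 is opposite
  -- to its sign relative to 2, so being aligned for 3 is the complement of being aligned for 2.
  divisors : L₁ + L₂ ≈ gf genDivisors
  divisors = ≈-sym (≈-trans (gf-split genDivisors aligned₂) (+-cong
    (≈-sym (E-divisors 1 2 refl 2<5 3<5 (λ ()) refl refl ±2-residue (gen-restrict genDivisors aligned₂)))
    (≈-trans (gf-bijection (λ de → de) (λ de → de) (λ {de} x → trans (sym (opposite de)) x) (λ {de} x → trans (opposite de) x)
                (λ _ → refl) (λ _ → refl) (λ _ → refl) (gen-restrict genDivisors (λ de → not (aligned₂ de))) g₃)
             (≈-sym (E-divisors 2 1 refl 3<5 2<5 (λ ()) refl refl 3-or-2 g₃)))))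
    where
    3-or-2 : ∀ r → is-±2 r ≡ true → r ≡ 3 ⊎ r ≡ 2
    3-or-2 2 _ = inj₂ refl
    3-or-2 3 _ = inj₁ refl
    aligned₂ = aligned 1 2 refl 2<5 3<5 (λ ()) refl refl ±2-residue
    aligned₃ = aligned 2 1 refl 3<5 2<5 (λ ()) refl refl 3-or-2
    g₃ = gen-restrict genDivisors aligned₃
    flip : ∀ e → class is-±2 e ≡ true → nonneg (±3.signed e) ≡ not (nonneg (±2.signed e))
    flip e x with ±2-residue (e % 5) x
    ... | inj₁ r rewrite residue-refl 2 {e} r | residue-other 3 {n = e} r (λ ()) = refl
    ... | inj₂ r rewrite residue-refl 3 {e} r | residue-other 2 {n = e} r (λ ()) = refl
    opposite : ∀ de → divisor-class de ∧ not (aligned₂ de) ≡ divisor-class de ∧ aligned₃ de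
    opposite (d , e) with class is-±1 d | class is-±2 e in x
    ... | false | _     = refl
    ... | true  | false = refl
    ... | true  | true  rewrite flip e x = xor-not (nonneg (±1.signed d)) (nonneg (±2.signed e))
      where
      xor-not : ∀ a b → not (not (a xor b)) ≡ not (a xor not b)
      xor-not a b = trans (Bool.not-involutive _) (trans (sym (Bool.not-involutive _)) (cong not (Bool.not-distribʳ-xor a b)))

-- The action of primes ≡ ±1 (mod 5) on the coefficients.

module HeckeOperator where

  open ResidueClasses
  open PowerSeries
  open WeightedSets
  open ThetaSeries
  open KroneckerIdentity
  open Dissections
  open EulerProducts
  open RationalParametrisation
  open DivisorCoefficients
  open import Defs using (b; shiftDilateCoeff)
  open import Data.Nat as ℕ using (ℕ; zero; suc; s≤s; NonZero)
  import Data.Nat.Properties as ℕ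
  open import Data.Nat.DivMod using (_%_; m*n/n≡m; [m+n]%n≡m%n)
  open import Data.Nat.Divisibility using (_∣_; _∣?_; divides; m∣m*n)
  open import Data.Nat.ListAction using (sum)
  open import Data.Nat.Primality using (Prime; euclidsLemma; prime⇒nonZero)
  open import Data.Integer as ℤ using (ℤ; +_)
  import Data.Integer.Properties as ℤ
  open import Data.Bool as Bool using (_∧_; Bool; true; false; _xor_; if_then_else_)
  import Data.Bool.Properties as Bool
  open import Data.List.Relation.Unary.AllPairs using ([])
  open import Data.List using ([]; applyUpTo)
  open import Data.List.Properties using (map-upTo)
  open import Data.Product using (∃-syntax; ∃; _×_; _,_)
  open import Data.Sum using (_⊎_; [_,_])
  open import Function using (id)
  open import Relation.Nullary using (Dec; yes; no; ¬_; contradiction)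
  open import Relation.Nullary.Decidable using (⌊_⌋)
  open import Relation.Binary.PropositionalEquality
    using (_≡_; _≢_; refl; sym; trans; cong; cong₂; subst; module ≡-Reasoning)

  parity-empty : ∀ {I : Set} {P : I → Set} (c : Count P) → (∀ {i} → ¬ P i) → Count.parity c ≡ false
  parity-empty c empty = parity-unique c
    (record { list = [] ; unique = [] ; sound = λ () ; complete = λ x → contradiction x empty }) (λ x → x) (λ x → x)

  module Hecke (p : ℕ) (p-prime : Prime p) (p≡±1 : p % 5 ≡ 1 ⊎ p % 5 ≡ 4) where

    private
      instance
        p≢0 : NonZero p
        p≢0 = prime⇒nonZero p-prime

    -- The place where p ≡ ±1 (mod 5) enters: multiplication by p maps each of the residue sets {1,
    -- 4} and {2, 3} to itself.
    residue-invariant : (f : ℕ → Bool) → f 1 ≡ f 4 → f 2 ≡ f 3 → ∀ n → class f (p ℕ.* n) ≡ class f n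
    residue-invariant f f14 f23 = [ (λ e → class-* f f p e refl refl refl refl refl) ,
                                    (λ e → class-* f f p e refl (sym f14) (sym f23) f23 f14) ] p≡±1

    private
      ∣p : ℕ → Bool
      ∣p n = ⌊ p ∣? n ⌋

      ∣p⇒ : ∀ {n} → ∣p n ≡ true → ∃ λ m → n ≡ p ℕ.* m
      ∣p⇒ {n} e with p ∣? n
      ... | yes (divides m eq) = m , trans eq (ℕ.*-comm m p)

      ⇒∣p : ∀ m → ∣p (p ℕ.* m) ≡ true
      ⇒∣p m with p ∣? p ℕ.* m
      ... | yes _ = refl
      ... | no ∤  = contradiction (m∣m*n m) ∤

      ∣⇒∣p : ∀ {n} → p ∣ n → ∣p n ≡ true
      ∣⇒∣p {n} p∣n with p ∣? n
      ... | yes _ = refl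
      ... | no ∤  = contradiction p∣n ∤

      ∤⇒ : ∀ {n} → ∣p n ≡ false → ¬ p ∣ n
      ∤⇒ e p∣n with () ← trans (sym e) (∣⇒∣p p∣n)

      _/p : ℕ → ℕ
      n /p = n ℕ./ p

      p*/p : ∀ m → (p ℕ.* m) /p ≡ m
      p*/p m = trans (cong (_/p) (ℕ.*-comm p m)) (m*n/n≡m m p)

      /p-back : ∀ {n} → ∣p n ≡ true → p ℕ.* (n /p) ≡ n
      /p-back e with ∣p⇒ e
      ... | m , refl = cong (p ℕ.*_) (p*/p m)

    product-weight-p : ℕ × ℕ → ℤ
    product-weight-p (d , e) = + (p ℕ.* (d ℕ.* e))

    -- This realises the substitution of q^p for q: the n-th coefficient becomes the one at n / p,
    -- and an empty count if p does not divide n.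
    gen-p : ∀ {I : Set} {w : I → ℕ} {X : I → Bool} → Gen (λ i → + w i) X → Gen (λ i → + (p ℕ.* w i)) X
    gen-p {w = w} c n with ∣p n in e
    ... | true = record
      { list = Count.list (c (n /p)) ; unique = Count.unique (c (n /p))
      ; sound = λ i∈ → let (eq , x) = Count.sound (c (n /p)) i∈ in
          cong +_ (trans (cong (p ℕ.*_) (ℤ.+-injective eq)) (/p-back e)) , x
      ; complete = λ { {i} (eq , x) → Count.complete (c (n /p))
          (cong +_ (trans (sym (p*/p (w i))) (cong (_/p) (ℤ.+-injective eq))) , x) } }
    ... | false = record
      { list = [] ; unique = []
      ; sound = λ ()
      ; complete = λ { {i} (eq , x) → contradiction (subst (p ∣_) (ℤ.+-injective eq) (m∣m*n (w i))) (∤⇒ e) } }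

    gf-p-* : ∀ {I : Set} {w : I → ℕ} {X : I → Bool} (c : Gen (λ i → + w i) X) m → gf (gen-p c) (p ℕ.* m) ≡ gf c m
    gf-p-* {w = w} c m = parity-unique (gen-p c (p ℕ.* m)) (c m)
      (λ { {i} (eq , x) → cong +_ (ℕ.*-cancelˡ-≡ (w i) m p (ℤ.+-injective eq)) , x })
      (λ { {i} (eq , x) → cong (λ t → + (p ℕ.* t)) (ℤ.+-injective eq) , x })

    gf-p-∤ : ∀ {I : Set} {w : I → ℕ} {X : I → Bool} (c : Gen (λ i → + w i) X) n → ¬ p ∣ n → gf (gen-p c) n ≡ false
    gf-p-∤ {w = w} c n ∤ = parity-empty (gen-p c n)
      (λ { {i} (eq , _) → ∤ (subst (p ∣_) (ℤ.+-injective eq) (m∣m*n (w i))) })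

    -- If k² is divisible by the prime p, so is k, and k = p k′ turns k² = p n into n = p k′².
    squares-p : ∀ n → gf genSquares (p ℕ.* n) ≡ gf (gen-p genSquares) n
    squares-p n = parity-bijection (_/p) (p ℕ.*_)
      (λ { {k} (eq , x) → down k (root k (ℤ.+-injective eq)) (ℤ.+-injective eq) x })
      (λ { {k} (eq , x) → cong +_ (trans (sym (square k)) (cong (p ℕ.*_) (ℤ.+-injective eq))) ,
                          trans (residue-invariant is-unit refl refl k) x })
      (λ { {k} (eq , _) → root k (ℤ.+-injective eq) }) (λ { {k} _ → p*/p k }) (genSquares (p ℕ.* n)) (gen-p genSquares n)
      where
      square : ∀ k → p ℕ.* (p ℕ.* (k ℕ.* k)) ≡ (p ℕ.* k) ℕ.* (p ℕ.* k)
      square k = trans (cong (p ℕ.*_) (trans (sym (ℕ.*-assoc p k k)) (ℕ.*-comm (p ℕ.* k) k)))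
                       (sym (ℕ.*-assoc p k (p ℕ.* k)))
      root : ∀ k → k ℕ.* k ≡ p ℕ.* n → p ℕ.* (k /p) ≡ k
      root k e = /p-back (∣⇒∣p ([ id , id ] (euclidsLemma k k p-prime (subst (p ∣_) (sym e) (m∣m*n n)))))
      down : ∀ k → p ℕ.* (k /p) ≡ k → k ℕ.* k ≡ p ℕ.* n → class is-unit k ≡ true →
             Level (λ k → + (p ℕ.* (k ℕ.* k))) (class is-unit) n (k /p)
      down k back eq x = cong +_ (ℕ.*-cancelˡ-≡ _ n p (trans (square (k /p)) (trans (cong (λ t → t ℕ.* t) back) eq))) ,
        trans (sym (residue-invariant is-unit refl refl (k /p))) (trans (cong (class is-unit) back) x)

    -- Inclusion–exclusion over p ∣ d and p ∣ e: each of the two conditions leaves the divisor pairs of n.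
    divisors-p : ∀ n → gf genDivisors (p ℕ.* n) ≡ gf (gen-p genDivisors) n
    divisors-p n = begin
      parity c
        ≡⟨ parity-split c p∣d ⟩
      parity cd xor parity c¬d
        -- The pairs with p | d are traded for the equally many with p | e, and pairs with p ∤ d
        -- satisfy p | e. So the pairs with p | e and p ∤ d occur twice, and those with p dividing
        -- both entries remain.
        ≡⟨ cong₂ _xor_ (trans d-part (sym e-part)) ¬d-part ⟩
      parity ce xor parity ce¬d
        ≡⟨ cong (_xor parity ce¬d) (parity-split ce p∣d) ⟩
      (parity ced xor parity ce¬d) xor parity ce¬d
        ≡⟨ trans (Bool.xor-assoc (parity ced) _ _) (trans (cong (parity ced xor_) (Bool.xor-same (parity ce¬d))) (Bool.xor-identityʳ _)) ⟩
      parity ced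
        ≡⟨ both-part ⟩
      gf (gen-p genDivisors) n ∎
      where
      open ≡-Reasoning
      open Count using (parity)
      c = genDivisors (p ℕ.* n)
      p∣d p∣e : ℕ × ℕ → Bool
      p∣d (d , e) = ∣p d
      p∣e (d , e) = ∣p e
      cd = restrict c p∣d true ; c¬d = restrict c p∣d false
      ce = restrict c p∣e true ; ce¬d = restrict ce p∣d false ; ced = restrict ce p∣d true

      cls : ∀ d e → divisor-class (p ℕ.* d , e) ≡ divisor-class (d , e)
      cls d e = cong (_∧ class is-±2 e) (residue-invariant is-±1 refl refl d)
      cls′ : ∀ d e → divisor-class (d , p ℕ.* e) ≡ divisor-class (d , e)
      cls′ d e = cong (class is-±1 d ∧_) (residue-invariant is-±2 refl refl e)

      rotate : ∀ d e → d ℕ.* (p ℕ.* e) ≡ p ℕ.* (d ℕ.* e)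
      rotate d e = trans (sym (ℕ.*-assoc d p e)) (trans (cong (ℕ._* e) (ℕ.*-comm d p)) (ℕ.*-assoc p d e))

      d-part : parity cd ≡ gf genDivisors n
      d-part = parity-bijection (λ { (d , e) → d /p , e }) (λ { (d , e) → p ℕ.* d , e })
        (λ { {d , e} ((eq , x) , h) → down d e (/p-back h) eq x })
        (λ { {d , e} (eq , x) → (cong +_ (trans (ℕ.*-assoc p d e) (cong (p ℕ.*_) (ℤ.+-injective eq))) , trans (cls d e) x) , ⇒∣p d })
        (λ { {d , e} (_ , h) → cong (_, e) (/p-back h) }) (λ { {d , e} _ → cong (_, e) (p*/p d) }) cd (genDivisors n)
        where
        down : ∀ d e → p ℕ.* (d /p) ≡ d → product-weight (d , e) ≡ + (p ℕ.* n) → divisor-class (d , e) ≡ true →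
               Level product-weight divisor-class n (d /p , e)
        down d e back eq x =
          cong +_ (ℕ.*-cancelˡ-≡ _ n p (trans (sym (ℕ.*-assoc p (d /p) e)) (trans (cong (ℕ._* e) back) (ℤ.+-injective eq)))) ,
          trans (sym (cls (d /p) e)) (trans (cong (λ t → divisor-class (t , e)) back) x)

      e-part : parity ce ≡ gf genDivisors n
      e-part = parity-bijection (λ { (d , e) → d , e /p }) (λ { (d , e) → d , p ℕ.* e })
        (λ { {d , e} ((eq , x) , h) → down d e (/p-back h) eq x })
        (λ { {d , e} (eq , x) → (cong +_ (trans (rotate d e) (cong (p ℕ.*_) (ℤ.+-injective eq))) , trans (cls′ d e) x) , ⇒∣p e })
        (λ { {d , e} (_ , h) → cong (d ,_) (/p-back h) }) (λ { {d , e} _ → cong (d ,_) (p*/p e) }) ce (genDivisors n)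
        where
        down : ∀ d e → p ℕ.* (e /p) ≡ e → product-weight (d , e) ≡ + (p ℕ.* n) → divisor-class (d , e) ≡ true →
               Level product-weight divisor-class n (d , e /p)
        down d e back eq x =
          cong +_ (ℕ.*-cancelˡ-≡ _ n p (trans (sym (rotate d (e /p))) (trans (cong (d ℕ.*_) back) (ℤ.+-injective eq)))) ,
          trans (sym (cls′ d (e /p))) (trans (cong (λ t → divisor-class (d , t)) back) x)

      both-part : parity ced ≡ gf (gen-p genDivisors) n
      both-part = parity-bijection (λ { (d , e) → d /p , e /p }) (λ { (d , e) → p ℕ.* d , p ℕ.* e })
        (λ { {d , e} (((eq , x) , h) , h′) → down d e (/p-back h′) (/p-back h) eq x })
        (λ { {d , e} (eq , x) → ((cong +_ (trans (ℕ.*-assoc p d (p ℕ.* e)) (cong (p ℕ.*_) (trans (rotate d e) (ℤ.+-injective eq)))) ,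
                                   trans (cls d (p ℕ.* e)) (trans (cls′ d e) x)) , ⇒∣p e) , ⇒∣p d })
        (λ { {d , e} ((_ , h) , h′) → cong₂ _,_ (/p-back h′) (/p-back h) })
        (λ { {d , e} _ → cong₂ _,_ (p*/p d) (p*/p e) }) ced (gen-p genDivisors n)
        where
        down : ∀ d e → p ℕ.* (d /p) ≡ d → p ℕ.* (e /p) ≡ e → product-weight (d , e) ≡ + (p ℕ.* n) → divisor-class (d , e) ≡ true →
               Level product-weight-p divisor-class n (d /p , e /p)
        down d e back back′ eq x =
          cong +_ (ℕ.*-cancelˡ-≡ _ n p (trans (cong (p ℕ.*_) (sym (rotate (d /p) (e /p))))
            (trans (sym (ℕ.*-assoc p (d /p) (p ℕ.* (e /p)))) (trans (cong₂ ℕ._*_ back back′) (ℤ.+-injective eq))))) ,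
          trans (sym (trans (cls (d /p) (p ℕ.* (e /p))) (cls′ (d /p) (e /p))))
                (trans (cong₂ (λ s t → divisor-class (s , t)) back back′) x)

      ¬d-part : parity c¬d ≡ parity ce¬d
      ¬d-part = parity-unique c¬d ce¬d
        (λ { {d , e} ((eq , x) , h) → ((eq , x) , [ (λ p∣d → contradiction p∣d (∤⇒ h)) , ∣⇒∣p ]
               (euclidsLemma d e p-prime (subst (p ∣_) (sym (ℤ.+-injective eq)) (m∣m*n n)))) , h })
        (λ { ((l , _) , h) → l , h })

    C : Series
    C = even-part G

    C≈ : C ≈ gf genSquares + gf genDivisors
    C≈ = ≈-trans even-part-G (+-cong squares divisors)

    C-p-* : ∀ m → C (p ℕ.* (p ℕ.* m)) ≡ C m
    C-p-* m = trans (at C≈ (p ℕ.* (p ℕ.* m))) (trans (cong₂ _xor_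
      (trans (squares-p (p ℕ.* m)) (gf-p-* genSquares m)) (trans (divisors-p (p ℕ.* m)) (gf-p-* genDivisors m)))
      (sym (at C≈ m)))

    C-p-∤ : ∀ n → ¬ p ∣ n → C (p ℕ.* n) ≡ false
    C-p-∤ n ∤ = trans (at C≈ (p ℕ.* n)) (cong₂ _xor_
      (trans (squares-p n) (gf-p-∤ genSquares n ∤)) (trans (divisors-p n) (gf-p-∤ genDivisors n ∤)))

    -- `G` carries an extra factor q, so its coefficient at 2 m + 2 is b₂₅(2 m + 1).
    C-suc : ∀ m → C (suc m) ≡ odd (b 25 (2 ℕ.* m ℕ.+ 1))
    C-suc m = trans (q*-suc (regular 25) (suc (double m)))
      (cong (λ k → odd (b 25 k)) (trans (cong suc (trans (double-+ m) (cong (m ℕ.+_) (sym (ℕ.+-identityʳ m))))) (ℕ.+-comm 1 (2 ℕ.* m))))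

    private
      α β : ℕ
      α = 2 ℕ.* p ℕ.∸ 1
      β = p ℕ.∸ 1

      1+β : suc β ≡ p
      1+β = trans (ℕ.+-comm 1 β) (ℕ.m∸n+n≡m (ℕ.>-nonZero⁻¹ p))

    coefficient : ℕ → ℕ → ℕ
    coefficient n m = if ⌊ n ℕ.≟ β ℕ.+ p ℕ.* m ⌋ then b 25 (2 ℕ.* m ℕ.+ 1) else 0

    rhs≡ : ∀ n → shiftDilateCoeff p β (λ m → b 25 (2 ℕ.* m ℕ.+ 1)) n ≡ sum (applyUpTo (coefficient n) (suc n))
    rhs≡ n = cong sum (map-upTo (coefficient n) (suc n))

    sum-single : ∀ (f : ℕ → ℕ) m k → k ℕ.< m → (∀ j → j ≢ k → f j ≡ 0) → sum (applyUpTo f m) ≡ f k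
    sum-single f (suc m) zero    _ z = trans (cong (f 0 ℕ.+_) (sum-vanish (λ j → f (suc j)) m (λ j → z (suc j) λ ()))) (ℕ.+-identityʳ (f 0))
    sum-single f (suc m) (suc k) (s≤s k<m) z = trans (cong₂ ℕ._+_ (z 0 λ ())
      (sum-single (λ j → f (suc j)) m k k<m (λ j j≢k → z (suc j) (λ e → j≢k (ℕ.suc-injective e))))) refl

    -- With j = p n + β one has j + 1 = p (n + 1), so the left side is a coefficient of `C` at a
    -- multiple of p. On the right n = β + p m says n + 1 = p (m + 1), so at most one summand is
    -- nonzero.
    congruence : ∀ n → odd (b 25 (2 ℕ.* p ℕ.* n ℕ.+ α)) ≡ odd (shiftDilateCoeff p β (λ m → b 25 (2 ℕ.* m ℕ.+ 1)) n)
    congruence n = begin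
      odd (b 25 (2 ℕ.* p ℕ.* n ℕ.+ α))     ≡⟨ cong (λ k → odd (b 25 k)) index≡ ⟩
      odd (b 25 (2 ℕ.* j ℕ.+ 1))           ≡⟨ sym (C-suc j) ⟩
      C (suc j)                            ≡⟨ cong C 1+j ⟩
      C (p ℕ.* suc n)                      ≡⟨ by (p ∣? suc n) ⟩
      odd (sum (applyUpTo (coefficient n) (suc n))) ≡⟨ cong odd (sym (rhs≡ n)) ⟩
      _ ∎
      where
      open ≡-Reasoning
      j = p ℕ.* n ℕ.+ β
      1+j : suc j ≡ p ℕ.* suc n
      1+j = trans (sym (ℕ.+-suc (p ℕ.* n) β)) (trans (cong (p ℕ.* n ℕ.+_) 1+β) (trans (ℕ.+-comm (p ℕ.* n) p) (sym (ℕ.*-suc p n))))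
      α≡ : α ≡ 2 ℕ.* β ℕ.+ 1
      α≡ = trans (cong (λ t → 2 ℕ.* t ℕ.∸ 1) (sym 1+β)) (trans (ℕ.+-suc β (β ℕ.+ 0)) (ℕ.+-comm 1 _))
      index≡ : 2 ℕ.* p ℕ.* n ℕ.+ α ≡ 2 ℕ.* j ℕ.+ 1
      index≡ = trans (cong₂ ℕ._+_ (ℕ.*-assoc 2 p n) α≡) (trans (sym (ℕ.+-assoc (2 ℕ.* (p ℕ.* n)) (2 ℕ.* β) 1))
        (cong (ℕ._+ 1) (sym (ℕ.*-distribˡ-+ 2 (p ℕ.* n) β))))
      β+p* : ∀ m → suc (β ℕ.+ p ℕ.* m) ≡ p ℕ.* suc m
      β+p* m = trans (cong (ℕ._+ p ℕ.* m) 1+β) (sym (ℕ.*-suc p m))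
      hit : ∀ {n m} → n ≡ β ℕ.+ p ℕ.* m → coefficient n m ≡ b 25 (2 ℕ.* m ℕ.+ 1)
      hit {n} {m} e with n ℕ.≟ β ℕ.+ p ℕ.* m
      ... | yes _ = refl
      ... | no ne = contradiction e ne
      miss : ∀ m → n ≢ β ℕ.+ p ℕ.* m → coefficient n m ≡ 0
      miss m ne with n ℕ.≟ β ℕ.+ p ℕ.* m
      ... | yes e = contradiction e ne
      ... | no _  = refl
      by : Dec (p ∣ suc n) → C (p ℕ.* suc n) ≡ odd (sum (applyUpTo (coefficient n) (suc n)))
      by (no ∤) = trans (C-p-∤ (suc n) ∤) (cong odd (sym (sum-vanish (coefficient n) (suc n) (λ m → miss m (λ e →
        ∤ (subst (p ∣_) (sym (trans (cong suc e) (β+p* m))) (m∣m*n (suc m))))))))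
      by (yes (divides (suc m) e)) = begin
        C (p ℕ.* suc n)               ≡⟨ cong (λ t → C (p ℕ.* t)) n≡ ⟩
        C (p ℕ.* (p ℕ.* suc m))       ≡⟨ C-p-* (suc m) ⟩
        C (suc m)                     ≡⟨ C-suc m ⟩
        odd (b 25 (2 ℕ.* m ℕ.+ 1))    ≡⟨ cong odd (sym (hit n≡β)) ⟩
        odd (coefficient n m)         ≡⟨ cong odd (sym (sum-single (coefficient n) (suc n) m m<
                                           (λ k k≢m → miss k (λ e′ → k≢m (ℕ.*-cancelˡ-≡ k m p (ℕ.+-cancelˡ-≡ β _ _ (trans (sym e′) n≡β)))))) ) ⟩
        _ ∎
        where
        n≡ : suc n ≡ p ℕ.* suc m
        n≡ = trans e (ℕ.*-comm (suc m) p)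
        n≡β : n ≡ β ℕ.+ p ℕ.* m
        n≡β = ℕ.suc-injective (trans n≡ (sym (β+p* m)))
        m< : m ℕ.< suc n
        m< = subst (suc m ℕ.≤_) (sym n≡) (ℕ.m≤n*m (suc m) p)

    odd-%2 : ∀ m → m % 2 ≡ (if odd m then 1 else 0)
    odd-%2 0 = refl
    odd-%2 1 = refl
    odd-%2 (suc (suc m)) = trans (cong (_% 2) (ℕ.+-comm 2 m)) (trans ([m+n]%n≡m%n m 2)
      (trans (odd-%2 m) (cong (λ t → if t then 1 else 0) (sym (Bool.not-involutive (odd m))))))

    regular-congruence : ∃[ α ] ∃[ β ] ∀ n →
      b 25 (2 ℕ.* p ℕ.* n ℕ.+ α) % 2 ≡ shiftDilateCoeff p β (λ m → b 25 (2 ℕ.* m ℕ.+ 1)) n % 2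
    regular-congruence = α , β , λ n →
      trans (odd-%2 (b 25 (2 ℕ.* p ℕ.* n ℕ.+ α))) (trans (cong (λ t → if t then 1 else 0) (congruence n)) (sym (odd-%2 (shiftDilateCoeff p β (λ m → b 25 (2 ℕ.* m ℕ.+ 1)) n))))

-- Legendre's formula for weighted factorials.

module LegendreFormula where

  open import Data.Nat
  open import Data.Nat.Properties
  open import Data.Nat.DivMod using (_/_; _%_; m≡m%n+[m/n]*n; m%n<n)
  open import Data.Nat.Divisibility
  open import Data.Nat.ListAction using (product)
  open import Data.Nat.Primality using (Prime; prime?; euclidsLemma; prime⇒nonZero; prime⇒nonTrivial; prime⇒irreducible)
  open import Data.Nat.Primality.Factorisation using (factorise)
  open import Data.Nat.Tactic.RingSolver using (solve-∀)
  open import Data.List using ([]; _∷_)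
  open import Data.List.Relation.Unary.All using (All; []; _∷_)
  open import Data.Sum using (inj₁; inj₂)
  open import Relation.Nullary using (Dec; yes; no; ¬_; contradiction)
  open import Relation.Binary.PropositionalEquality
    using (_≡_; _≢_; refl; sym; trans; cong; cong₂; subst; module ≡-Reasoning)

  prodTo sumTo : ℕ → (ℕ → ℕ) → ℕ
  prodTo zero    f = 1
  prodTo (suc x) f = prodTo x f * f (suc x)
  sumTo zero    f = 0
  sumTo (suc x) f = sumTo x f + f (suc x)

  prodTo-cong : ∀ x {f g} → (∀ j → 1 ≤ j → j ≤ x → f j ≡ g j) → prodTo x f ≡ prodTo x g
  prodTo-cong zero    e = refl
  prodTo-cong (suc x) e = cong₂ _*_ (prodTo-cong x (λ j 1≤j j≤x → e j 1≤j (m≤n⇒m≤1+n j≤x))) (e (suc x) (s≤s z≤n) ≤-refl)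

  prodTo-mono : ∀ x {f g} → (∀ j → 1 ≤ j → j ≤ x → f j ≤ g j) → prodTo x f ≤ prodTo x g
  prodTo-mono zero    e = ≤-refl
  prodTo-mono (suc x) e = *-mono-≤ (prodTo-mono x (λ j 1≤j j≤x → e j 1≤j (m≤n⇒m≤1+n j≤x))) (e (suc x) (s≤s z≤n) ≤-refl)

  prodTo-* : ∀ x f g → prodTo x (λ j → f j * g j) ≡ prodTo x f * prodTo x g
  prodTo-* zero    f g = refl
  prodTo-* (suc x) f g = trans (cong (_* (f (suc x) * g (suc x))) (prodTo-* x f g))
    (interchange (prodTo x f) (prodTo x g) (f (suc x)) (g (suc x)))
    where
    interchange : ∀ a b c d → (a * b) * (c * d) ≡ (a * c) * (b * d)
    interchange = solve-∀

  prodTo-1 : ∀ x {f} → (∀ j → 1 ≤ j → j ≤ x → f j ≡ 1) → prodTo x f ≡ 1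
  prodTo-1 zero    e = refl
  prodTo-1 (suc x) e = cong₂ _*_ (prodTo-1 x (λ j 1≤j j≤x → e j 1≤j (m≤n⇒m≤1+n j≤x))) (e (suc x) (s≤s z≤n) ≤-refl)

  prodTo-single : ∀ x {f} r → 1 ≤ r → r ≤ x → (∀ j → j ≢ r → f j ≡ 1) → prodTo x f ≡ f r
  prodTo-single zero r 1≤r r≤0 e = contradiction (≤-trans 1≤r r≤0) λ ()
  prodTo-single (suc x) {f} r 1≤r r≤1+x e with r ≟ suc x
  ... | yes refl = trans (cong (_* f (suc x)) (prodTo-1 x (λ j _ j≤x → e j (<⇒≢ (s≤s j≤x))))) (*-identityˡ _)
  ... | no r≢    = trans (cong₂ _*_ (prodTo-single x r 1≤r (≤-pred (≤∧≢⇒< r≤1+x r≢)) e) (e (suc x) (λ e′ → r≢ (sym e′)))) (*-identityʳ _)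

  prodTo-^ : ∀ x b e → prodTo x (λ j → b ^ e j) ≡ b ^ sumTo x e
  prodTo-^ zero    b e = refl
  prodTo-^ (suc x) b e = trans (cong (_* b ^ e (suc x)) (prodTo-^ x b e)) (sym (^-distribˡ-+-* b (sumTo x e) (e (suc x))))

  prodTo-shift : ∀ x (h : ℕ → ℕ) {g} → (∀ k → g (suc k) ≡ h k) → prodTo x g * h x ≡ h 0 * prodTo x h
  prodTo-shift zero    h e = *-comm 1 (h 0)
  prodTo-shift (suc x) h {g} e = begin
    prodTo x g * g (suc x) * h (suc x) ≡⟨ cong (λ t → prodTo x g * t * h (suc x)) (e x) ⟩
    prodTo x g * h x * h (suc x)       ≡⟨ cong (_* h (suc x)) (prodTo-shift x h e) ⟩
    h 0 * prodTo x h * h (suc x)       ≡⟨ *-assoc (h 0) _ _ ⟩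
    h 0 * (prodTo x h * h (suc x))     ∎
    where open ≡-Reasoning

  ι : ∀ {A : Set} → Dec A → ℕ
  ι (yes _) = 1
  ι (no _)  = 0

  ι-cong : ∀ {A B : Set} (d : Dec A) (e : Dec B) → (A → B) → (B → A) → ι d ≡ ι e
  ι-cong (yes _) (yes _) _ _ = refl
  ι-cong (no _)  (no _)  _ _ = refl
  ι-cong (yes a) (no ¬b) f _ = contradiction (f a) ¬b
  ι-cong (no ¬a) (yes b) _ g = contradiction (g b) ¬a

  ι-yes : ∀ {A : Set} (d : Dec A) → A → ι d ≡ 1
  ι-yes (yes _) _ = refl
  ι-yes (no ¬a) a = contradiction a ¬a

  ι-no : ∀ {A : Set} (d : Dec A) → ¬ A → ι d ≡ 0
  ι-no (no _)  _  = refl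
  ι-no (yes a) ¬a = contradiction a ¬a

  onPrime : ℕ → ℕ → ℕ
  onPrime p n with prime? p
  ... | yes _ = n
  ... | no _  = 1

  onPrime-cong : ∀ p {m n} → (Prime p → m ≡ n) → onPrime p m ≡ onPrime p n
  onPrime-cong p e with prime? p
  ... | yes pr = e pr
  ... | no _   = refl

  onPrime-mono : ∀ p {m n} → (Prime p → m ≤ n) → onPrime p m ≤ onPrime p n
  onPrime-mono p e with prime? p
  ... | yes pr = e pr
  ... | no _   = ≤-refl

  onPrime-* : ∀ p m n → onPrime p (m * n) ≡ onPrime p m * onPrime p n
  onPrime-* p m n with prime? p
  ... | yes _ = refl
  ... | no _  = refl

  onPrime-1 : ∀ p → onPrime p 1 ≡ 1
  onPrime-1 p with prime? p
  ... | yes _ = refl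
  ... | no _  = refl

  onPrime-yes : ∀ p n → Prime p → onPrime p n ≡ n
  onPrime-yes p n pr with prime? p
  ... | yes _ = refl
  ... | no ¬p = contradiction pr ¬p

  -- The number in which each prime p ≤ X has exponent e(p) + e(p²) + ... + e(p^X). Prescribing
  -- exponents per prime power, as in Legendre's Σ ⌊n / p^k⌋, lets two numbers be compared one prime
  -- power at a time; the cut-off is harmless as p^X > X.
  V : ℕ → (ℕ → ℕ) → ℕ
  V X e = prodTo X (λ p → onPrime p (prodTo X (λ k → p ^ e (p ^ k))))

  V-mono : ∀ X {e e′} → (∀ q → 1 ≤ q → e q ≤ e′ q) → V X e ≤ V X e′
  V-mono X le = prodTo-mono X λ { p@(suc _) _ _ → onPrime-mono p λ _ → prodTo-mono X λ k _ _ →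
    ^-monoʳ-≤ p (le (p ^ k) (m^n>0 p k)) }

  V-+ : ∀ X e e′ → V X (λ q → e q + e′ q) ≡ V X e * V X e′
  V-+ X e e′ = trans (prodTo-cong X λ p _ _ → trans
      (cong (onPrime p) (trans (prodTo-cong X λ k _ _ → ^-distribˡ-+-* p (e (p ^ k)) (e′ (p ^ k))) (prodTo-* X _ _)))
      (onPrime-* p _ _))
    (prodTo-* X _ _)

  V-0 : ∀ X {e} → (∀ q → e q ≡ 0) → V X e ≡ 1
  V-0 X {e} z = prodTo-1 X λ p _ _ → trans (cong (onPrime p) (prodTo-1 X λ k _ _ → cong (p ^_) (z (p ^ k)))) (onPrime-1 p)

  V-cong : ∀ X {e e′} → (∀ q → e q ≡ e′ q) → V X e ≡ V X e′
  V-cong X eq = prodTo-cong X λ p _ _ → cong (onPrime p) (prodTo-cong X λ k _ _ → cong (p ^_) (eq (p ^ k)))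

  V-* : ∀ X e a → V X (λ q → a * e q) ≡ V X e ^ a
  V-* X e zero    = V-0 X (λ _ → refl)
  V-* X e (suc a) = trans (V-+ X e (λ q → a * e q)) (cong (V X e *_) (V-* X e a))

  prime≥2 : ∀ {p} → Prime p → 2 ≤ p
  prime≥2 {p} pr = nonTrivial⇒n>1 p {{prime⇒nonTrivial pr}}

  n<2^n : ∀ n → n < 2 ^ n
  n<2^n zero    = s≤s z≤n
  n<2^n (suc n) = begin-strict
    suc n           ≤⟨ n<2^n n ⟩
    2 ^ n           <⟨ m<m+n (2 ^ n) (m^n>0 2 n) ⟩
    2 ^ n + 2 ^ n   ≡⟨ cong (2 ^ n +_) (sym (+-identityʳ _)) ⟩
    2 ^ suc n       ∎
    where open ≤-Reasoning

  prime-power-∣ : ∀ {p r} → Prime p → Prime r → p ≢ r → ∀ k {n} → p ^ k ∣ r * n → p ^ k ∣ n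
  prime-power-∣ pp pr p≢r zero    d = 1∣ _
  prime-power-∣ {p} {r} pp pr p≢r (suc k) {n} d
    with euclidsLemma r n pp (∣-trans (m∣m*n (p ^ k)) d)
  ... | inj₁ p∣r = contradiction p∣r p∤r
    where
    p∤r : ¬ p ∣ r
    p∤r p∣r with prime⇒irreducible pr p∣r
    ... | inj₁ refl = contradiction (prime≥2 pp) λ { (s≤s ()) }
    ... | inj₂ e    = p≢r e
  ... | inj₂ (divides m refl) = subst (p ^ suc k ∣_) (*-comm p m) (*-monoʳ-∣ p (prime-power-∣ pp pr p≢r k
    (*-cancelˡ-∣ p {{prime⇒nonZero pp}} (subst (p ^ suc k ∣_) (rotate r m p) d))))
    where
    rotate : ∀ r m p → r * (m * p) ≡ p * (r * m)
    rotate = solve-∀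

  factor : ℕ → ℕ → ℕ → ℕ
  factor X n p = onPrime p (prodTo X (λ k → p ^ ι (p ^ k ∣? n)))

  single : ℕ → ℕ → ℕ
  single r p = onPrime p (r ^ ι (p ≟ r))

  -- For p = r the condition p^(k + 1) | r n is p^k | n, so the product moves by one index. It gains
  -- the factor for k = 0, the new prime r, and loses the one for k = X, which is 1 because p^X > X
  -- ≥ n.
  factor-* : ∀ X {r n} → Prime r → 1 ≤ n → n ≤ X → ∀ p → factor X (r * n) p ≡ single r p * factor X n p
  factor-* X {r} {n} pr 1≤n n≤X p = trans (onPrime-cong p by) (onPrime-* p _ _)
    where
    by : Prime p → prodTo X (λ k → p ^ ι (p ^ k ∣? r * n)) ≡ r ^ ι (p ≟ r) * prodTo X (λ k → p ^ ι (p ^ k ∣? n))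
    by pp with p ≟ r
    ... | no p≢r = trans (prodTo-cong X λ k _ _ → cong (p ^_) (ι-cong (p ^ k ∣? r * n) (p ^ k ∣? n)
                           (prime-power-∣ pp pr p≢r k) (∣n⇒∣m*n r))) (sym (*-identityˡ _))
    ... | yes refl = begin
      prodTo X g           ≡⟨ sym (*-identityʳ _) ⟩
      prodTo X g * 1       ≡⟨ cong (prodTo X g *_) (sym (cong (p ^_) (ι-no (p ^ X ∣? n) too-big))) ⟩
      prodTo X g * h X     ≡⟨ prodTo-shift X h (λ k → cong (p ^_) (ι-cong (p ^ suc k ∣? p * n) (p ^ k ∣? n)
                                (*-cancelˡ-∣ p {{prime⇒nonZero pp}}) (*-monoʳ-∣ p))) ⟩
      h 0 * prodTo X h     ≡⟨ cong (_* prodTo X h) (cong (p ^_) (ι-yes (1 ∣? n) (1∣ n))) ⟩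
      p ^ 1 * prodTo X h   ∎
      where
      open ≡-Reasoning
      g h : ℕ → ℕ
      g k = p ^ ι (p ^ k ∣? p * n)
      h k = p ^ ι (p ^ k ∣? n)
      too-big : ¬ p ^ X ∣ n
      too-big d = <⇒≱ (≤-<-trans n≤X (<-≤-trans (n<2^n X) (^-monoˡ-≤ X (prime≥2 pp))))
                      (∣⇒≤ {{>-nonZero 1≤n}} d)

  ∏factor : ∀ X {ps} → All Prime ps → product ps ≤ X → prodTo X (factor X (product ps)) ≡ product ps
  ∏factor X [] _ = prodTo-1 X λ p _ _ → trans (onPrime-cong p λ pp → prodTo-1 X λ { k@(suc j) _ _ →
      cong (p ^_) (ι-no (p ^ k ∣? 1) λ d → contradiction (∣⇒≤ (∣-trans (m∣m*n (p ^ j)) d)) (<⇒≱ (prime≥2 pp))) }) (onPrime-1 p)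
  ∏factor X {r ∷ ps} (pr ∷ pps) rn≤X = begin
    prodTo X (factor X (r * n))               ≡⟨ prodTo-cong X (λ p _ _ → factor-* X pr 1≤n n≤X p) ⟩
    prodTo X (λ p → single r p * factor X n p) ≡⟨ prodTo-* X (single r) (factor X n) ⟩
    prodTo X (single r) * prodTo X (factor X n) ≡⟨ cong₂ _*_ ∏single (∏factor X pps n≤X) ⟩
    r * n                                     ∎
    where
    open ≡-Reasoning
    n = product ps
    1≤n : 1 ≤ n
    1≤n = Data.Nat.Primality.productOfPrimes≥1 pps
    instance
      r≢0 : NonZero r
      r≢0 = prime⇒nonZero pr
    n≤X : n ≤ X
    n≤X = ≤-trans (m≤n*m n r) rn≤X
    r≤X : r ≤ X
    r≤X = ≤-trans (m≤m*n r n {{>-nonZero 1≤n}}) rn≤X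
    ∏single : prodTo X (single r) ≡ r
    ∏single = trans (prodTo-single X r (<⇒≤ (prime≥2 pr)) r≤X (λ p p≢r → trans (cong (onPrime p) (cong (r ^_) (ι-no (p ≟ r) p≢r))) (onPrime-1 p)))
      (trans (onPrime-yes r _ pr) (trans (cong (r ^_) (ι-yes (r ≟ r) refl)) (*-identityʳ r)))

  V-number : ∀ X n → 1 ≤ n → n ≤ X → V X (λ q → ι (q ∣? n)) ≡ n
  V-number X n@(suc _) _ n≤X with factorise n
  ... | record { factors = ps ; isFactorisation = e ; factorsPrime = pps } =
    trans (cong (λ m → prodTo X (factor X m)) e) (trans (∏factor X pps (subst (_≤ X) e n≤X)) (sym e))

  -- The factorial if every weight is 1; the quotient for the indicators of ±1 and ±2 modulo 5 is
  -- the product of k^χ(k).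
  P : (ℕ → ℕ) → ℕ → ℕ
  P a x = prodTo x (λ j → j ^ a j)

  V-P : ∀ X a x → x ≤ X → P a x ≡ V X (λ q → sumTo x (λ j → a j * ι (q ∣? j)))
  V-P X a zero    _ = sym (V-0 X (λ _ → refl))
  V-P X a (suc x) x<X = begin
    P a x * suc x ^ a (suc x)
      ≡⟨ cong₂ _*_ (V-P X a x (<⇒≤ x<X)) (cong (_^ a (suc x)) (sym (V-number X (suc x) (s≤s z≤n) x<X))) ⟩
    V X (λ q → sumTo x (λ j → a j * ι (q ∣? j))) * V X (λ q → ι (q ∣? suc x)) ^ a (suc x)
      ≡⟨ cong (V X (λ q → sumTo x (λ j → a j * ι (q ∣? j))) *_) (sym (V-* X (λ q → ι (q ∣? suc x)) (a (suc x)))) ⟩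
    V X (λ q → sumTo x (λ j → a j * ι (q ∣? j))) * V X (λ q → a (suc x) * ι (q ∣? suc x))
      ≡⟨ sym (V-+ X (λ q → sumTo x (λ j → a j * ι (q ∣? j))) (λ q → a (suc x) * ι (q ∣? suc x))) ⟩
    V X (λ q → sumTo (suc x) (λ j → a j * ι (q ∣? j))) ∎
    where open ≡-Reasoning

  multiples-sum : ∀ (a : ℕ → ℕ) q → 1 ≤ q → ∀ x y r → x ≡ r + y * q → r < q →
                  sumTo x (λ j → a j * ι (q ∣? j)) ≡ sumTo y (λ k → a (q * k))
  multiples-sum a q@(suc _) _ zero zero    r e r<q = refl
  multiples-sum a q@(suc m) _ zero (suc y) r e r<q = contradiction (trans e (+-suc r (m + y * q))) λ ()
  multiples-sum a q@(suc m) 1≤q (suc x) y (suc r) e r<q = trans (cong₂ _+_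
    (multiples-sum a q 1≤q x y r (suc-injective e) (<-trans (n<1+n r) r<q))
    (trans (cong (a (suc x) *_) (ι-no (q ∣? suc x) q∤)) (*-zeroʳ (a (suc x))))) (+-identityʳ _)
    where
    q∤ : ¬ q ∣ suc x
    q∤ d = contradiction (∣⇒≤ (∣m+n∣m⇒∣n (subst (q ∣_) (trans e (+-comm (suc r) (y * q))) d) (n∣m*n y))) (<⇒≱ r<q)
  multiples-sum a q@(suc m) 1≤q (suc x) (suc y) zero e r<q = cong₂ _+_
    (multiples-sum a q 1≤q x y m (suc-injective e) ≤-refl)
    (trans (cong (a (suc x) *_) (ι-yes (q ∣? suc x) (divides (suc y) e))) (trans (*-identityʳ _) (cong a (trans e (*-comm (suc y) q)))))

  -- The contribution of one prime power q to Legendre's formula: the weights of the multiples of q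
  -- up to x. The clause at 0 only avoids a division by zero.
  exponent : (ℕ → ℕ) → ℕ → ℕ → ℕ
  exponent a x zero      = 0
  exponent a x q@(suc _) = sumTo (x / q) (λ k → a (q * k))

  P≡V : ∀ X a x → x ≤ X → P a x ≡ V X (exponent a x)
  P≡V X a x x≤X = trans (V-P X a x x≤X) (prodTo-cong X λ p 1≤p _ → cong (onPrime p) (prodTo-cong X λ k _ _ → cong (p ^_) (at p k 1≤p)))
    where
    at : ∀ p k → 1 ≤ p → sumTo x (λ j → a j * ι (p ^ k ∣? j)) ≡ exponent a x (p ^ k)
    at p@(suc _) k _ = go (p ^ k) (m^n>0 p k)
      where
      go : ∀ q → 1 ≤ q → sumTo x (λ j → a j * ι (q ∣? j)) ≡ exponent a x q
      go q@(suc _) 1≤q = multiples-sum a q 1≤q x (x / q) (x % q) (m≡m%n+[m/n]*n x q) (m%n<n x q)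

-- Comparison of exponents in the Chebyshev quotient.

module ExponentInequality where

  open ResidueClasses
  open LegendreFormula
  open import Data.Nat
  open import Data.Nat.Properties
  open import Data.Nat.DivMod
  open import Data.Nat.Divisibility
  open import Data.Nat.Tactic.RingSolver using (solve-∀)
  open import Data.Bool using (Bool; true; false; if_then_else_; _∧_; not)
  open import Data.Bool.Properties using (∧-zeroʳ)
  open import Relation.Nullary using (Dec; yes; no)
  open import Relation.Nullary.Decidable using (⌊_⌋; True; toWitness)
  open import Relation.Binary.PropositionalEquality using (_≡_; refl; sym; trans; cong; cong₂; subst)

  indicator : Bool → ℕ
  indicator c = if c then 1 else 0

  one b₁ b₂ : ℕ → ℕ
  one _ = 1
  b₁ k = indicator (class is-±1 k)
  b₂ k = indicator (class is-±2 k)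

  sumTo-cong : ∀ x {f g} → (∀ j → f j ≡ g j) → sumTo x f ≡ sumTo x g
  sumTo-cong zero    e = refl
  sumTo-cong (suc x) e = cong₂ _+_ (sumTo-cong x e) (e (suc x))

  sumTo-mono : ∀ x {f g} → (∀ j → f j ≤ g j) → sumTo x f ≤ sumTo x g
  sumTo-mono zero    e = z≤n
  sumTo-mono (suc x) e = +-mono-≤ (sumTo-mono x e) (e (suc x))

  sumTo-0 : ∀ x {f} → (∀ j → f j ≡ 0) → sumTo x f ≡ 0
  sumTo-0 zero    e = refl
  sumTo-0 (suc x) e = cong₂ _+_ (sumTo-0 x e) (e (suc x))

  sumTo-one : ∀ x → sumTo x one ≡ x
  sumTo-one zero    = refl
  sumTo-one (suc x) = trans (cong (_+ 1) (sumTo-one x)) (+-comm x 1)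

  sumTo-+ : ∀ x f g → sumTo x (λ j → f j + g j) ≡ sumTo x f + sumTo x g
  sumTo-+ zero    f g = refl
  sumTo-+ (suc x) f g = trans (cong (_+ (f (suc x) + g (suc x))) (sumTo-+ x f g)) (lemma (sumTo x f) (sumTo x g) (f (suc x)) (g (suc x)))
    where
    lemma : ∀ a b c d → a + b + (c + d) ≡ a + c + (b + d)
    lemma = solve-∀

  -- The partial sums of `b₁` and `b₂`, by recursion with period 5 so that concrete values compute.
  u v : ℕ → ℕ
  u 0 = 0
  u 1 = 1
  u 2 = 1
  u 3 = 1
  u 4 = 2
  u (suc (suc (suc (suc (suc y))))) = 2 + u y
  v 0 = 0
  v 1 = 0
  v 2 = 1
  v 3 = 2
  v 4 = 2
  v (suc (suc (suc (suc (suc y))))) = 2 + v y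

  u-suc : ∀ y → u y + b₁ (suc y) ≡ u (suc y)
  u-suc 0 = refl
  u-suc 1 = refl
  u-suc 2 = refl
  u-suc 3 = refl
  u-suc 4 = refl
  u-suc (suc (suc (suc (suc (suc y))))) = cong (2 +_) (u-suc y)

  v-suc : ∀ y → v y + b₂ (suc y) ≡ v (suc y)
  v-suc 0 = refl
  v-suc 1 = refl
  v-suc 2 = refl
  v-suc 3 = refl
  v-suc 4 = refl
  v-suc (suc (suc (suc (suc (suc y))))) = cong (2 +_) (v-suc y)

  sumTo-b₁ : ∀ y → sumTo y b₁ ≡ u y
  sumTo-b₁ zero    = refl
  sumTo-b₁ (suc y) = trans (cong (_+ b₁ (suc y)) (sumTo-b₁ y)) (u-suc y)

  sumTo-b₂ : ∀ y → sumTo y b₂ ≡ v y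
  sumTo-b₂ zero    = refl
  sumTo-b₂ (suc y) = trans (cong (_+ b₂ (suc y)) (sumTo-b₂ y)) (v-suc y)

  Quasiperiodic : ℕ → (ℕ → ℕ) → Set
  Quasiperiodic s f = ∀ r a → f (r + a * 5) ≡ f r + a * s

  quasiperiodic : ∀ s f → (∀ y → f (5 + y) ≡ s + f y) → Quasiperiodic s f
  quasiperiodic s f e r zero    = trans (cong f (+-identityʳ r)) (sym (+-identityʳ (f r)))
  quasiperiodic s f e r (suc a) = trans (cong f (lemma r (a * 5))) (trans (e (r + a * 5))
    (trans (cong (s +_) (quasiperiodic s f e r a)) (lemma′ s (f r) (a * s))))
    where
    lemma : ∀ r t → r + (5 + t) ≡ 5 + (r + t)
    lemma = solve-∀
    lemma′ : ∀ s r t → s + (r + t) ≡ r + (s + t)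
    lemma′ = solve-∀

  [r+ab]/d : ∀ r a b d e .{{_ : NonZero d}} → b ≡ e * d → (r + a * b) / d ≡ r / d + a * e
  [r+ab]/d r a b d e refl = trans (+-distrib-/-∣ʳ r (divides (a * e) (sym (*-assoc a e d))))
    (cong (r / d +_) (trans (cong (_/ d) (sym (*-assoc a e d))) (m*n/n≡m (a * e) d)))

  -- The left side is the exponent of p in the numerator, where y = ⌊10 n / p^k⌋, the right side the one in the denominator;
  -- both grow by the same amount when y grows by 10.
  exponent-inequality : ∀ s f g c → Quasiperiodic s f → Quasiperiodic s g →
    (∀ r → r < 10 → r + f r + 2 * f (r / 2) ≤ 2 * (r / 2) + 3 * (r / 5) + g r + 2 * g (r / 2) + c) →
    ∀ y → y + 6 * (y / 10) + f y + 2 * f (y / 2) ≤ 2 * (y / 2) + 3 * (y / 5) + g y + 2 * g (y / 2) + c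
  exponent-inequality s f g c pf pg small y = subst (λ y → y + 6 * (y / 10) + f y + 2 * f (y / 2) ≤ 2 * (y / 2) + 3 * (y / 5) + g y + 2 * g (y / 2) + c)
    (sym (m≡m%n+[m/n]*n y 10)) (by (y % 10) (y / 10) (m%n<n y 10))
    where
    by : ∀ r a → r < 10 → let y = r + a * 10 in
         y + 6 * (y / 10) + f y + 2 * f (y / 2) ≤ 2 * (y / 2) + 3 * (y / 5) + g y + 2 * g (y / 2) + c
    by r a r<10 = begin
      y′ + 6 * (y′ / 10) + f y′ + 2 * f (y′ / 2)
        ≡⟨ cong₂ _+_ (cong₂ (λ i j → y′ + 6 * i + j) y/10 (at f pf)) (cong (2 *_) (at/2 f pf)) ⟩
      (r + a * 10) + 6 * a + (f r + a * 2 * s) + 2 * (f (r / 2) + a * s)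
        ≡⟨ lemma r a s (f r) (f (r / 2)) ⟩
      (r + f r + 2 * f (r / 2)) + (16 * a + 4 * (a * s))
        ≤⟨ +-monoˡ-≤ (16 * a + 4 * (a * s)) (small r r<10) ⟩
      (2 * (r / 2) + 3 * (r / 5) + g r + 2 * g (r / 2) + c) + (16 * a + 4 * (a * s))
        ≡⟨ lemma′ (r / 2) (r / 5) (g r) (g (r / 2)) c a s ⟩
      2 * (r / 2 + a * 5) + 3 * (r / 5 + a * 2) + (g r + a * 2 * s) + 2 * (g (r / 2) + a * s) + c
        ≡⟨ sym (cong (_+ c) (cong₂ _+_ (cong₂ _+_ (cong₂ (λ i j → 2 * i + 3 * j) y/2 ([r+ab]/d r a 10 5 2 refl)) (at g pg)) (cong (2 *_) (at/2 g pg)))) ⟩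
      2 * (y′ / 2) + 3 * (y′ / 5) + g y′ + 2 * g (y′ / 2) + c ∎
      where
      open ≤-Reasoning
      y′ = r + a * 10
      y/2 : y′ / 2 ≡ r / 2 + a * 5
      y/2 = [r+ab]/d r a 10 2 5 refl
      y/10 : y′ / 10 ≡ a
      y/10 = trans ([r+ab]/d r a 10 10 1 refl) (cong₂ _+_ (m<n⇒m/n≡0 r<10) (*-identityʳ a))
      at : ∀ h → Quasiperiodic s h → h y′ ≡ h r + a * 2 * s
      at h ph = trans (cong (λ t → h (r + t)) (sym (*-assoc a 2 5))) (ph r (a * 2))
      at/2 : ∀ h → Quasiperiodic s h → h (y′ / 2) ≡ h (r / 2) + a * s
      at/2 h ph = trans (cong h y/2) (ph (r / 2) a)
      lemma : ∀ r a s x y → (r + a * 10) + 6 * a + (x + a * 2 * s) + 2 * (y + a * s) ≡ (r + x + 2 * y) + (16 * a + 4 * (a * s))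
      lemma = solve-∀
      lemma′ : ∀ i j x y c a s → (2 * i + 3 * j + x + 2 * y + c) + (16 * a + 4 * (a * s))
               ≡ 2 * (i + a * 5) + 3 * (j + a * 2) + (x + a * 2 * s) + 2 * (y + a * s) + c
      lemma′ = solve-∀

  below-10 : {Q : ℕ → Set} → Q 0 → Q 1 → Q 2 → Q 3 → Q 4 → Q 5 → Q 6 → Q 7 → Q 8 → Q 9 → ∀ r → r < 10 → Q r
  below-10 a b c d e f g h i j 0 _ = a
  below-10 a b c d e f g h i j 1 _ = b
  below-10 a b c d e f g h i j 2 _ = c
  below-10 a b c d e f g h i j 3 _ = d
  below-10 a b c d e f g h i j 4 _ = e
  below-10 a b c d e f g h i j 5 _ = f
  below-10 a b c d e f g h i j 6 _ = g
  below-10 a b c d e f g h i j 7 _ = h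
  below-10 a b c d e f g h i j 8 _ = i
  below-10 a b c d e f g h i j 9 _ = j
  below-10 a b c d e f g h i j (suc (suc (suc (suc (suc (suc (suc (suc (suc (suc r))))))))))
    (s≤s (s≤s (s≤s (s≤s (s≤s (s≤s (s≤s (s≤s (s≤s (s≤s ()))))))))))

  check : ∀ {m n} {_ : True (m ≤? n)} → m ≤ n
  check {_} {_} {t} = toWitness t

  inequality-±1 : ∀ y → y + 6 * (y / 10) + u y + 2 * u (y / 2) ≤ 2 * (y / 2) + 3 * (y / 5) + v y + 2 * v (y / 2) + 2
  inequality-±1 = exponent-inequality 2 u v 2 (quasiperiodic 2 u (λ _ → refl)) (quasiperiodic 2 v (λ _ → refl))
    (below-10 check check check check check check check check check check)

  -- The multiplicities in the quotient are tuned to this case, which tolerates no surplus. Equality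
  -- at y = 3 forces the character product up to 5 n to be squared, and equality at y = 7 then
  -- forces the cube of (2 n)!; the power 6 of n! balances the growth over a period of 10.
  inequality-±2 : ∀ y → y + 6 * (y / 10) + v y + 2 * v (y / 2) ≤ 2 * (y / 2) + 3 * (y / 5) + u y + 2 * u (y / 2) + 0
  inequality-±2 = exponent-inequality 2 v u 0 (quasiperiodic 2 v (λ _ → refl)) (quasiperiodic 2 u (λ _ → refl))
    (below-10 check check check check check check check check check check)

  inequality-0 : ∀ y → y + 6 * (y / 10) + 0 + 2 * 0 ≤ 2 * (y / 2) + 3 * (y / 5) + 0 + 2 * 0 + 2
  inequality-0 = exponent-inequality 0 (λ _ → 0) (λ _ → 0) 2 (λ _ a → sym (*-zeroʳ a)) (λ _ a → sym (*-zeroʳ a))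
    (below-10 check check check check check check check check check check)

  -- The values 1, -1, 0 of χ(q): multiplication by q preserves the classes ±1 and ±2, exchanges
  -- them, or leads out of both.
  data Class (q : ℕ) : Set where
    class-±1 : class is-±1 q ≡ true → class is-±2 q ≡ false →
               (∀ k → b₁ (q * k) ≡ b₁ k) → (∀ k → b₂ (q * k) ≡ b₂ k) → Class q
    class-±2 : class is-±2 q ≡ true → (∀ k → b₁ (q * k) ≡ b₂ k) → (∀ k → b₂ (q * k) ≡ b₁ k) → Class q
    class-0  : q % 5 ≡ 0 → class is-±2 q ≡ false → (∀ k → b₁ (q * k) ≡ 0) → (∀ k → b₂ (q * k) ≡ 0) → Class q

  classify : ∀ q → Class q
  classify q with q % 5 in e | m%n<n q 5
  ... | 0 | _ = class-0 e (cong is-±2 e)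
    (λ k → cong indicator (class-* is-±1 (λ _ → false) q e refl refl refl refl refl k))
    (λ k → cong indicator (class-* is-±2 (λ _ → false) q e refl refl refl refl refl k))
  ... | 1 | _ = class-±1 (cong is-±1 e) (cong is-±2 e)
    (λ k → cong indicator (class-* is-±1 is-±1 q e refl refl refl refl refl k))
    (λ k → cong indicator (class-* is-±2 is-±2 q e refl refl refl refl refl k))
  ... | 2 | _ = class-±2 (cong is-±2 e)
    (λ k → cong indicator (class-* is-±1 is-±2 q e refl refl refl refl refl k))
    (λ k → cong indicator (class-* is-±2 is-±1 q e refl refl refl refl refl k))
  ... | 3 | _ = class-±2 (cong is-±2 e)
    (λ k → cong indicator (class-* is-±1 is-±2 q e refl refl refl refl refl k))
    (λ k → cong indicator (class-* is-±2 is-±1 q e refl refl refl refl refl k))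
  ... | 4 | _ = class-±1 (cong is-±1 e) (cong is-±2 e)
    (λ k → cong indicator (class-* is-±1 is-±1 q e refl refl refl refl refl k))
    (λ k → cong indicator (class-* is-±2 is-±2 q e refl refl refl refl refl k))
  ... | suc (suc (suc (suc (suc _)))) | s≤s (s≤s (s≤s (s≤s (s≤s ()))))

  module _ (n : ℕ) where

    private
      X = 10 * n

    numerator denominator : ℕ → ℕ
    numerator q   = exponent one X q + 6 * exponent one n q + exponent b₁ X q + 2 * exponent b₁ (5 * n) q
    denominator q = 2 * exponent one (5 * n) q + 3 * exponent one (2 * n) q + exponent b₂ X q + 2 * exponent b₂ (5 * n) q

    -- A bound for the surplus of the numerator at q. Beyond X all floors in the numerator are 0,
    -- and in the classes ±2 the character terms absorb the surplus.
    excess : ℕ → ℕ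
    excess q = if ⌊ q ≤? X ⌋ ∧ not (class is-±2 q) then 2 else 0

    private
      -- All floors become functions of the single variable y = ⌊X / q⌋, which reduces the
      -- comparison of exponents to one inequality in y.
      divide : ∀ a d e q .{{_ : NonZero d}} .{{_ : NonZero q}} → a ≡ e * d → e / q ≡ (a / q) / d
      divide a d e q refl = trans (cong (_/ q) (sym (m*n/n≡m e d))) (trans (m/n/o≡m/[n*o] (e * d) d q {{_}} {{_}} {{m*n≢0 d q}})
        (trans (/-congʳ {{m*n≢0 d q}} {{m*n≢0 q d}} (*-comm d q)) (sym (m/n/o≡m/[n*o] (e * d) q d {{_}} {{_}} {{m*n≢0 q d}}))))
      10n≡5n*2 : ∀ n → 10 * n ≡ 5 * n * 2
      10n≡5n*2 = solve-∀
      10n≡2n*5 : ∀ n → 10 * n ≡ 2 * n * 5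
      10n≡2n*5 = solve-∀

    exponent-bound : ∀ q → 1 ≤ q → numerator q ≤ denominator q + excess q
    exponent-bound q@(suc _) _
      rewrite divide X 2 (5 * n) q (10n≡5n*2 n) | divide X 5 (2 * n) q (10n≡2n*5 n) | divide X 10 n q (*-comm 10 n)
            | sumTo-one (X / q) | sumTo-one (X / q / 2) | sumTo-one (X / q / 5) | sumTo-one (X / q / 10) = by (classify q) (q ≤? X)
      where
      y = X / q
      Goal : ℕ → Set
      Goal c = y + 6 * (y / 10) + sumTo y (λ k → b₁ (q * k)) + 2 * sumTo (y / 2) (λ k → b₁ (q * k))
             ≤ 2 * (y / 2) + 3 * (y / 5) + sumTo y (λ k → b₂ (q * k)) + 2 * sumTo (y / 2) (λ k → b₂ (q * k)) + c
      values : ∀ {f g : ℕ → ℕ} {c : ℕ} → (∀ y → sumTo y (λ k → b₁ (q * k)) ≡ f y) → (∀ y → sumTo y (λ k → b₂ (q * k)) ≡ g y) →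
        (∀ y → y + 6 * (y / 10) + f y + 2 * f (y / 2) ≤ 2 * (y / 2) + 3 * (y / 5) + g y + 2 * g (y / 2) + c) → Goal c
      values e₁ e₂ le rewrite e₁ y | e₁ (y / 2) | e₂ y | e₂ (y / 2) = le y
      vanish : ∀ c y → y ≡ 0 → y + 6 * (y / 10) + sumTo y (λ k → b₁ (q * k)) + 2 * sumTo (y / 2) (λ k → b₁ (q * k)) ≤ c
      vanish c y refl = z≤n
      by : Class q → Dec (q ≤ X) → Goal (if ⌊ q ≤? X ⌋ ∧ not (class is-±2 q) then 2 else 0)
      by (class-±2 c e₁ e₂) _ rewrite c | ∧-zeroʳ ⌊ q ≤? X ⌋ =
        values (λ y → trans (sumTo-cong y e₁) (sumTo-b₂ y)) (λ y → trans (sumTo-cong y e₂) (sumTo-b₁ y)) inequality-±2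
      by (class-±1 _ c e₁ e₂) _ with q ≤? X
      ... | no q≰X = vanish _ y (m<n⇒m/n≡0 (≰⇒> q≰X))
      ... | yes _ rewrite c =
        values (λ y → trans (sumTo-cong y e₁) (sumTo-b₁ y)) (λ y → trans (sumTo-cong y e₂) (sumTo-b₂ y)) inequality-±1
      by (class-0 _ c e₁ e₂) _ with q ≤? X
      ... | no q≰X = vanish _ y (m<n⇒m/n≡0 (≰⇒> q≰X))
      ... | yes _ rewrite c = values (λ y → sumTo-0 y e₁) (λ y → sumTo-0 y e₂) inequality-0

    N D : ℕ
    N = P one X * P one n ^ 6 * P b₁ X * P b₁ (5 * n) ^ 2
    D = P one (5 * n) ^ 2 * P one (2 * n) ^ 3 * P b₂ X * P b₂ (5 * n) ^ 2

    private
      kn≤X : ∀ {k} → k ≤ 10 → k * n ≤ X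
      kn≤X = *-monoˡ-≤ n
      n≤X : n ≤ X
      n≤X = m≤n*m n 10
      V⁴ : ∀ a e b f g c h → V X (λ q → a * e q + b * f q + g q + c * h q) ≡ V X e ^ a * V X f ^ b * V X g * V X h ^ c
      V⁴ a e b f g c h = trans (V-+ X (λ q → a * e q + b * f q + g q) (λ q → c * h q)) (cong₂ _*_
        (trans (V-+ X (λ q → a * e q + b * f q) g) (cong (_* V X g)
          (trans (V-+ X (λ q → a * e q) (λ q → b * f q)) (cong₂ _*_ (V-* X e a) (V-* X f b))))) (V-* X h c))

    N≤D*V : N ≤ D * V X excess
    N≤D*V = begin
      N ≡⟨ cong₂ _*_ (cong₂ _*_ (cong₂ _*_ (trans (P≡V X one X ≤-refl) (sym (*-identityʳ _))) (cong (_^ 6) (P≡V X one n n≤X))) (P≡V X b₁ X ≤-refl))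
                     (cong (_^ 2) (P≡V X b₁ (5 * n) (kn≤X {5} check))) ⟩
      V X (exponent one X) ^ 1 * V X (exponent one n) ^ 6 * V X (exponent b₁ X) * V X (exponent b₁ (5 * n)) ^ 2
        ≡⟨ sym (V⁴ 1 (exponent one X) 6 (exponent one n) (exponent b₁ X) 2 (exponent b₁ (5 * n))) ⟩
      V X (λ q → 1 * exponent one X q + 6 * exponent one n q + exponent b₁ X q + 2 * exponent b₁ (5 * n) q)
        ≡⟨ V-cong X (λ q → cong (λ t → t + 6 * exponent one n q + exponent b₁ X q + 2 * exponent b₁ (5 * n) q) (*-identityˡ (exponent one X q))) ⟩
      V X numerator
        ≤⟨ V-mono X exponent-bound ⟩
      V X (λ q → denominator q + excess q)
        ≡⟨ V-+ X denominator excess ⟩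
      V X denominator * V X excess
        ≡⟨ cong (_* V X excess) (V⁴ 2 (exponent one (5 * n)) 3 (exponent one (2 * n)) (exponent b₂ X) 2 (exponent b₂ (5 * n))) ⟩
      V X (exponent one (5 * n)) ^ 2 * V X (exponent one (2 * n)) ^ 3 * V X (exponent b₂ X) * V X (exponent b₂ (5 * n)) ^ 2 * V X excess
        ≡⟨ cong (_* V X excess) (sym (cong₂ _*_ (cong₂ _*_ (cong₂ _*_ (cong (_^ 2) (P≡V X one (5 * n) (kn≤X {5} check)))
             (cong (_^ 3) (P≡V X one (2 * n) (kn≤X {2} check)))) (P≡V X b₂ X ≤-refl)) (cong (_^ 2) (P≡V X b₂ (5 * n) (kn≤X {5} check))))) ⟩
      D * V X excess ∎
      where open ≤-Reasoning

-- Chebyshev estimates and the count of primes ≡ ±1 (mod 5).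

module PrimeCounts where

  open import Defs using (primeCount; primeCountIn)
  open ResidueClasses using (is-±1; is-±2; class)
  open LegendreFormula
  open ExponentInequality
  open import Data.Nat
  open import Data.Nat.Properties
  open import Data.Nat.DivMod
  open import Data.Nat.Divisibility
  open import Data.Nat.Induction using (<-rec)
  open import Data.Nat.ListAction using (sum)
  open import Data.Nat.Primality using (Prime; prime?; prime⇒irreducible; prime⇒nonZero; ¬prime[0])
  open import Data.Nat.Tactic.RingSolver using (solve-∀)
  open import Data.Bool using (Bool; true; false; if_then_else_; _∧_)
  open import Data.Bool.Properties using (∧-zeroʳ)
  open import Data.List using (applyUpTo)
  open import Data.List.Properties using (map-upTo)
  open import Data.Product using (∃; _×_; _,_; proj₁; proj₂)
  open import Data.Sum using (inj₂)
  open import Relation.Nullary using (yes; no; contradiction)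
  open import Relation.Nullary.Decidable using (⌊_⌋; toWitness)
  open import Relation.Binary.PropositionalEquality using (_≡_; refl; sym; trans; cong; cong₂; subst)

  open ≤-Reasoning

  prodTo-≥1 : ∀ x {f} → (∀ j → 1 ≤ j → 1 ≤ f j) → 1 ≤ prodTo x f
  prodTo-≥1 zero    e = ≤-refl
  prodTo-≥1 (suc x) e = *-mono-≤ (prodTo-≥1 x e) (e (suc x) (s≤s z≤n))

  P>0 : ∀ a x → 1 ≤ P a x
  P>0 a x = prodTo-≥1 x λ { j@(suc _) _ → m^n>0 j (a j) }

  module _ (X : ℕ) (1≤X : 1 ≤ X) where

    -- The product is the largest power of p with exponent at most K that does not exceed X. The
    -- second component carries the induction: while p^K ≤ X, every factor so far equals p.
    power-bound : ∀ p → 1 ≤ p → ∀ K → let v = prodTo K (λ k → p ^ ι (p ^ k ≤? X)) in v ≤ X × (p ^ K ≤ X → v ≡ p ^ K)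
    power-bound p 1≤p zero    = 1≤X , λ _ → refl
    power-bound p@(suc _) 1≤p (suc K) with power-bound p 1≤p K | p ^ suc K ≤? X
    ... | v≤X , _  | no big  = subst (_≤ X) (sym (*-identityʳ _)) v≤X , λ small → contradiction small big
    ... | _   , eq | yes small = subst (_≤ X) (sym v≡) small , λ _ → v≡
      where
      v≡ : prodTo K (λ k → p ^ ι (p ^ k ≤? X)) * (p * 1) ≡ p * p ^ K
      v≡ = trans (cong₂ _*_ (eq (≤-trans (m≤n*m (p ^ K) p) small)) (*-identityʳ p)) (*-comm (p ^ K) p)

  module _ (n s : ℕ) (1≤n : 1 ≤ n) (5≤s : 5 ≤ s) (X<s² : 10 * n < suc s * suc s) where

    private
      X = 10 * n
      1≤X : 1 ≤ X
      1≤X = ≤-trans 1≤n (m≤n*m n 10)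
      instance
        X≢0 : NonZero X
        X≢0 = >-nonZero 1≤X

    excess≤2 : ∀ q → excess n q ≤ ι (q ≤? X) + ι (q ≤? X)
    excess≤2 q with q ≤? X | class is-±2 q
    ... | no _  | _     = z≤n
    ... | yes _ | true  = z≤n
    ... | yes _ | false = ≤-refl

    excess-±2 : ∀ q → class is-±2 q ≡ true → excess n q ≡ 0
    excess-±2 q e rewrite e | ∧-zeroʳ ⌊ q ≤? X ⌋ = refl

    excess-> : ∀ q → X < q → excess n q ≡ 0
    excess-> q X<q with q ≤? X
    ... | no _    = refl
    ... | yes q≤X = contradiction X<q (≤⇒≯ q≤X)

    excess-factor≤ : ∀ p → 1 ≤ p → prodTo X (λ k → p ^ excess n (p ^ k)) ≤ X * X
    excess-factor≤ p@(suc _) 1≤p = begin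
      prodTo X (λ k → p ^ excess n (p ^ k))
        ≤⟨ prodTo-mono X (λ k _ _ → ≤-trans (^-monoʳ-≤ p (excess≤2 (p ^ k))) (≤-reflexive (^-distribˡ-+-* p (ι (p ^ k ≤? X)) _))) ⟩
      prodTo X (λ k → p ^ ι (p ^ k ≤? X) * p ^ ι (p ^ k ≤? X))
        ≡⟨ prodTo-* X _ _ ⟩
      prodTo X (λ k → p ^ ι (p ^ k ≤? X)) * prodTo X (λ k → p ^ ι (p ^ k ≤? X))
        ≤⟨ *-mono-≤ (proj₁ (power-bound X 1≤X p 1≤p X)) (proj₁ (power-bound X 1≤X p 1≤p X)) ⟩
      X * X ∎

    -- A prime above s ≥ 5 is not 5, so outside ±1 it lies in ±2 and has no surplus itself. Its
    -- square lies in the class of ±1 and could have some, but p² already exceeds X.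
    excess-factor-1 : ∀ p → Prime p → s < p → class is-±1 p ≡ false → prodTo X (λ k → p ^ excess n (p ^ k)) ≡ 1
    excess-factor-1 p pp s<p ∉±1 = prodTo-1 X λ k 1≤k _ → cong (p ^_) (vanish k 1≤k)
      where
      instance
        p≢0 : NonZero p
        p≢0 = prime⇒nonZero pp
      ±2 : class is-±2 p ≡ true
      ±2 with p % 5 in e | m%n<n p 5
      ... | 0 | _ = contradiction (5∣p (m%n≡0⇒n∣m p 5 e)) λ ()
        where
        5∣p : 5 ∣ p → 5 ≡ 0
        5∣p d with prime⇒irreducible pp d
        ... | inj₂ refl = contradiction s<p (≤⇒≯ 5≤s)
      ... | 1 | _ = contradiction ∉±1 λ ()
      ... | 2 | _ = refl
      ... | 3 | _ = refl
      ... | 4 | _ = contradiction ∉±1 λ ()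
      ... | suc (suc (suc (suc (suc _)))) | s≤s (s≤s (s≤s (s≤s (s≤s ()))))
      vanish : ∀ k → 1 ≤ k → excess n (p ^ k) ≡ 0
      vanish 1 _ = excess-±2 (p ^ 1) (trans (cong (class is-±2) (*-identityʳ p)) ±2)
      vanish (suc (suc k)) _ = excess-> (p ^ suc (suc k)) (<-≤-trans X<s² (≤-trans (*-mono-≤ s<p s<p)
        (*-monoʳ-≤ p (m≤m*n p (p ^ k) {{m^n≢0 p k}}))))

    -- The primes that may contribute a factor X²: those ≡ ±1 (mod 5), and those up to √X, whose
    -- higher powers can carry a surplus whatever their class.
    multiplicity : ℕ → ℕ
    multiplicity p = ι (prime? p) * (b₁ p + ι (p ≤? s))

    V-excess : V X (excess n) ≤ X ^ (2 * sumTo X multiplicity)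
    V-excess = begin
      V X (excess n)
        ≤⟨ prodTo-mono X (λ p 1≤p _ → by p 1≤p) ⟩
      prodTo X (λ p → (X ^ 2) ^ multiplicity p)
        ≡⟨ prodTo-^ X (X ^ 2) multiplicity ⟩
      (X ^ 2) ^ sumTo X multiplicity
        ≡⟨ ^-*-assoc X 2 (sumTo X multiplicity) ⟩
      X ^ (2 * sumTo X multiplicity) ∎
      where
      once : ∀ p → 1 ≤ p → ∀ j → 1 ≤ j → prodTo X (λ k → p ^ excess n (p ^ k)) ≤ (X ^ 2) ^ (j + 0)
      once p 1≤p j 1≤j = ≤-trans (excess-factor≤ p 1≤p)
        (≤-trans (≤-reflexive (trans (cong (X *_) (sym (*-identityʳ X))) (sym (*-identityʳ (X ^ 2)))))
                 (^-monoʳ-≤ (X ^ 2) {{m^n≢0 X 2}} (≤-trans 1≤j (m≤m+n j 0))))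
      by : ∀ p → 1 ≤ p → onPrime p (prodTo X (λ k → p ^ excess n (p ^ k))) ≤ (X ^ 2) ^ multiplicity p
      by p 1≤p with prime? p
      ... | no _   = ≤-refl
      ... | yes pp with class is-±1 p in e | p ≤? s
      ...   | false | no p≰s = ≤-reflexive (excess-factor-1 p pp (≰⇒> p≰s) e)
      ...   | false | yes _  = once p 1≤p 1 (s≤s z≤n)
      ...   | true  | d      = once p 1≤p (1 + ι d) (s≤s z≤n)

  fct : ℕ → ℕ
  fct = P one

  fct-double-suc : ∀ m → fct (2 * suc m) ≡ fct (2 * m) * ((1 + 2 * m) * (2 + 2 * m))
  fct-double-suc m = trans (cong fct (*-suc 2 m)) (trans
    (cong₂ (λ a b → fct (2 * m) * a * b) (*-identityʳ (1 + 2 * m)) (*-identityʳ (2 + 2 * m))) (*-assoc (fct (2 * m)) _ _))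

  fct-suc-square : ∀ m → fct (suc m) ^ 2 ≡ suc m * suc m * fct m ^ 2
  fct-suc-square m = trans (cong (_^ 2) (cong (fct m *_) (*-identityʳ (suc m)))) (lemma (fct m) (suc m))
    where
    lemma : ∀ f m → (f * m) * ((f * m) * 1) ≡ m * m * (f * (f * 1))
    lemma = solve-∀

  -- The bound 4^m for the central binomial coefficient, free of division: each step multiplies that
  -- coefficient by 2 (2 m + 1) / (m + 1), which is below 4.
  central-upper : ∀ m → fct (2 * m) ≤ 4 ^ m * fct m ^ 2
  central-upper zero    = ≤-refl
  central-upper (suc m) = begin
    fct (2 * suc m)                                   ≡⟨ fct-double-suc m ⟩
    fct (2 * m) * ((1 + 2 * m) * (2 + 2 * m))         ≤⟨ *-mono-≤ (central-upper m) (*-monoˡ-≤ (2 + 2 * m) (n≤1+n (1 + 2 * m))) ⟩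
    4 ^ m * fct m ^ 2 * ((2 + 2 * m) * (2 + 2 * m))   ≡⟨ lemma (4 ^ m) (fct m ^ 2) m ⟩
    4 * 4 ^ m * (suc m * suc m * fct m ^ 2)           ≡⟨ cong (4 ^ suc m *_) (sym (fct-suc-square m)) ⟩
    4 ^ suc m * fct (suc m) ^ 2                       ∎
    where
    lemma : ∀ a f m → a * f * ((2 + 2 * m) * (2 + 2 * m)) ≡ 4 * a * ((1 + m) * (1 + m) * f)
    lemma = solve-∀

  central-lower : ∀ m → 4 ^ m * fct m ^ 2 ≤ (1 + 2 * m) * fct (2 * m)
  central-lower zero    = ≤-refl
  central-lower (suc m) = begin
    4 ^ suc m * fct (suc m) ^ 2                       ≡⟨ cong (4 ^ suc m *_) (fct-suc-square m) ⟩
    4 * 4 ^ m * (suc m * suc m * fct m ^ 2)           ≡⟨ lemma (4 ^ m) (fct m ^ 2) m ⟩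
    4 ^ m * fct m ^ 2 * ((2 + 2 * m) * (2 + 2 * m))   ≤⟨ *-mono-≤ (central-lower m) (*-monoˡ-≤ (2 + 2 * m) (n≤1+n (2 + 2 * m))) ⟩
    (1 + 2 * m) * fct (2 * m) * ((3 + 2 * m) * (2 + 2 * m)) ≡⟨ lemma′ (fct (2 * m)) m ⟩
    (1 + 2 * suc m) * (fct (2 * m) * ((1 + 2 * m) * (2 + 2 * m))) ≡⟨ cong ((1 + 2 * suc m) *_) (sym (fct-double-suc m)) ⟩
    (1 + 2 * suc m) * fct (2 * suc m)                 ∎
    where
    lemma : ∀ a f m → 4 * a * ((1 + m) * (1 + m) * f) ≡ a * f * ((2 + 2 * m) * (2 + 2 * m))
    lemma = solve-∀
    lemma′ : ∀ f m → (1 + 2 * m) * f * ((3 + 2 * m) * (2 + 2 * m)) ≡ (1 + 2 * (1 + m)) * (f * ((1 + 2 * m) * (2 + 2 * m)))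
    lemma′ = solve-∀

  b-periodic : ∀ (f : ℕ → Bool) i m → (if class f (i + m * 5) then 1 else 0) ≡ (if class f i then 1 else 0)
  b-periodic f i m = cong (λ r → if f r then 1 else 0) ([m+kn]%n≡m%n i m 5)

  P-b₁ : ∀ m → P b₁ (suc m * 5) ≡ P b₁ (m * 5) * ((1 + m * 5) * (4 + m * 5))
  P-b₁ m rewrite b-periodic is-±1 1 m | b-periodic is-±1 2 m | b-periodic is-±1 3 m | b-periodic is-±1 4 m | b-periodic is-±1 5 m =
    lemma (P b₁ (m * 5)) (m * 5)
    where
    lemma : ∀ p x → p * ((1 + x) * 1) * 1 * 1 * ((4 + x) * 1) * 1 ≡ p * ((1 + x) * (4 + x))
    lemma = solve-∀

  P-b₂ : ∀ m → P b₂ (suc m * 5) ≡ P b₂ (m * 5) * ((2 + m * 5) * (3 + m * 5))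
  P-b₂ m rewrite b-periodic is-±2 1 m | b-periodic is-±2 2 m | b-periodic is-±2 3 m | b-periodic is-±2 4 m | b-periodic is-±2 5 m =
    lemma (P b₂ (m * 5)) (m * 5)
    where
    lemma : ∀ p x → p * 1 * ((2 + x) * 1) * ((3 + x) * 1) * 1 * 1 ≡ p * ((2 + x) * (3 + x))
    lemma = solve-∀

  -- The character products cost only a polynomial factor: in each block of five, (5 m + 2) (5 m +
  -- 3) exceeds (5 m + 1) (5 m + 4) by just 2, and passing from 1 + m to 2 + m absorbs this.
  P-b₂≤P-b₁ : ∀ m → P b₂ (m * 5) ≤ (1 + m) * P b₁ (m * 5)
  P-b₂≤P-b₁ zero    = ≤-refl
  P-b₂≤P-b₁ (suc m) = begin
    P b₂ (suc m * 5)                                       ≡⟨ P-b₂ m ⟩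
    P b₂ (m * 5) * ((2 + m * 5) * (3 + m * 5))             ≤⟨ *-monoˡ-≤ ((2 + m * 5) * (3 + m * 5)) (P-b₂≤P-b₁ m) ⟩
    -- The added polynomial is the exact difference (2 + m) (1 + 5 m) (4 + 5 m) - (1 + m) (2 + 5 m)
    -- (3 + 5 m).
    (1 + m) * p * ((2 + m * 5) * (3 + m * 5))              ≤⟨ m≤m+n _ (p * (25 * m * m + 23 * m + 2)) ⟩
    (1 + m) * p * ((2 + m * 5) * (3 + m * 5)) + p * (25 * m * m + 23 * m + 2) ≡⟨ lemma p m ⟩
    (2 + m) * (p * ((1 + m * 5) * (4 + m * 5)))            ≡⟨ cong ((2 + m) *_) (sym (P-b₁ m)) ⟩
    (2 + m) * P b₁ (suc m * 5)                             ∎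
    where
    p = P b₁ (m * 5)
    lemma : ∀ p m → (1 + m) * p * ((2 + m * 5) * (3 + m * 5)) + p * (25 * m * m + 23 * m + 2) ≡ (2 + m) * (p * ((1 + m * 5) * (4 + m * 5)))
    lemma = solve-∀

  module _ (n : ℕ) where

    private
      X = 10 * n

    W : ℕ
    W = (1 + X) * (1 + 2 * n) * (1 + n) ^ 2

    -- (10 n)! / (5 n)!² supplies 4^(5 n), while (2 n)!³ / n!⁶ takes away at most 4^(3 n). `W`
    -- collects the polynomial losses of these bounds and of the character products.
    D-lower : 4 ^ (2 * n) * D n ≤ W * N n
    D-lower = begin
      4 ^ (2 * n) * (C ^ 2 * E ^ 3 * P b₂ X * P b₂ (5 * n) ^ 2)
        ≤⟨ *-monoʳ-≤ (4 ^ (2 * n)) (*-mono-≤ (*-mono-≤ (*-monoʳ-≤ (C ^ 2) (^-monoˡ-≤ 3 (central-upper n))) V₁) (^-monoˡ-≤ 2 V₂)) ⟩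
      4 ^ (2 * n) * (C ^ 2 * (4 ^ n * B ^ 2) ^ 3 * ((1 + 2 * n) * U₁) * ((1 + n) * U₂) ^ 2)
        ≡⟨ lemma (4 ^ (2 * n)) (4 ^ n) (C ^ 2) B (1 + 2 * n) U₁ (1 + n) U₂ ⟩
      (4 ^ (2 * n) * (4 ^ n * 4 ^ n * 4 ^ n) * C ^ 2) * ((1 + 2 * n) * (1 + n) ^ 2) * (B ^ 6 * U₁ * U₂ ^ 2)
        ≡⟨ cong (λ t → (t * C ^ 2) * ((1 + 2 * n) * (1 + n) ^ 2) * (B ^ 6 * U₁ * U₂ ^ 2)) fours ⟩
      (4 ^ (5 * n) * C ^ 2) * ((1 + 2 * n) * (1 + n) ^ 2) * (B ^ 6 * U₁ * U₂ ^ 2)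
        ≤⟨ *-monoˡ-≤ (B ^ 6 * U₁ * U₂ ^ 2) (*-monoˡ-≤ ((1 + 2 * n) * (1 + n) ^ 2) (central-lower (5 * n))) ⟩
      ((1 + 2 * (5 * n)) * fct (2 * (5 * n))) * ((1 + 2 * n) * (1 + n) ^ 2) * (B ^ 6 * U₁ * U₂ ^ 2)
        ≡⟨ cong (λ t → ((1 + t) * fct t) * ((1 + 2 * n) * (1 + n) ^ 2) * (B ^ 6 * U₁ * U₂ ^ 2)) (sym (*-assoc 2 5 n)) ⟩
      ((1 + X) * A) * ((1 + 2 * n) * (1 + n) ^ 2) * (B ^ 6 * U₁ * U₂ ^ 2)
        ≡⟨ lemma′ (1 + X) A (1 + 2 * n) (1 + n) B U₁ U₂ ⟩
      W * N n ∎
      where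
      A = fct X ; B = fct n ; C = fct (5 * n) ; E = fct (2 * n)
      U₁ = P b₁ X ; U₂ = P b₁ (5 * n)
      V₁ : P b₂ X ≤ (1 + 2 * n) * U₁
      V₁ = subst (λ t → P b₂ t ≤ (1 + 2 * n) * P b₁ t) (eq n) (P-b₂≤P-b₁ (2 * n))
        where
        eq : ∀ n → 2 * n * 5 ≡ 10 * n
        eq = solve-∀
      V₂ : P b₂ (5 * n) ≤ (1 + n) * U₂
      V₂ = subst (λ t → P b₂ t ≤ (1 + n) * P b₁ t) (*-comm n 5) (P-b₂≤P-b₁ n)
      fours : 4 ^ (2 * n) * (4 ^ n * 4 ^ n * 4 ^ n) ≡ 4 ^ (5 * n)
      fours = trans (cong (4 ^ (2 * n) *_) (trans (cong (_* 4 ^ n) (sym (^-distribˡ-+-* 4 n n))) (sym (^-distribˡ-+-* 4 (n + n) n))))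
        (trans (sym (^-distribˡ-+-* 4 (2 * n) (n + n + n))) (cong (4 ^_) (eq n)))
        where
        eq : ∀ n → 2 * n + (n + n + n) ≡ 5 * n
        eq = solve-∀
      lemma : ∀ f g c b x u y w → f * (c * ((g * (b * (b * 1))) * ((g * (b * (b * 1))) * ((g * (b * (b * 1))) * 1))) * (x * u) * ((y * w) * ((y * w) * 1)))
              ≡ (f * (g * g * g) * c) * (x * (y * (y * 1))) * ((b * (b * (b * (b * (b * (b * 1)))))) * u * (w * (w * 1)))
      lemma = solve-∀
      lemma′ : ∀ z a x y b u w → (z * a) * (x * (y * (y * 1))) * ((b * (b * (b * (b * (b * (b * 1)))))) * u * (w * (w * 1)))
               ≡ z * x * (y * (y * 1)) * (a * (b * (b * (b * (b * (b * (b * 1)))))) * u * (w * (w * 1)))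
      lemma′ = solve-∀

    four-power-bound : 4 ^ (2 * n) ≤ W * V X (excess n)
    four-power-bound = *-cancelʳ-≤ (4 ^ (2 * n)) (W * V X (excess n)) (D n) {{>-nonZero D>0}} (begin
      4 ^ (2 * n) * D n             ≤⟨ D-lower ⟩
      W * N n                       ≤⟨ *-monoʳ-≤ W (N≤D*V n) ⟩
      W * (D n * V X (excess n))    ≡⟨ lemma W (D n) (V X (excess n)) ⟩
      W * V X (excess n) * D n      ∎)
      where
      lemma : ∀ w d v → w * (d * v) ≡ w * v * d
      lemma = solve-∀
      pow>0 : ∀ a x k → 1 ≤ P a x ^ k
      pow>0 a x k = m^n>0 (P a x) {{>-nonZero (P>0 a x)}} k
      D>0 : 1 ≤ D n
      D>0 = *-mono-≤ (*-mono-≤ (*-mono-≤ (pow>0 one (5 * n) 2) (pow>0 one (2 * n) 3)) (P>0 b₂ X)) (pow>0 b₂ (5 * n) 2)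

    W≤X⁵ : 1 ≤ n → W ≤ X ^ 5
    W≤X⁵ 1≤n = begin
      (1 + X) * (1 + 2 * n) * (1 + n) ^ 2
        ≤⟨ *-mono-≤ (*-mono-≤ 1+X≤ (≤-trans (+-monoˡ-≤ (2 * n) 1≤n) (≤-trans (≤-reflexive (eq₁ n)) (*-monoˡ-≤ n (check {3} {10})))))
                    (^-monoˡ-≤ 2 (≤-trans (+-monoˡ-≤ n 1≤n) (≤-trans (≤-reflexive (eq₂ n)) (*-monoˡ-≤ n (check {2} {10}))))) ⟩
      (X * X) * X * X ^ 2
        ≡⟨ lemma X ⟩
      X ^ 5 ∎
      where
      eq₁ : ∀ n → n + 2 * n ≡ 3 * n
      eq₁ = solve-∀
      eq₂ : ∀ n → n + n ≡ 2 * n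
      eq₂ = solve-∀
      lemma : ∀ x → (x * x) * x * (x * (x * 1)) ≡ x * (x * (x * (x * (x * 1))))
      lemma = solve-∀
      1+X≤ : 1 + X ≤ X * X
      1+X≤ = ≤-trans (+-monoˡ-≤ X (≤-trans 1≤n (m≤n*m n 10))) (≤-trans (≤-reflexive (cong (X +_) (sym (+-identityʳ X))))
               (*-monoˡ-≤ X (≤-trans (check {2} {10}) (m≤m*n 10 n {{>-nonZero 1≤n}}))))

  Θ π πₛ : ℕ → ℕ
  Θ x = prodTo x (λ p → onPrime p p)
  π x = sumTo x (λ p → ι (prime? p))
  πₛ x = sumTo x (λ p → ι (prime? p) * b₁ p)

  onPrime≥1 : ∀ p → 1 ≤ p → 1 ≤ onPrime p p
  onPrime≥1 p 1≤p with prime? p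
  ... | yes _ = 1≤p
  ... | no _  = ≤-refl

  Θ-split : ∀ m j → Θ (m + j) ≤ Θ m * prodTo (m + j) (λ p → onPrime p (p ^ ι (m <? p)))
  Θ-split m zero rewrite +-identityʳ m = m≤m*n (Θ m) _ {{>-nonZero (prodTo-≥1 m λ { p@(suc _) _ → positive p })}}
    where
    positive : ∀ p .{{_ : NonZero p}} → 1 ≤ onPrime p (p ^ ι (m <? p))
    positive p with prime? p
    ... | yes _ = m^n>0 p (ι (m <? p))
    ... | no _  = ≤-refl
  Θ-split m (suc j) rewrite +-suc m j = begin
    Θ (m + j) * onPrime p p
      ≤⟨ *-monoˡ-≤ (onPrime p p) (Θ-split m j) ⟩
    Θ m * R * onPrime p p
      ≡⟨ *-assoc (Θ m) R (onPrime p p) ⟩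
    Θ m * (R * onPrime p p)
      ≡⟨ cong (λ t → Θ m * (R * onPrime p t)) (sym (trans (cong (p ^_) (ι-yes (m <? p) (s≤s (m≤m+n m j)))) (*-identityʳ p))) ⟩
    Θ m * (R * onPrime p (p ^ ι (m <? p))) ∎
    where
    p = suc (m + j)
    R = prodTo (m + j) (λ p → onPrime p (p ^ ι (m <? p)))

  prodTo-≥-first : ∀ x {f} → 1 ≤ x → (∀ j → 1 ≤ j → 1 ≤ f j) → f 1 ≤ prodTo x f
  prodTo-≥-first 1 {f} _ _ = ≤-reflexive (sym (*-identityˡ (f 1)))
  prodTo-≥-first (suc (suc x)) {f} _ e = ≤-trans (prodTo-≥-first (suc x) (s≤s z≤n) e)
    (m≤m*n (prodTo (suc x) f) (f (suc (suc x))) {{>-nonZero (e (suc (suc x)) (s≤s z≤n))}})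

  -- The primes in (m, 2 m] divide the central binomial coefficient: for m < q ≤ 2 m the floor ⌊2 m
  -- / q⌋ is positive and ⌊m / q⌋ is 0.
  Θ-double : ∀ m → 1 ≤ m → Θ (2 * m) ≤ Θ m * 4 ^ m
  Θ-double m 1≤m = begin
    Θ (2 * m)                ≡⟨ cong Θ (cong (m +_) (+-identityʳ m)) ⟩
    Θ (m + m)                ≤⟨ Θ-split m m ⟩
    Θ m * prodTo (m + m) (λ p → onPrime p (p ^ ι (m <? p)))
                             ≤⟨ *-monoʳ-≤ (Θ m) (≤-trans first Vτ≤) ⟩
    Θ m * 4 ^ m              ∎
    where
    X = m + m
    τ : ℕ → ℕ
    τ q = ι (m <? q) * ι (q ≤? X)
    first : prodTo X (λ p → onPrime p (p ^ ι (m <? p))) ≤ V X τ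
    first = prodTo-mono X λ { p@(suc _) _ p≤X → onPrime-mono p λ _ → ≤-trans
      (≤-reflexive (trans (cong (p ^_) (sym (trans (cong (ι (m <? p) *_) (ι-yes (p ≤? X) p≤X)) (*-identityʳ (ι (m <? p)))))) (cong (λ t → p ^ τ t) (sym (*-identityʳ p)))))
      (prodTo-≥-first X (≤-trans 1≤m (m≤m+n m m)) (λ k _ → m^n>0 p (τ (p ^ k)))) }
    halves : ∀ q .{{_ : NonZero q}} → 2 * (m / q) ≤ X / q
    halves q = ≤-trans (≤-reflexive (sym (m*n/n≡m (2 * (m / q)) q))) (/-monoˡ-≤ q (≤-trans (≤-reflexive (*-assoc 2 (m / q) q))
      (≤-trans (*-monoʳ-≤ 2 (m/n*n≤m m q)) (≤-reflexive (cong (m +_) (+-identityʳ m))))))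
    exponents : ∀ q → 1 ≤ q → 2 * exponent one m q + τ q ≤ exponent one X q
    exponents q@(suc _) _ rewrite sumTo-one (m / q) | sumTo-one (X / q) with m <? q | q ≤? X
    ... | yes m<q | yes q≤X = subst (λ t → 2 * t + 1 ≤ X / q) (sym (m<n⇒m/n≡0 m<q)) (m≥n⇒m/n>0 q≤X)
    ... | yes _   | no _    = ≤-trans (≤-reflexive (+-identityʳ _)) (halves q)
    ... | no _    | _       = ≤-trans (≤-reflexive (+-identityʳ _)) (halves q)
    Vτ≤ : V X τ ≤ 4 ^ m
    Vτ≤ = *-cancelˡ-≤ (fct m ^ 2) {{>-nonZero (m^n>0 (fct m) {{>-nonZero (P>0 one m)}} 2)}} (begin
      fct m ^ 2 * V X τ                        ≡⟨ cong (λ t → t ^ 2 * V X τ) (P≡V X one m (m≤m+n m m)) ⟩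
      V X (exponent one m) ^ 2 * V X τ         ≡⟨ cong (_* V X τ) (sym (V-* X (exponent one m) 2)) ⟩
      V X (λ q → 2 * exponent one m q) * V X τ ≡⟨ sym (V-+ X (λ q → 2 * exponent one m q) τ) ⟩
      V X (λ q → 2 * exponent one m q + τ q)   ≤⟨ V-mono X exponents ⟩
      V X (exponent one X)                     ≡⟨ sym (P≡V X one X ≤-refl) ⟩
      fct (m + m)                              ≡⟨ cong fct (cong (m +_) (sym (+-identityʳ m))) ⟩
      fct (2 * m)                              ≤⟨ central-upper m ⟩
      4 ^ m * fct m ^ 2                        ≡⟨ *-comm (4 ^ m) _ ⟩
      fct m ^ 2 * 4 ^ m                        ∎)

  Θ-mono : ∀ x j → Θ x ≤ Θ (j + x)
  Θ-mono x zero    = ≤-refl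
  Θ-mono x (suc j) = ≤-trans (Θ-mono x j) (m≤m*n (Θ (j + x)) _ {{>-nonZero (onPrime≥1 (suc (j + x)) (s≤s z≤n))}})

  -- Induction through m = ⌈x / 2⌉. The constant 3 leaves room for the rounding, as 3 m + m ≤ 3 x
  -- for x ≥ 2.
  Θ≤ : ∀ x → Θ x ≤ 4 ^ (3 * x)
  Θ≤ = <-rec _ step
    where
    step : ∀ x → (∀ {y} → y < x → Θ y ≤ 4 ^ (3 * y)) → Θ x ≤ 4 ^ (3 * x)
    step 0 _ = ≤-refl
    step 1 _ = check
    step x@(suc (suc x′)) rec = begin
      Θ x                      ≤⟨ subst (λ t → Θ x ≤ Θ t) (m∸n+n≡m x≤2m) (Θ-mono x (2 * m ∸ x)) ⟩
      Θ (2 * m)                ≤⟨ Θ-double m (s≤s z≤n) ⟩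
      Θ m * 4 ^ m              ≤⟨ *-monoˡ-≤ (4 ^ m) (rec m<x) ⟩
      4 ^ (3 * m) * 4 ^ m      ≡⟨ sym (^-distribˡ-+-* 4 (3 * m) m) ⟩
      4 ^ (3 * m + m)          ≤⟨ ^-monoʳ-≤ 4 4m≤3x ⟩
      4 ^ (3 * x)              ∎
      where
      h = suc x′ / 2
      m = suc h
      x≡ : suc x′ ≡ suc x′ % 2 + h * 2
      x≡ = m≡m%n+[m/n]*n (suc x′) 2
      x≤2m : x ≤ 2 * m
      x≤2m = begin
        suc (suc x′)                  ≡⟨ cong suc x≡ ⟩
        suc (suc x′ % 2 + h * 2)      ≤⟨ s≤s (+-monoˡ-≤ (h * 2) (≤-pred (m%n<n (suc x′) 2))) ⟩
        2 + h * 2                     ≡⟨ *-comm m 2 ⟩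
        2 * m                         ∎
      2h≤ : h * 2 ≤ suc x′
      2h≤ = m/n*n≤m (suc x′) 2
      m<x : m < x
      m<x = s≤s (m/n<m (suc x′) 2 ≤-refl)
      4m≤3x : 3 * m + m ≤ 3 * x
      4m≤3x = begin
        3 * m + m            ≡⟨ lemma h ⟩
        2 * (h * 2) + 4      ≤⟨ +-monoˡ-≤ 4 (*-monoʳ-≤ 2 2h≤) ⟩
        2 * suc x′ + 4       ≤⟨ m≤m+n _ x′ ⟩
        2 * suc x′ + 4 + x′  ≡⟨ lemma′ x′ ⟩
        3 * x                ∎
        where
        lemma : ∀ h → 3 * (1 + h) + (1 + h) ≡ 2 * (h * 2) + 4
        lemma = solve-∀
        lemma′ : ∀ x → 2 * (1 + x) + 4 + x ≡ 3 * (2 + x)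
        lemma′ = solve-∀

  sumTo-≤ : ∀ s x → sumTo x (λ p → ι (p ≤? s)) ≤ x × sumTo x (λ p → ι (p ≤? s)) ≤ s
  sumTo-≤ s zero    = z≤n , z≤n
  sumTo-≤ s (suc x) with sumTo-≤ s x | suc x ≤? s
  ... | le , _  | yes x<s = subst (_≤ suc x) (+-comm 1 _) (s≤s le) , subst (_≤ s) (+-comm 1 _) (≤-trans (s≤s le) x<s)
  ... | le , le′ | no _    = subst (_≤ suc x) (sym (+-identityʳ _)) (m≤n⇒m≤1+n le) , subst (_≤ s) (sym (+-identityʳ _)) le′

  -- Each prime above s contributes at least s + 1 to `Θ x`, and the primes up to s are paid for by
  -- the first factor. Powers of s + 1 take the place of logarithms.
  π-upper : ∀ s x → suc s ^ π x ≤ suc s ^ s * Θ x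
  π-upper s x = begin
    suc s ^ π x                                        ≡⟨ sym (prodTo-^ x (suc s) (λ p → ι (prime? p))) ⟩
    prodTo x (λ p → suc s ^ ι (prime? p))              ≤⟨ prodTo-mono x (λ p 1≤p _ → by p 1≤p) ⟩
    prodTo x (λ p → suc s ^ ι (p ≤? s) * onPrime p p)  ≡⟨ prodTo-* x (λ p → suc s ^ ι (p ≤? s)) (λ p → onPrime p p) ⟩
    prodTo x (λ p → suc s ^ ι (p ≤? s)) * Θ x          ≡⟨ cong (_* Θ x) (prodTo-^ x (suc s) (λ p → ι (p ≤? s))) ⟩
    suc s ^ sumTo x (λ p → ι (p ≤? s)) * Θ x           ≤⟨ *-monoˡ-≤ (Θ x) (^-monoʳ-≤ (suc s) (proj₂ (sumTo-≤ s x))) ⟩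
    suc s ^ s * Θ x                                    ∎
    where
    by : ∀ p → 1 ≤ p → suc s ^ ι (prime? p) ≤ suc s ^ ι (p ≤? s) * onPrime p p
    by p 1≤p with prime? p | p ≤? s
    ... | no _  | d      = ≤-trans (m^n>0 (suc s) (ι d)) (≤-reflexive (sym (*-identityʳ _)))
    ... | yes _ | yes _  = m≤m*n (suc s ^ 1) p {{>-nonZero 1≤p}}
    ... | yes _ | no p≰s = ≤-trans (≤-reflexive (*-identityʳ (suc s))) (≤-trans (≰⇒> p≰s) (≤-reflexive (sym (*-identityˡ p))))

  isqrt : ∀ X → ∃ λ s → s * s ≤ X × X < suc s * suc s
  isqrt zero    = 0 , z≤n , s≤s z≤n
  isqrt (suc X) with isqrt X
  ... | s , s²≤X , X<  with suc s * suc s ≤? suc X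
  ...   | yes le = suc s , le , ≤-<-trans X< (*-mono-< (n<1+n (suc s)) (n<1+n (suc s)))
  ...   | no  nle = s , m≤n⇒m≤1+n s²≤X , ≰⇒> nle

  ^-cancel-≤ : ∀ b i j → 2 ≤ b → b ^ i ≤ b ^ j → i ≤ j
  ^-cancel-≤ b i j 2≤b le with i ≤? j
  ... | yes i≤j = i≤j
  ... | no i≰j  = contradiction le (<⇒≱ (^-monoʳ-< b 2≤b (≰⇒> i≰j)))

  -- It yields s + 1 ≤ 2^⌊s / 23⌋ for s ≥ 184 = 23 · 8; the inequality still fails for exponent 7.
  23t+23≤2^t : ∀ k → 23 * (8 + k) + 23 ≤ 2 ^ (8 + k)
  23t+23≤2^t zero    = check
  23t+23≤2^t (suc k) = begin
    23 * (8 + suc k) + 23              ≡⟨ lemma k ⟩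
    (23 * (8 + k) + 23) + 23           ≤⟨ +-mono-≤ (23t+23≤2^t k) (≤-trans (m≤n+m 23 (23 * (8 + k))) (23t+23≤2^t k)) ⟩
    2 ^ (8 + k) + 2 ^ (8 + k)          ≡⟨ cong (2 ^ (8 + k) +_) (sym (+-identityʳ (2 ^ (8 + k)))) ⟩
    2 ^ (8 + suc k)                    ∎
    where
    lemma : ∀ k → 23 * (8 + (1 + k)) + 23 ≡ (23 * (8 + k) + 23) + 23
    lemma = solve-∀

  πₛ-mono : ∀ x j → πₛ x ≤ πₛ (j + x)
  πₛ-mono x zero    = ≤-refl
  πₛ-mono x (suc j) = ≤-trans (πₛ-mono x j) (m≤m+n (πₛ (j + x)) _)

  module _ (n s : ℕ) (1≤n : 1 ≤ n) (184≤s : 184 ≤ s) (s²≤X : s * s ≤ 10 * n) (X<s² : 10 * n < suc s * suc s) where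

    private
      X = 10 * n
      b = suc s
      K = sumTo X (multiplicity n s 1≤n (≤-trans check 184≤s) X<s²)
      instance
        X≢0 : NonZero X
        X≢0 = >-nonZero (≤-trans 1≤n (m≤n*m n 10))

    K≤ : K ≤ πₛ X + s
    K≤ = begin
      K ≤⟨ sumTo-mono X by ⟩
      sumTo X (λ p → ι (prime? p) * b₁ p + ι (p ≤? s))
        ≡⟨ sumTo-+ X (λ p → ι (prime? p) * b₁ p) (λ p → ι (p ≤? s)) ⟩
      πₛ X + sumTo X (λ p → ι (p ≤? s))
        ≤⟨ +-monoʳ-≤ (πₛ X) (proj₂ (sumTo-≤ s X)) ⟩
      πₛ X + s ∎
      where
      by : ∀ p → ι (prime? p) * (b₁ p + ι (p ≤? s)) ≤ ι (prime? p) * b₁ p + ι (p ≤? s)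
      by p with prime? p
      ... | yes _ = ≤-reflexive (trans (*-identityˡ _) (cong (_+ ι (p ≤? s)) (sym (*-identityˡ (b₁ p)))))
      ... | no _  = z≤n

    four-power≤ : 4 ^ (2 * n) ≤ b ^ (2 * (5 + 2 * K))
    four-power≤ = begin
      4 ^ (2 * n)                    ≤⟨ four-power-bound n ⟩
      W n * V X (excess n)           ≤⟨ *-mono-≤ (W≤X⁵ n 1≤n) (V-excess n s 1≤n (≤-trans check 184≤s) X<s²) ⟩
      X ^ 5 * X ^ (2 * K)            ≡⟨ sym (^-distribˡ-+-* X 5 (2 * K)) ⟩
      X ^ (5 + 2 * K)                ≤⟨ ^-monoˡ-≤ (5 + 2 * K) (≤-trans (<⇒≤ X<s²) (≤-reflexive (cong (b *_) (sym (*-identityʳ b))))) ⟩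
      (b ^ 2) ^ (5 + 2 * K)          ≡⟨ ^-*-assoc b 2 (5 + 2 * K) ⟩
      b ^ (2 * (5 + 2 * K))          ∎

    -- Otherwise 4^(2 n) ≤ (s + 1)^(9 s) ≤ 2^(9 s t) with t = s / 23, which contradicts s² ≤ 10 n.
    s≤πₛ : s ≤ πₛ X
    s≤πₛ with s ≤? πₛ X
    ... | yes le = le
    ... | no nle = contradiction 92n≤90n (<⇒≱ (*-monoˡ-< n {{>-nonZero 1≤n}} (check {92} {92})))
      where
      -- 23 is the least integer with 4 · 23 > 9 · 10, so that the bounds 4 n ≤ 9 s t and s² ≤ 10 n
      -- become incompatible.
      t = s / 23
      8≤t : 8 ≤ t
      8≤t = /-monoˡ-≤ 23 184≤s
      b≤2^t : b ≤ 2 ^ t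
      b≤2^t = begin
        suc s                          ≡⟨ cong suc (m≡m%n+[m/n]*n s 23) ⟩
        suc (s % 23) + t * 23          ≤⟨ +-monoˡ-≤ (t * 23) (m%n<n s 23) ⟩
        23 + t * 23                    ≡⟨ trans (+-comm 23 (t * 23)) (cong (_+ 23) (*-comm t 23)) ⟩
        23 * t + 23                    ≡⟨ cong (λ t → 23 * t + 23) (sym (m+[n∸m]≡n 8≤t)) ⟩
        23 * (8 + (t ∸ 8)) + 23        ≤⟨ 23t+23≤2^t (t ∸ 8) ⟩
        2 ^ (8 + (t ∸ 8))              ≡⟨ cong (2 ^_) (m+[n∸m]≡n 8≤t) ⟩
        2 ^ t                          ∎
      e≤9s : 2 * (5 + 2 * K) ≤ 9 * s
      e≤9s = begin
        2 * (5 + 2 * K)                ≤⟨ *-monoʳ-≤ 2 (+-monoʳ-≤ 5 (*-monoʳ-≤ 2 (≤-trans K≤ (+-monoˡ-≤ s (<⇒≤ (≰⇒> nle)))))) ⟩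
        2 * (5 + 2 * (s + s))          ≡⟨ lemma s ⟩
        10 + 8 * s                     ≤⟨ +-monoˡ-≤ (8 * s) (≤-trans (check {10} {184}) 184≤s) ⟩
        s + 8 * s                      ∎
        where
        lemma : ∀ s → 2 * (5 + 2 * (s + s)) ≡ 10 + 8 * s
        lemma = solve-∀
      4n≤t9s : 2 * (2 * n) ≤ t * (9 * s)
      4n≤t9s = ^-cancel-≤ 2 _ _ ≤-refl (begin
        2 ^ (2 * (2 * n))              ≡⟨ sym (^-*-assoc 2 2 (2 * n)) ⟩
        4 ^ (2 * n)                    ≤⟨ four-power≤ ⟩
        b ^ (2 * (5 + 2 * K))          ≤⟨ ^-monoʳ-≤ b e≤9s ⟩
        b ^ (9 * s)                    ≤⟨ ^-monoˡ-≤ (9 * s) b≤2^t ⟩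
        (2 ^ t) ^ (9 * s)              ≡⟨ ^-*-assoc 2 t (9 * s) ⟩
        2 ^ (t * (9 * s))              ∎)
      92n≤90n : 92 * n ≤ 91 * n
      92n≤90n = begin
        92 * n                         ≡⟨ lemma n ⟩
        2 * (2 * n) * 23               ≤⟨ *-monoˡ-≤ 23 4n≤t9s ⟩
        t * (9 * s) * 23               ≡⟨ lemma′ t s ⟩
        t * 23 * (9 * s)               ≤⟨ *-monoˡ-≤ (9 * s) (m/n*n≤m s 23) ⟩
        s * (9 * s)                    ≡⟨ lemma″ s ⟩
        9 * (s * s)                    ≤⟨ *-monoʳ-≤ 9 s²≤X ⟩
        9 * (10 * n)                   ≡⟨ sym (*-assoc 9 10 n) ⟩
        90 * n                         ≤⟨ *-monoˡ-≤ n (check {90} {91}) ⟩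
        91 * n                         ∎
        where
        lemma : ∀ n → 92 * n ≡ 2 * (2 * n) * 23
        lemma = solve-∀
        lemma′ : ∀ t s → t * (9 * s) * 23 ≡ t * 23 * (9 * s)
        lemma′ = solve-∀
        lemma″ : ∀ s → s * (9 * s) ≡ 9 * (s * s)
        lemma″ = solve-∀

    -- Everything is compared as a power of s + 1: Θ(x) ≤ 4^(3 x) ≤ (4^(2 n))^16, and `four-power≤`
    -- bounds the last number. The resulting 65 s + 160 + 64 `πₛ X` is at most 130 `πₛ X` because
    -- 160 ≤ s ≤ `πₛ X`; the hypothesis 14 ≤ n absorbs the 27 in 3 x ≤ 27 + 30 n.
    π≤130πₛ : ∀ x → x ≤ 9 + X → 14 ≤ n → π x ≤ 130 * πₛ X
    π≤130πₛ x x≤ 14≤n = begin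
      π x                                  ≤⟨ ^-cancel-≤ b (π x) (s + 32 * (5 + 2 * K)) (s≤s (≤-trans (check {1} {184}) 184≤s)) powers ⟩
      s + 32 * (5 + 2 * K)                 ≤⟨ +-monoʳ-≤ s (*-monoʳ-≤ 32 (+-monoʳ-≤ 5 (*-monoʳ-≤ 2 K≤))) ⟩
      s + 32 * (5 + 2 * (πₛ X + s))        ≡⟨ lemma s (πₛ X) ⟩
      (65 * s + 160) + 64 * πₛ X           ≤⟨ +-monoˡ-≤ (64 * πₛ X) (+-mono-≤ (*-monoʳ-≤ 65 s≤πₛ) (≤-trans (check {160} {184}) (≤-trans 184≤s s≤πₛ))) ⟩
      (65 * πₛ X + πₛ X) + 64 * πₛ X       ≡⟨ lemma′ (πₛ X) ⟩
      130 * πₛ X                           ∎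
      where
      lemma : ∀ s p → s + 32 * (5 + 2 * (p + s)) ≡ (65 * s + 160) + 64 * p
      lemma = solve-∀
      lemma′ : ∀ p → (65 * p + p) + 64 * p ≡ 130 * p
      lemma′ = solve-∀
      3x≤32n : 3 * x ≤ 2 * n * 16
      3x≤32n = begin
        3 * x                ≤⟨ *-monoʳ-≤ 3 x≤ ⟩
        3 * (9 + 10 * n)     ≡⟨ eq n ⟩
        27 + 30 * n          ≤⟨ +-monoˡ-≤ (30 * n) (≤-trans (check {27} {28}) (*-monoʳ-≤ 2 14≤n)) ⟩
        2 * n + 30 * n       ≡⟨ eq′ n ⟩
        2 * n * 16           ∎
        where
        eq : ∀ n → 3 * (9 + 10 * n) ≡ 27 + 30 * n
        eq = solve-∀
        eq′ : ∀ n → 2 * n + 30 * n ≡ 2 * n * 16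
        eq′ = solve-∀
      powers : b ^ π x ≤ b ^ (s + 32 * (5 + 2 * K))
      powers = begin
        b ^ π x                              ≤⟨ π-upper s x ⟩
        b ^ s * Θ x                          ≤⟨ *-monoʳ-≤ (b ^ s) (≤-trans (Θ≤ x) (^-monoʳ-≤ 4 3x≤32n)) ⟩
        b ^ s * 4 ^ (2 * n * 16)             ≡⟨ cong (b ^ s *_) (sym (^-*-assoc 4 (2 * n) 16)) ⟩
        b ^ s * (4 ^ (2 * n)) ^ 16           ≤⟨ *-monoʳ-≤ (b ^ s) (^-monoˡ-≤ 16 four-power≤) ⟩
        b ^ s * (b ^ (2 * (5 + 2 * K))) ^ 16 ≡⟨ cong (b ^ s *_) (^-*-assoc b (2 * (5 + 2 * K)) 16) ⟩
        b ^ s * b ^ (2 * (5 + 2 * K) * 16)   ≡⟨ sym (^-distribˡ-+-* b s (2 * (5 + 2 * K) * 16)) ⟩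
        b ^ (s + 2 * (5 + 2 * K) * 16)       ≡⟨ cong (λ e → b ^ (s + e)) (trans (*-comm (2 * (5 + 2 * K)) 16) (sym (*-assoc 16 2 (5 + 2 * K)))) ⟩
        b ^ (s + 32 * (5 + 2 * K))           ∎

  sum-snoc : ∀ f x → sum (applyUpTo f (suc x)) ≡ f 0 + sumTo x f
  sum-snoc f zero    = refl
  sum-snoc f (suc x) = trans (go f (suc x)) (trans (cong (_+ f (suc x)) (sum-snoc f x)) (+-assoc (f 0) (sumTo x f) (f (suc x))))
    where
    go : ∀ f x → sum (applyUpTo f (suc x)) ≡ sum (applyUpTo f x) + f x
    go f zero    = +-identityʳ (f 0)
    go f (suc x) = trans (cong (f 0 +_) (go (λ j → f (suc j)) x)) (sym (+-assoc (f 0) (sum (applyUpTo (λ j → f (suc j)) x)) (f (suc x))))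

  primeCount≡π : ∀ x → primeCount x ≡ π x
  primeCount≡π x = trans (cong sum (map-upTo f (suc x))) (trans (sum-snoc f x) (trans (cong (_+ sumTo x f) f0) (sumTo-cong x at)))
    where
    f : ℕ → ℕ
    f p = if ⌊ prime? p ⌋ then 1 else 0
    at : ∀ p → f p ≡ ι (prime? p)
    at p with prime? p
    ... | yes _ = refl
    ... | no _  = refl
    f0 : f 0 ≡ 0
    f0 = trans (at 0) (ι-no (prime? 0) ¬prime[0])

  primeCountIn≡πₛ : ∀ x → primeCountIn (class is-±1) x ≡ πₛ x
  primeCountIn≡πₛ x = trans (cong sum (map-upTo f (suc x))) (trans (sum-snoc f x) (trans (cong (_+ sumTo x f) f0) (sumTo-cong x at)))
    where
    f : ℕ → ℕ
    f p = if ⌊ prime? p ⌋ ∧ class is-±1 p then 1 else 0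
    at : ∀ p → f p ≡ ι (prime? p) * b₁ p
    at p with prime? p
    ... | yes _ = sym (+-identityʳ (b₁ p))
    ... | no _  = refl
    f0 : f 0 ≡ 0
    f0 = trans (at 0) (cong (_* b₁ 0) (ι-no (prime? 0) ¬prime[0]))

  -- Rounding x down to a multiple of 10 loses at most 9. From 40000 on the integer square root is
  -- at least 184, since 184² = 33856.
  positive-density : ∀ x → 40000 ≤ x → 1 * primeCount x ≤ 130 * primeCountIn (class is-±1) x
  positive-density x 40000≤x with isqrt (10 * (x / 10))
  ... | s , s²≤X , X<s² = begin
    1 * primeCount x         ≡⟨ trans (*-identityˡ (primeCount x)) (primeCount≡π x) ⟩
    π x                      ≤⟨ π≤130πₛ n s 1≤n 184≤s s²≤X X<s² x x≤ (≤-trans (toWitness {a? = 14 ≤? 4000} _) 4000≤n) ⟩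
    130 * πₛ X               ≤⟨ *-monoʳ-≤ 130 (subst (λ t → πₛ X ≤ πₛ t) (m∸n+n≡m X≤x) (πₛ-mono X (x ∸ X))) ⟩
    130 * πₛ x               ≡⟨ cong (130 *_) (sym (primeCountIn≡πₛ x)) ⟩
    130 * primeCountIn (class is-±1) x ∎
    where
    n = x / 10
    X = 10 * n
    4000≤n : 4000 ≤ n
    4000≤n = /-monoˡ-≤ 10 40000≤x
    1≤n : 1 ≤ n
    1≤n = ≤-trans (s≤s z≤n) 4000≤n
    X≤x : X ≤ x
    X≤x = ≤-trans (≤-reflexive (*-comm 10 n)) (m/n*n≤m x 10)
    x≤ : x ≤ 9 + X
    x≤ = begin
      x                   ≡⟨ m≡m%n+[m/n]*n x 10 ⟩
      x % 10 + n * 10     ≤⟨ +-mono-≤ (≤-pred (m%n<n x 10)) (≤-reflexive (*-comm n 10)) ⟩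
      9 + X               ∎
    184≤s : 184 ≤ s
    184≤s with 184 ≤? s
    ... | yes le = le
    ... | no nle = contradiction (≤-trans (*-monoʳ-≤ 10 4000≤n) (≤-trans (<⇒≤ X<s²) (*-mono-≤ (≰⇒> nle) (≰⇒> nle))))
                                 (<⇒≱ (toWitness {a? = 33857 ≤? 40000} _))

open import Defs
open import Data.Nat using (ℕ; _+_; _*_; _≤_; s≤s; z≤n; _%_)
open import Data.Nat.Primality using (Prime)
open import Data.Bool using (Bool; true)
open import Data.Product using (Σ; ∃-syntax; _×_; _,_)
open import Relation.Binary.PropositionalEquality using (_≡_)

open ResidueClasses using (class; is-±1; ±1-residue)

theorem1p2 : Σ (ℕ → Bool) λ S →
    (∃[ a ] ∃[ c ] ∃[ N ]
    (1 ≤ a) × (1 ≤ c) ×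
    (∀ x → N ≤ x → a * primeCount x ≤ c * primeCountIn S x))
    ×
    (∀ p → Prime p → S p ≡ true →
    ∃[ α ] ∃[ β ] ∀ n →
    b 25 (2 * p * n + α) % 2
    ≡ shiftDilateCoeff p β (λ m → b 25 (2 * m + 1)) n % 2)
theorem1p2 = class is-±1 , (1 , 130 , 40000 , s≤s z≤n , s≤s z≤n , PrimeCounts.positive-density) ,
  λ p p-prime p∈S → HeckeOperator.Hecke.regular-congruence p p-prime (±1-residue (p % 5) p∈S)
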